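{- There is an absolute constant $C$ such that for positive integers $k\le n$, in any $4$-graph $G$ on $n$ vertices with $e\ge Ckn^3$ edges one can find $t=\min\{k,d^{1/4}\}$ vertex-disjoint copies of $\mathit{St}_4(d,d,k)$, where $d=(n/k)^{1/3}$.
   Context: A $4$-graph is a $4$-uniform hypergraph. Generalised stars: $\mathit{St}_2(d)$ is the graph star with $d$ leaves; $\mathit{St}_r(d_1,\dots,d_{r-1})$ is the $r$-graph in which all edges contain a common vertex $v$ and removing $v$ from every edge yields $d_1$ vertex-disjoint copies of $\mathit{St}_{r-1}(d_2,\dots,d_{r-1})$. Non-integer quantities are rounded (floors and ceilings omitted). -}

module Defs where

open import Data.Nat using (ℕ; zero; suc; _+_; _*_; _^_; _≤_; _≤?_; _⊓_)
open import Data.Fin using (Fin)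
open import Data.Fin.Subset using (Subset; ⁅_⁆; _∪_; ∣_∣)
open import Data.List using (List)
open import Data.List.Relation.Unary.All using (All)
open import Data.List.Relation.Unary.Unique.Propositional using (Unique)
open import Data.List.Membership.Propositional using (_∈_)
open import Data.Unit using (⊤; tt)
open import Data.Sum using (_⊎_; inj₁; inj₂)
open import Data.Product using (_×_; _,_; Σ)
open import Relation.Binary.PropositionalEquality using (_≡_)
open import Relation.Nullary using (yes; no)
open import Function.Definitions using (Injective)

record FourGraph (n : ℕ) : Set where
  field
    edges   : List (Subset n)
    unique  : Unique edges
    uniform : All (λ e → ∣ e ∣ ≡ 4) edges
open FourGraph public

numEdges : ∀ {n} → FourGraph n → ℕ
numEdges G = Data.List.length (edges G)

maxBelow : (ℕ → ℕ) → ℕ → ℕ → ℕ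
maxBelow f m zero = zero
maxBelow f m (suc x) with f (suc x) ≤? m
... | yes _ = suc x
... | no  _ = maxBelow f m x

-- d = ⌊ (n/k)^{1/3} ⌋ : the largest d with k * d^3 ≤ n.
dParam : ℕ → ℕ → ℕ
dParam k n = maxBelow (λ x → k * x ^ 3) n n

root4 : ℕ → ℕ
root4 d = maxBelow (λ x → x ^ 4) d d

tParam : ℕ → ℕ → ℕ
tParam k n = k ⊓ root4 (dParam k n)

-- Vertex set of St_4(d₁,d₂,d₃): centre v; level-1 vertices u_i (i<d₁);
-- level-2 vertices w_{ij} (j<d₂); leaves x_{ijl} (l<d₃).
StarV : ℕ → ℕ → ℕ → Set
StarV d₁ d₂ d₃ = ⊤ ⊎ (Fin d₁ ⊎ ((Fin d₁ × Fin d₂) ⊎ (Fin d₁ × Fin d₂ × Fin d₃)))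

-- The edges of St_4(d₁,d₂,d₃) are exactly {v, u_i, w_{ij}, x_{ijl}}.
-- t vertex-disjoint copies of St_4(d₁,d₂,d₃) in G: an injective map from
-- the disjoint union of t copies of the vertex set into Fin n sending
-- every edge of every copy to an edge of G.
DisjointStarCopies : ∀ {n} → FourGraph n → ℕ → ℕ → ℕ → ℕ → Set
DisjointStarCopies {n} G t d₁ d₂ d₃ =
  Σ (Fin t × StarV d₁ d₂ d₃ → Fin n) λ f →
    Injective _≡_ _≡_ f
    × (∀ (s : Fin t) (i : Fin d₁) (j : Fin d₂) (l : Fin d₃) →
         (⁅ f (s , inj₁ tt) ⁆ ∪ ⁅ f (s , inj₂ (inj₁ i)) ⁆
           ∪ ⁅ f (s , inj₂ (inj₂ (inj₁ (i , j)))) ⁆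
           ∪ ⁅ f (s , inj₂ (inj₂ (inj₂ (i , j , l)))) ⁆) ∈ edges G)

{-# OPTIONS --safe #-}

-- Suppose there are no t disjoint stars.  Call a triple high if its codegree
-- exceeds the number ζ of vertices of t stars, and a pair vu an A-pair if very
-- many edges at vu contain no high triple vuw.  By greedy embedding, neither the
-- A-pairs contain t disjoint d-stars, nor the high triples t disjoint two-level
-- stars (v; uᵢ; wᵢⱼ), nor do t vertices v have links each containing d disjoint
-- St₃(d,k) avoiding any ζ vertices.  So apart from few "rich" vertices, a vertex
-- has few A-pairs and high triples, and few edges avoiding both.  The bound on the
-- latter loses a factor t³, which is affordable only at the few heavy vertices,
-- those of degree at least about k n² d / t: this is where t⁴ ≤ d enters.  The set
-- Z of vertices of a maximal family of disjoint stars has few edges at its light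
-- vertices, and the edges avoiding Z contain no star at all.  For those the same
-- analysis with t = 1 loses nothing and applies to every vertex.

module Submission where

open import Defs
open import Data.Nat using (ℕ; _*_; _^_; _≤_)
open import Data.Product using (∃-syntax)

import Algebra.Properties.CommutativeMonoid.Sum as MonoidSum
import Algebra.Properties.Semiring.Sum as SemiringSum
open import Data.Bool using (Bool; true; false; _∧_; _∨_; not) renaming (_≟_ to _≟ᵇ_)
open import Data.Bool.Properties using (∨-zeroʳ)
open import Data.Empty using (⊥; ⊥-elim)
open import Data.Fin using (Fin; zero; suc; _≟_; fromℕ<)
open import Data.Fin.Properties using (any?; all?; +↔⊎; *↔×; 1↔⊤; toℕ<n)
open import Data.Nat using (zero; suc; _+_; _<_; _≤?_; _<?_; z≤n; s≤s; >-nonZero)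
open import Data.Nat.Properties hiding (_≟_)
open import Data.Nat.Tactic.RingSolver using (solve-∀)
open import Data.Product using (Σ; ∃; _×_; _,_; proj₁; proj₂)
open import Data.Product.Function.NonDependent.Propositional using (_×-↔_)
open import Data.Sum using (_⊎_; inj₁; inj₂; [_,_]′)
open import Data.Sum.Function.Propositional using (_⊎-↔_)
open import Data.Unit using (⊤; tt)
open import Data.Vec.Functional using () renaming (_∷_ to _∷ᶠ_)
open import Data.Vec.Properties using (≡-dec)
open import Function using (_∘_; _↔_; Inverse)
open import Function.Definitions using (Injective)
open import Function.Properties.Inverse using (↔-refl; ↔-trans)
open import Relation.Binary.PropositionalEquality
  using (_≡_; _≢_; refl; sym; trans; cong; cong₂; subst; subst₂)
open import Relation.Nullary using (¬_; Dec; yes; no; does)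
open import Relation.Nullary.Decidable using (dec-true; decidable-stable; map′; _×-dec_; _→-dec_)

-- Every bound below is an inequality of naturals, hence stable, so excluded
-- middle may be used while proving it.

-- The factor t³ comes from the thresholds: ζ is of order t d² k and α of order t² d k n, and
-- deleting ζ vertices of degree α from a link costs their product, which is at most of order t³ k
-- n². The degree that makes a vertex heavy exceeds eight times the resulting bound on the edges
-- counted there, so these edges are absorbed into the total instead of being bounded. A-pairs would
-- bring in a further factor t, since an unexceptional vertex may lie in about t d of them. So a set
-- `Y` of order t d² is deleted that meets every d-star of A-pairs and every two-level star of high
-- triples; outside `Y`, a vertex has at most d A-neighbours. The vertices of `Y` keep the weaker
-- bound and are few enough for it. For t = 1 every vertex takes part, and d n² edges through
-- A-pairs at each of n vertices would be too many when d exceeds k. An edge therefore counts as bad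
-- only if it is bad at all four of its vertices, and of such edges there are only order n³.

_>>=_ : ∀ {A B : Set} → ¬ ¬ A → (A → ¬ ¬ B) → ¬ ¬ B
(m >>= f) k = m λ a → f a k

em : ∀ {A : Set} → ¬ ¬ Dec A
em k = k (no λ a → k (yes a))

em-Fin : ∀ {n} (P : Fin n → Set) → ¬ ¬ (∀ i → Dec (P i))
em-Fin {zero}  P k = k λ ()
em-Fin {suc n} P k = em λ p → em-Fin (P ∘ suc) λ ps → k λ { zero → p ; (suc i) → ps i }

≤-stable : ∀ {a b} → ¬ ¬ (a ≤ b) → a ≤ b
≤-stable = decidable-stable (_ ≤? _)

-- Boolean predicates and their indicators

true≢false : ∀ {b} → b ≡ true → b ≡ false → ⊥
true≢false refl ()

≢false⇒true : ∀ {b} → ¬ (b ≡ false) → b ≡ true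
≢false⇒true {true}  _ = refl
≢false⇒true {false} h = ⊥-elim (h refl)

¬true⇒false : ∀ {b} → ¬ (b ≡ true) → b ≡ false
¬true⇒false {false} _ = refl
¬true⇒false {true}  h = ⊥-elim (h refl)

∧⁺ : ∀ {a b} → a ≡ true → b ≡ true → a ∧ b ≡ true
∧⁺ refl refl = refl

∧⁻ˡ : ∀ {a b} → a ∧ b ≡ true → a ≡ true
∧⁻ˡ {true} _ = refl

∧⁻ʳ : ∀ {a b} → a ∧ b ≡ true → b ≡ true
∧⁻ʳ {true} p = p

∨⁺ˡ : ∀ {a b} → a ≡ true → a ∨ b ≡ true
∨⁺ˡ refl = refl

∨⁺ʳ : ∀ {a b} → b ≡ true → a ∨ b ≡ true
∨⁺ʳ {a} refl = ∨-zeroʳ a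

∨⁻ : ∀ {a b} → a ∨ b ≡ true → a ≡ true ⊎ b ≡ true
∨⁻ {true}  _ = inj₁ refl
∨⁻ {false} p = inj₂ p

∨-false⁻ˡ : ∀ {a b} → a ∨ b ≡ false → a ≡ false
∨-false⁻ˡ {false} _ = refl

∨-false⁻ʳ : ∀ {a b} → a ∨ b ≡ false → b ≡ false
∨-false⁻ʳ {false} p = p

∨-false⁺ : ∀ {a b} → a ≡ false → b ≡ false → a ∨ b ≡ false
∨-false⁺ refl refl = refl

not⁺ : ∀ {b} → b ≡ false → not b ≡ true
not⁺ refl = refl

not⁻ : ∀ {b} → not b ≡ true → b ≡ false
not⁻ {false} _ = refl

true⊎false : ∀ b → b ≡ true ⊎ b ≡ false
true⊎false true  = inj₁ refl
true⊎false false = inj₂ refl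

does⁻ : ∀ {A : Set} {d : Dec A} → does d ≡ true → A
does⁻ {d = yes a} _ = a

does-false⁻ : ∀ {A : Set} {d : Dec A} → does d ≡ false → ¬ A
does-false⁻ {d = no ¬a} _ = ¬a

⟦_⟧ : Bool → ℕ
⟦ true  ⟧ = 1
⟦ false ⟧ = 0

_▹_ : Bool → ℕ → ℕ
true  ▹ m = m
false ▹ m = 0

infixr 7 _▹_

⟦⟧≤ : ∀ {b m} → (b ≡ true → 1 ≤ m) → ⟦ b ⟧ ≤ m
⟦⟧≤ {true}  h = h refl
⟦⟧≤ {false} h = z≤n

1≤⟦⟧ : ∀ {b} → b ≡ true → 1 ≤ ⟦ b ⟧
1≤⟦⟧ refl = ≤-refl

⟦⟧-mono : ∀ {a b} → (a ≡ true → b ≡ true) → ⟦ a ⟧ ≤ ⟦ b ⟧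
⟦⟧-mono h = ⟦⟧≤ (1≤⟦⟧ ∘ h)

1≤▹ : ∀ {b m} → b ≡ true → 1 ≤ m → 1 ≤ b ▹ m
1≤▹ refl h = h

▹≤ : ∀ b {m} → b ▹ m ≤ m
▹≤ true  = ≤-refl
▹≤ false = z≤n

▹-mono : ∀ b {m m′} → (b ≡ true → m ≤ m′) → b ▹ m ≤ b ▹ m′
▹-mono true  h = h refl
▹-mono false h = z≤n

▹-⟦⟧ : ∀ b c → b ▹ ⟦ c ⟧ ≡ ⟦ b ∧ c ⟧
▹-⟦⟧ true  c = refl
▹-⟦⟧ false c = refl

-- Finite sums and sizes of vertex sets

opaque
  sum : ∀ {n} → (Fin n → ℕ) → ℕ
  sum = MonoidSum.sum +-0-commutativeMonoid

#_ : ∀ {n} → (Fin n → Bool) → ℕ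
# p = sum λ i → ⟦ p i ⟧

infix 8 #_

opaque
  unfolding sum

  sum-mono : ∀ {n} {f g : Fin n → ℕ} → (∀ i → f i ≤ g i) → sum f ≤ sum g
  sum-mono {zero}  h = z≤n
  sum-mono {suc n} h = +-mono-≤ (h zero) (sum-mono (h ∘ suc))

  sum-const : ∀ n c → sum {n} (λ _ → c) ≡ n * c
  sum-const zero    c = refl
  sum-const (suc n) c = cong (c +_) (sum-const n c)

  sum-+ : ∀ {n} (f g : Fin n → ℕ) → sum (λ i → f i + g i) ≡ sum f + sum g
  sum-+ = MonoidSum.∑-distrib-+ +-0-commutativeMonoid

  sum-swap : ∀ {m n} (f : Fin m → Fin n → ℕ) → sum (λ i → sum (f i)) ≡ sum (λ j → sum λ i → f i j)
  sum-swap = MonoidSum.∑-comm +-0-commutativeMonoid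

  sum-*ʳ : ∀ {n} (f : Fin n → ℕ) c → sum (λ i → f i * c) ≡ sum f * c
  sum-*ʳ f c = sym (SemiringSum.*-distribʳ-sum +-*-semiring c f)

  ≤-sum : ∀ {n} (f : Fin n → ℕ) i → f i ≤ sum f
  ≤-sum f zero    = m≤m+n _ _
  ≤-sum f (suc i) = ≤-trans (≤-sum (f ∘ suc) i) (m≤n+m _ _)

  ｛_｝ : ∀ {n} → Fin n → Fin n → Bool
  ｛ v ｝ x = does (v ≟ x)

  ｛｝⁺ : ∀ {n} (v : Fin n) → ｛ v ｝ v ≡ true
  ｛｝⁺ v = dec-true (v ≟ v) refl

  #｛｝≤1 : ∀ {n} (v : Fin n) → # ｛ v ｝ ≤ 1
  #｛｝≤1 {suc n} zero = s≤s (≤-reflexive (trans (sum-const n 0) (*-zeroʳ n)))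
  #｛｝≤1 {suc n} (suc v) = ≤-trans (sum-mono step) (#｛｝≤1 v)
    where
    step : ∀ i → ⟦ does (suc v ≟ suc i) ⟧ ≤ ⟦ does (v ≟ i) ⟧
    step i with v ≟ i
    ... | yes _ = ≤-refl
    ... | no  _ = ≤-refl

sum-≤ : ∀ {n} {f : Fin n → ℕ} {c} → (∀ i → f i ≤ c) → sum f ≤ n * c
sum-≤ {n} {c = c} h = ≤-trans (sum-mono h) (≤-reflexive (sum-const n c))

sum-▹ : ∀ {n} b {f : Fin n → ℕ} → sum (λ i → b ▹ f i) ≡ b ▹ sum f
sum-▹ true  = refl
sum-▹ {n} false = trans (sum-const n 0) (*-zeroʳ n)

▹sum-≤ : ∀ {n} (p : Fin n → Bool) {f : Fin n → ℕ} {c} → (∀ i → p i ≡ true → f i ≤ c)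
       → sum (λ i → p i ▹ f i) ≤ # p * c
▹sum-≤ p {f} {c} h = ≤-trans (sum-mono pointwise) (≤-reflexive (sum-*ʳ (λ i → ⟦ p i ⟧) c))
  where
  pointwise : ∀ i → p i ▹ f i ≤ ⟦ p i ⟧ * c
  pointwise i with p i | h i
  ... | true  | hi = ≤-trans (hi refl) (≤-reflexive (sym (*-identityˡ c)))
  ... | false | _  = z≤n

#-mono : ∀ {n} {p q : Fin n → Bool} → (∀ i → p i ≡ true → q i ≡ true) → # p ≤ # q
#-mono h = sum-mono λ i → ⟦⟧-mono (h i)

#≤n : ∀ {n} (p : Fin n → Bool) → # p ≤ n
#≤n p = ≤-trans (sum-≤ λ i → ⟦⟧≤ λ _ → ≤-refl) (≤-reflexive (*-identityʳ _))

#-cover : ∀ {n} {p q r : Fin n → Bool} → (∀ i → p i ≡ true → q i ≡ true ⊎ r i ≡ true)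
        → # p ≤ # q + # r
#-cover {p = p} {q} {r} h = ≤-trans (sum-mono pointwise) (≤-reflexive (sum-+ (λ i → ⟦ q i ⟧) (λ i → ⟦ r i ⟧)))
  where
  pointwise : ∀ i → ⟦ p i ⟧ ≤ ⟦ q i ⟧ + ⟦ r i ⟧
  pointwise i = ⟦⟧≤ λ pi →
    [ (λ qi → ≤-trans (1≤⟦⟧ qi) (m≤m+n _ _)) , (λ ri → ≤-trans (1≤⟦⟧ ri) (m≤n+m _ _)) ]′ (h i pi)

_∪ᵇ_ : ∀ {n} → (Fin n → Bool) → (Fin n → Bool) → Fin n → Bool
(p ∪ᵇ q) x = p x ∨ q x

infixr 6 _∪ᵇ_

_∖_ : ∀ {n} → (Fin n → Bool) → (Fin n → Bool) → Fin n → Bool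
(p ∖ q) x = p x ∧ not (q x)

∖⁻ˡ : ∀ {n} (p q : Fin n → Bool) {x} → (p ∖ q) x ≡ true → p x ≡ true
∖⁻ˡ p q = ∧⁻ˡ

∖⁻ʳ : ∀ {n} (p q : Fin n → Bool) {x} → (p ∖ q) x ≡ true → q x ≡ false
∖⁻ʳ p q {x} h = not⁻ (∧⁻ʳ {p x} h)

∅ : ∀ {n} → Fin n → Bool
∅ _ = false

#∅ : ∀ n → # (∅ {n}) ≡ 0
#∅ n = trans (sum-const n 0) (*-zeroʳ n)

#∪≤ : ∀ {n} (p q : Fin n → Bool) → # (p ∪ᵇ q) ≤ # p + # q
#∪≤ p q = #-cover {r = q} λ i → ∨⁻

#≤#∖+# : ∀ {n} (p q : Fin n → Bool) → # p ≤ # (p ∖ q) + # q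
#≤#∖+# p q = #-cover {r = q} λ i pi → [ inj₂ , (λ ¬q → inj₁ (∧⁺ pi (not⁺ ¬q))) ]′ (true⊎false (q i))

#<⇒∃∖ : ∀ {n} {p q : Fin n → Bool} → # q < # p → ∃[ x ] p x ≡ true × q x ≡ false
#<⇒∃∖ {p = p} {q} h with any? (λ x → (p ∖ q) x ≟ᵇ true)
... | yes (x , px∖q) = x , ∧⁻ˡ px∖q , not⁻ (∧⁻ʳ {p x} px∖q)
... | no ¬∃ = ⊥-elim (<⇒≱ h (#-mono λ i pi → ≢false⇒true λ qi → ¬∃ (i , ∧⁺ pi (not⁺ qi))))

-- Disjoint copies, greedy embedding and maximal families

_×ᶠ_ : ∀ {a b} {A B : Set} → Fin a ↔ A → Fin b ↔ B → Fin (a * b) ↔ (A × B)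
_×ᶠ_ {a} {b} A B = ↔-trans (*↔× {a} {b}) (A ×-↔ B)

_⊎ᶠ_ : ∀ {a b} {A B : Set} → Fin a ↔ A → Fin b ↔ B → Fin (a + b) ↔ (A ⊎ B)
_⊎ᶠ_ {a} {b} A B = ↔-trans (+↔⊎ {a} {b}) (A ⊎-↔ B)

infixr 6 _×ᶠ_
infixr 5 _⊎ᶠ_

finᶠ : ∀ {m} → Fin m ↔ Fin m
finᶠ = ↔-refl

module _ {n : ℕ} where

  opaque
    image : ∀ {m} {I : Set} → Fin m ↔ I → (I → Fin n) → Fin n → Bool
    image e f x = does (any? λ j → f (Inverse.to e j) ≟ x)

    image⁺ : ∀ {m} {I : Set} (e : Fin m ↔ I) f i → image e f (f i) ≡ true
    image⁺ e f i = dec-true (any? λ j → f (Inverse.to e j) ≟ f i)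
      (Inverse.from e i , cong f (Inverse.strictlyInverseˡ e i))

    image⁻ : ∀ {m} {I : Set} (e : Fin m ↔ I) f {x} → image e f x ≡ true → ∃[ i ] f i ≡ x
    image⁻ e f {x} h with does⁻ {d = any? λ j → f (Inverse.to e j) ≟ x} h
    ... | j , eq = Inverse.to e j , eq

  #image≤ : ∀ {m} {I : Set} (e : Fin m ↔ I) f → # image e f ≤ m
  #image≤ {m} e f = begin
    sum (λ x → ⟦ image e f x ⟧)                                ≤⟨ sum-mono pointwise ⟩
    sum (λ x → sum λ j → ⟦ ｛ f (Inverse.to e j) ｝ x ⟧)       ≡⟨ sum-swap (λ x j → ⟦ ｛ f (Inverse.to e j) ｝ x ⟧) ⟩
    sum (λ j → # ｛ f (Inverse.to e j) ｝)                     ≤⟨ sum-≤ (λ j → #｛｝≤1 (f (Inverse.to e j))) ⟩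
    m * 1                                                      ≡⟨ *-identityʳ m ⟩
    m                                                          ∎
    where
    open ≤-Reasoning
    pointwise : ∀ x → ⟦ image e f x ⟧ ≤ sum λ j → ⟦ ｛ f (Inverse.to e j) ｝ x ⟧
    pointwise x = ⟦⟧≤ λ h → let (i , fi≡x) = image⁻ e f h in
      ≤-trans (1≤⟦⟧ (subst (λ y → ｛ y ｝ x ≡ true)
                 (sym (trans (cong f (Inverse.strictlyInverseˡ e i)) fi≡x)) (｛｝⁺ x)))
              (≤-sum (λ j → ⟦ ｛ f (Inverse.to e j) ｝ x ⟧) (Inverse.from e i))

  image-false⁻ : ∀ {m} {I : Set} (e : Fin m ↔ I) f {x} → image e f x ≡ false → ∀ i → f i ≢ x
  image-false⁻ e f h i refl = true≢false (image⁺ e f i) h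

  -- One notion serves stars of every uniformity and their disjoint unions: the shape is the index
  -- type, `P` carries the edges, and `Z` holds the vertices already spent.
  record Copy (I : Set) (P : (I → Fin n) → Set) (Z : Fin n → Bool) : Set where
    constructor copy
    field
      at    : I → Fin n
      inj   : Injective _≡_ _≡_ at
      avoid : ∀ i → Z (at i) ≡ false
      prop  : P at
  open Copy public

  reindex : ∀ {I K : Set} {P : (I → Fin n) → Set} {Q : (K → Fin n) → Set} {Z}
            (h : K → I) (g : I → K) → (∀ x → g (h x) ≡ x) → (∀ f → P f → Q (f ∘ h))
          → Copy I P Z → Copy K Q Z
  reindex h g gh P⇒Q (copy f f-inj f-av p) =
    copy (f ∘ h) (λ {x} {y} eq → trans (sym (gh x)) (trans (cong g (f-inj eq)) (gh y)))
         (f-av ∘ h) (P⇒Q f p)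

  weaken : ∀ {I : Set} {P P′ : (I → Fin n) → Set} {Z Z′} → (∀ f → P f → P′ f)
         → (∀ f → P f → ∀ i → Z′ (f i) ≡ false) → Copy I P Z → Copy I P′ Z′
  weaken P⇒P′ P⇒Z′ (copy f f-inj _ p) = copy f f-inj (P⇒Z′ f p) (P⇒P′ f p)

  map-prop : ∀ {I : Set} {P P′ : (I → Fin n) → Set} {Z} → (∀ f → P f → P′ f) → Copy I P Z → Copy I P′ Z
  map-prop h (copy f f-inj f-av p) = copy f f-inj f-av (h f p)

  shrink : ∀ {I : Set} {P : (I → Fin n) → Set} {Z Z′} → (∀ v → Z v ≡ false → Z′ v ≡ false) → Copy I P Z → Copy I P Z′
  shrink h (copy f f-inj f-av p) = copy f f-inj (λ i → h (f i) (f-av i)) p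

  -- `Q` may depend on the first map, so that the second copy can be attached to vertices chosen
  -- before.
  join : ∀ {s} {I J : Set} {P : (I → Fin n) → Set} {Q : (I → Fin n) → (J → Fin n) → Set}
         (e : Fin s ↔ I) {Z} (c : Copy I P Z) → Copy J (Q (at c)) (Z ∪ᵇ image e (at c))
       → Copy (I ⊎ J) (λ f → P (f ∘ inj₁) × Q (f ∘ inj₁) (f ∘ inj₂)) Z
  join e {Z} (copy f f-inj f-av p) (copy g g-inj g-av q) =
    copy fg fg-inj (λ { (inj₁ i) → f-av i ; (inj₂ j) → ∨-false⁻ˡ (g-av j) }) (p , q)
    where
    fg = [ f , g ]′
    f≢g : ∀ i j → f i ≢ g j
    f≢g i j = image-false⁻ e f (∨-false⁻ʳ {Z (g j)} (g-av j)) i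
    fg-inj : Injective _≡_ _≡_ fg
    fg-inj {inj₁ x} {inj₁ y} eq = cong inj₁ (f-inj eq)
    fg-inj {inj₁ x} {inj₂ y} eq = ⊥-elim (f≢g x y eq)
    fg-inj {inj₂ x} {inj₁ y} eq = ⊥-elim (f≢g y x (sym eq))
    fg-inj {inj₂ x} {inj₂ y} eq = cong inj₂ (g-inj eq)

  Each : ∀ {J I : Set} → (J → (I → Fin n) → Set) → (J × I → Fin n) → Set
  Each P f = ∀ j → P j (λ i → f (j , i))

  Family : (J : Set) {I : Set} → (J → (I → Fin n) → Set) → (Fin n → Bool) → Set
  Family J {I} P = Copy (J × I) (Each P)

  Family-[] : ∀ {I : Set} (P : Fin 0 → (I → Fin n) → Set) {Z} → Family (Fin 0) P Z
  Family-[] P = copy (λ ()) (λ { {()} }) (λ ()) (λ ())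

  Family-∷ : ∀ {m s} {I : Set} (e : Fin s ↔ I) (P : Fin (suc m) → (I → Fin n) → Set) {Z}
             (c : Family (Fin m) (P ∘ suc) Z)
           → Copy I (P zero) (Z ∪ᵇ image (finᶠ ×ᶠ e) (at c)) → Family (Fin (suc m)) P Z
  Family-∷ {m} {s} {I} e P {Z} c c₀ =
    reindex to from from∘to (λ { f (ps , p) zero → p ; f (ps , p) (suc j) → ps j })
      (join {Q = λ _ → P zero} (finᶠ ×ᶠ e) c c₀)
    where
    to : Fin (suc m) × I → (Fin m × I) ⊎ I
    to (zero  , i) = inj₂ i
    to (suc j , i) = inj₁ (j , i)
    from : (Fin m × I) ⊎ I → Fin (suc m) × I
    from (inj₂ i) = zero , i
    from (inj₁ (j , i)) = suc j , i
    from∘to : ∀ x → from (to x) ≡ x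
    from∘to (zero  , i) = refl
    from∘to (suc j , i) = refl

  #∪image≤ : ∀ {s} {I : Set} (e : Fin s ↔ I) Z f → # (Z ∪ᵇ image e f) ≤ # Z + s
  #∪image≤ e Z f = ≤-trans (#∪≤ Z (image e f)) (+-monoʳ-≤ (# Z) (#image≤ e f))

  -- The forbidden set is `Z` together with the copies already placed, so `m * s` extra vertices of
  -- room serve for every step alike.
  greedy-Fin : ∀ m {s} {I : Set} (e : Fin s ↔ I) (P : Fin m → (I → Fin n) → Set) Z
             → (∀ j Q → # Q ≤ # Z + m * s → ¬ ¬ Copy I (P j) Q) → ¬ ¬ Family (Fin m) P Z
  greedy-Fin zero    e P Z h k = k (Family-[] P)
  greedy-Fin (suc m) {s} e P Z h =
    greedy-Fin m e (P ∘ suc) Z (λ j Q Q≤ → h (suc j) Q (≤-trans Q≤ bound)) >>= λ c →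
    h zero (Z ∪ᵇ image (finᶠ ×ᶠ e) (at c)) (≤-trans (#∪image≤ (finᶠ ×ᶠ e) Z (at c)) bound) >>= λ c₀ k →
    k (Family-∷ e P c c₀)
    where
    bound : # Z + m * s ≤ # Z + suc m * s
    bound = +-monoʳ-≤ (# Z) (m≤n+m (m * s) s)

  greedy : ∀ {m s} {I J : Set} (r : Fin m ↔ J) (e : Fin s ↔ I) (P : J → (I → Fin n) → Set) Z
         → (∀ j Q → # Q ≤ # Z + m * s → ¬ ¬ Copy I (P j) Q) → ¬ ¬ Family J P Z
  greedy {m} {s} {I} {J} r e P Z h =
    greedy-Fin m e (P ∘ to) Z (λ j → h (to j)) >>= λ c k →
    k (reindex (λ (j , i) → from j , i) (λ (j , i) → to j , i) (λ (j , i) → cong (_, i) (to∘from j))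
        (λ f ps j → subst (λ j′ → P j′ (λ i → f (from j , i))) (to∘from j) (ps (from j))) c)
    where open Inverse r renaming (strictlyInverseˡ to to∘from)

  representatives : ∀ {m} {J : Set} (r : Fin m ↔ J) (p : J → Fin n → Bool) Z
                  → (∀ j → # Z + m < # (p j)) → ¬ ¬ Copy J (λ f → ∀ j → p j (f j) ≡ true) Z
  representatives {m} r p Z h =
    greedy r 1↔⊤ (λ j f → p j (f tt) ≡ true) Z point >>= λ c k →
    k (reindex (_, tt) proj₁ (λ _ → refl) (λ f q → q) c)
    where
    point : ∀ j Q → # Q ≤ # Z + m * 1 → ¬ ¬ Copy ⊤ (λ f → p j (f tt) ≡ true) Q
    point j Q Q≤ k with #<⇒∃∖ {p = p j} {Q} (≤-<-trans (subst (λ m → # Q ≤ # Z + m) (*-identityʳ m) Q≤) (h j))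
    ... | x , px , ¬Qx = k (copy (λ _ → x) (λ _ → refl) (λ _ → ¬Qx) px)

  -- If one copy fewer can be placed, a further copy would complete the excluded family; if not, the
  -- bound drops by one.
  maximal : ∀ m {s} {I : Set} (e : Fin s ↔ I) (P : (I → Fin n) → Set) Z
          → ¬ Family (Fin m) (λ _ → P) Z
          → ¬ ¬ (∃[ j ] j ≤ m × Σ (Family (Fin j) (λ _ → P) Z) λ c →
                   ¬ Copy I P (Z ∪ᵇ image (finᶠ ×ᶠ e) (at c)))
  maximal zero    e P Z ¬F = ⊥-elim (¬F (Family-[] λ _ → P))
  maximal (suc m) e P Z ¬F = em >>= λ where
    (yes c) k → k (m , n≤1+n m , c , λ c₀ → ¬F (Family-∷ e (λ _ → P) c c₀))
    (no ¬F′) → maximal m e P Z ¬F′ >>= λ (j , j≤m , rest) k → k (j , m≤n⇒m≤1+n j≤m , rest)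

  -- The vertices of a maximal family, together with `Z`, meet every further copy. This converts the
  -- absence of many disjoint copies into the absence of any copy off a small set.
  stuck : ∀ m {s} {I : Set} (e : Fin s ↔ I) (P : (I → Fin n) → Set) Z
        → ¬ Family (Fin m) (λ _ → P) Z → ¬ ¬ (∃[ Q ] # Q ≤ # Z + m * s × ¬ Copy I P Q)
  stuck m {s} e P Z ¬F = maximal m e P Z ¬F >>= λ (j , j≤m , c , ¬c₀) k →
    k (_ , ≤-trans (#∪image≤ (finᶠ ×ᶠ e) Z (at c)) (+-monoʳ-≤ (# Z) (*-monoˡ-≤ s j≤m)) , ¬c₀)

-- Generalised stars as iterated cones

Cone : Set → Set
Cone I = ⊤ ⊎ I

coneᶠ : ∀ {s} {I : Set} → Fin s ↔ I → Fin (1 + s) ↔ Cone I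
coneᶠ e = 1↔⊤ ⊎ᶠ e

starᶠ : ∀ k → Fin (1 + k) ↔ Cone (Fin k)
starᶠ k = coneᶠ (finᶠ {k})

attach : ∀ {T J : Set} → T × Cone J → T ⊎ (T × J)
attach (s , inj₁ tt) = inj₁ s
attach (s , inj₂ j)  = inj₂ (s , j)

detach : ∀ {T J : Set} → T ⊎ (T × J) → T × Cone J
detach (inj₁ s)       = s , inj₁ tt
detach (inj₂ (s , j)) = s , inj₂ j

detach-attach : ∀ {T J : Set} (x : T × Cone J) → detach (attach x) ≡ x
detach-attach (s , inj₁ tt) = refl
detach-attach (s , inj₂ j)  = refl

-- Sums over tuples, graphs and 3-graphs, deletion of vertices

module _ {n : ℕ} where

  private
    V = Fin n

  sum₂ : (V → V → ℕ) → ℕ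
  sum₂ f = sum λ v → sum (f v)

  sum₃ : (V → V → V → ℕ) → ℕ
  sum₃ f = sum λ v → sum₂ (f v)

  sum₄ : (V → V → V → V → ℕ) → ℕ
  sum₄ f = sum λ v → sum₃ (f v)

  #₂ : (V → V → Bool) → ℕ
  #₂ g = sum₂ λ v u → ⟦ g v u ⟧

  #₃ : (V → V → V → Bool) → ℕ
  #₃ g = sum₃ λ v u w → ⟦ g v u w ⟧

  #₄ : (V → V → V → V → Bool) → ℕ
  #₄ g = sum₄ λ v u w x → ⟦ g v u w x ⟧

  sum₂-mono : ∀ {f g : V → V → ℕ} → (∀ v u → f v u ≤ g v u) → sum₂ f ≤ sum₂ g
  sum₂-mono h = sum-mono λ v → sum-mono (h v)

  sum₃-mono : ∀ {f g : V → V → V → ℕ} → (∀ v u w → f v u w ≤ g v u w) → sum₃ f ≤ sum₃ g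
  sum₃-mono h = sum-mono λ v → sum₂-mono (h v)

  sum₄-mono : ∀ {f g : V → V → V → V → ℕ} → (∀ v u w x → f v u w x ≤ g v u w x) → sum₄ f ≤ sum₄ g
  sum₄-mono h = sum-mono λ v → sum₃-mono (h v)

  sum-cong : ∀ {f g : V → ℕ} → (∀ v → f v ≡ g v) → sum f ≡ sum g
  sum-cong h = ≤-antisym (sum-mono λ v → ≤-reflexive (h v)) (sum-mono λ v → ≤-reflexive (sym (h v)))

  sum₂-+ : (f g : V → V → ℕ) → sum₂ (λ v u → f v u + g v u) ≡ sum₂ f + sum₂ g
  sum₂-+ f g = trans (sum-cong λ v → sum-+ (f v) (g v)) (sum-+ (λ v → sum (f v)) (λ v → sum (g v)))

  sum₃-+ : (f g : V → V → V → ℕ) → sum₃ (λ v u w → f v u w + g v u w) ≡ sum₃ f + sum₃ g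
  sum₃-+ f g = trans (sum-cong λ v → sum₂-+ (f v) (g v)) (sum-+ (λ v → sum₂ (f v)) (λ v → sum₂ (g v)))

  sum₄-+ : (f g : V → V → V → V → ℕ) → sum₄ (λ v u w x → f v u w x + g v u w x) ≡ sum₄ f + sum₄ g
  sum₄-+ f g = trans (sum-cong λ v → sum₃-+ (f v) (g v)) (sum-+ (λ v → sum₃ (f v)) (λ v → sum₃ (g v)))

  sum₂-+≤ : (f g : V → V → ℕ) {A B : ℕ} → sum₂ f ≤ A → sum₂ g ≤ B → sum₂ (λ v u → f v u + g v u) ≤ A + B
  sum₂-+≤ f g p q = ≤-trans (≤-reflexive (sum₂-+ f g)) (+-mono-≤ p q)

  sum₃-+≤ : (f g : V → V → V → ℕ) {A B : ℕ} → sum₃ f ≤ A → sum₃ g ≤ B → sum₃ (λ v u w → f v u w + g v u w) ≤ A + B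
  sum₃-+≤ f g p q = ≤-trans (≤-reflexive (sum₃-+ f g)) (+-mono-≤ p q)

  sum₄-+≤ : (f g : V → V → V → V → ℕ) {A B : ℕ} → sum₄ f ≤ A → sum₄ g ≤ B
          → sum₄ (λ v u w x → f v u w x + g v u w x) ≤ A + B
  sum₄-+≤ f g p q = ≤-trans (≤-reflexive (sum₄-+ f g)) (+-mono-≤ p q)

  sum₂-▹ : ∀ b {f : V → V → ℕ} → sum₂ (λ v u → b ▹ f v u) ≡ b ▹ sum₂ f
  sum₂-▹ b = trans (sum-cong λ v → sum-▹ b) (sum-▹ b)

  sum₃-▹ : ∀ b {f : V → V → V → ℕ} → sum₃ (λ v u w → b ▹ f v u w) ≡ b ▹ sum₃ f
  sum₃-▹ b = trans (sum-cong λ v → sum₂-▹ b) (sum-▹ b)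

  sum₃-12 : (f : V → V → V → ℕ) → sum₃ (λ v u w → f u v w) ≡ sum₃ f
  sum₃-12 f = sum-swap λ v u → sum (f u v)

  sum₃-23 : (f : V → V → V → ℕ) → sum₃ (λ v u w → f v w u) ≡ sum₃ f
  sum₃-23 f = sum-cong λ v → sum-swap λ u w → f v w u

  sum₃-13 : (f : V → V → V → ℕ) → sum₃ (λ v u w → f w u v) ≡ sum₃ f
  sum₃-13 f = trans (sum₃-12 λ u v w → f w u v) (trans (sum₃-23 λ u w v → f w u v) (sum₃-12 f))

  _∖²_ : (V → V → Bool) → (V → Bool) → V → V → Bool
  (g ∖² K) v u = g v u ∧ (not (K v) ∧ not (K u))

  _∖³_ : (V → V → V → Bool) → (V → Bool) → V → V → V → Bool
  (F ∖³ K) v u w = F v u w ∧ (not (K v) ∧ (not (K u) ∧ not (K w)))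

  ∖²⁻ : ∀ g K {v u} → (g ∖² K) v u ≡ true → g v u ≡ true × K v ≡ false × K u ≡ false
  ∖²⁻ g K {v} {u} h = ∧⁻ˡ h , not⁻ (∧⁻ˡ (∧⁻ʳ {g v u} h)) , not⁻ (∧⁻ʳ {not (K v)} (∧⁻ʳ {g v u} h))

  ∖³⁻ : ∀ F K {v u w} → (F ∖³ K) v u w ≡ true
      → F v u w ≡ true × K v ≡ false × K u ≡ false × K w ≡ false
  ∖³⁻ F K {v} {u} {w} h = ∧⁻ˡ h , not⁻ (∧⁻ˡ h₁) , not⁻ (∧⁻ˡ h₂) , not⁻ (∧⁻ʳ {not (K u)} h₂)
    where
    h₁ = ∧⁻ʳ {F v u w} h
    h₂ = ∧⁻ʳ {not (K v)} h₁

  record Graph (g : V → V → Bool) : Set where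
    field
      symmetric   : ∀ {v u} → g v u ≡ true → g u v ≡ true
      irreflexive : ∀ {v u} → g v u ≡ true → v ≢ u

  record Graph₃ (F : V → V → V → Bool) : Set where
    field
      swap₁₂   : ∀ {v u w} → F v u w ≡ true → F u v w ≡ true
      swap₂₃   : ∀ {v u w} → F v u w ≡ true → F v w u ≡ true
      distinct : ∀ {v u w} → F v u w ≡ true → v ≢ u
    swap₁₃ : ∀ {v u w} → F v u w ≡ true → F w u v ≡ true
    swap₁₃ = swap₁₂ ∘ swap₂₃ ∘ swap₁₂
    link : ∀ v → Graph (F v)
    link v = record { symmetric = swap₂₃ ; irreflexive = distinct ∘ swap₂₃ ∘ swap₁₂ }

  open Graph
  open Graph₃

  ∖²-graph : ∀ {g} K → Graph g → Graph (g ∖² K)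
  ∖²-graph {g} K G = record
    { symmetric   = λ h → let (e , ¬v , ¬u) = ∖²⁻ g K h in ∧⁺ (symmetric G e) (∧⁺ (not⁺ ¬u) (not⁺ ¬v))
    ; irreflexive = λ h → irreflexive G (∧⁻ˡ h) }

  ∖³-graph : ∀ {F} K → Graph₃ F → Graph₃ (F ∖³ K)
  ∖³-graph {F} K G = record
    { swap₁₂   = λ h → let (e , ¬v , ¬u , ¬w) = ∖³⁻ F K h in
                   ∧⁺ (swap₁₂ G e) (∧⁺ (not⁺ ¬u) (∧⁺ (not⁺ ¬v) (not⁺ ¬w)))
    ; swap₂₃   = λ h → let (e , ¬v , ¬u , ¬w) = ∖³⁻ F K h in
                   ∧⁺ (swap₂₃ G e) (∧⁺ (not⁺ ¬v) (∧⁺ (not⁺ ¬w) (not⁺ ¬u)))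
    ; distinct = λ h → distinct G (∧⁻ˡ h) }

  -- Edges are counted as ordered tuples, so a deleted vertex is charged once for each coordinate
  -- that it may occupy.
  #₂-delete : ∀ {g} → Graph g → ∀ K {D} → (∀ v → K v ≡ true → # (g v) ≤ D)
            → #₂ g ≤ #₂ (g ∖² K) + (# K * D + # K * D)
  #₂-delete {g} G K {D} deg≤ = ≤-trans (sum₂-mono pointwise)
    (sum₂-+≤ _ _ ≤-refl (sum₂-+≤ (λ v u → K v ▹ ⟦ g v u ⟧) (λ v u → K u ▹ ⟦ g v u ⟧) first second))
    where
    pointwise : ∀ v u → ⟦ g v u ⟧ ≤ ⟦ (g ∖² K) v u ⟧ + (K v ▹ ⟦ g v u ⟧ + K u ▹ ⟦ g v u ⟧)
    pointwise v u with g v u | K v | K u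
    ... | false | _     | _     = z≤n
    ... | true  | true  | _     = s≤s z≤n
    ... | true  | false | true  = ≤-refl
    ... | true  | false | false = s≤s z≤n
    first : sum₂ (λ v u → K v ▹ ⟦ g v u ⟧) ≤ # K * D
    first = ≤-trans (≤-reflexive (sum-cong λ v → sum-▹ (K v))) (▹sum-≤ K deg≤)
    second : sum₂ (λ v u → K u ▹ ⟦ g v u ⟧) ≤ # K * D
    second = begin
      sum₂ (λ v u → K u ▹ ⟦ g v u ⟧) ≡⟨ sum-swap (λ v u → K u ▹ ⟦ g v u ⟧) ⟩
      sum₂ (λ u v → K u ▹ ⟦ g v u ⟧) ≤⟨ sum₂-mono (λ u v → ▹-mono (K u) λ _ → ⟦⟧-mono (symmetric G)) ⟩
      sum₂ (λ u v → K u ▹ ⟦ g u v ⟧) ≤⟨ first ⟩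
      # K * D                        ∎
      where open ≤-Reasoning

  #₃-delete : ∀ {F} → Graph₃ F → ∀ K {D} → (∀ v → K v ≡ true → #₂ (F v) ≤ D)
            → #₃ F ≤ #₃ (F ∖³ K) + (# K * D + (# K * D + # K * D))
  #₃-delete {F} G K {D} deg≤ = ≤-trans (sum₃-mono pointwise)
    (sum₃-+≤ _ _ ≤-refl (sum₃-+≤ (λ v u w → K v ▹ ⟦ F v u w ⟧) _ first
      (sum₃-+≤ (λ v u w → K u ▹ ⟦ F v u w ⟧) (λ v u w → K w ▹ ⟦ F v u w ⟧) second third)))
    where
    open ≤-Reasoning
    pointwise : ∀ v u w → ⟦ F v u w ⟧ ≤ ⟦ (F ∖³ K) v u w ⟧ + (K v ▹ ⟦ F v u w ⟧ + (K u ▹ ⟦ F v u w ⟧ + K w ▹ ⟦ F v u w ⟧))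
    pointwise v u w with F v u w | K v | K u | K w
    ... | false | _     | _     | _     = z≤n
    ... | true  | true  | _     | _     = s≤s z≤n
    ... | true  | false | true  | _     = s≤s z≤n
    ... | true  | false | false | true  = ≤-refl
    ... | true  | false | false | false = s≤s z≤n
    first : sum₃ (λ v u w → K v ▹ ⟦ F v u w ⟧) ≤ # K * D
    first = ≤-trans (≤-reflexive (sum-cong λ v → sum₂-▹ (K v))) (▹sum-≤ K deg≤)
    second : sum₃ (λ v u w → K u ▹ ⟦ F v u w ⟧) ≤ # K * D
    second = begin
      sum₃ (λ v u w → K u ▹ ⟦ F v u w ⟧) ≤⟨ sum₃-mono (λ v u w → ▹-mono (K u) λ _ → ⟦⟧-mono (swap₁₂ G)) ⟩
      sum₃ (λ v u w → K u ▹ ⟦ F u v w ⟧) ≡⟨ sum₃-12 (λ v u w → K v ▹ ⟦ F v u w ⟧) ⟩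
      sum₃ (λ v u w → K v ▹ ⟦ F v u w ⟧) ≤⟨ first ⟩
      # K * D                            ∎
    third : sum₃ (λ v u w → K w ▹ ⟦ F v u w ⟧) ≤ # K * D
    third = begin
      sum₃ (λ v u w → K w ▹ ⟦ F v u w ⟧) ≤⟨ sum₃-mono (λ v u w → ▹-mono (K w) λ _ → ⟦⟧-mono (swap₁₃ G)) ⟩
      sum₃ (λ v u w → K w ▹ ⟦ F w u v ⟧) ≡⟨ sum₃-13 (λ v u w → K v ▹ ⟦ F v u w ⟧) ⟩
      sum₃ (λ v u w → K v ▹ ⟦ F v u w ⟧) ≤⟨ first ⟩
      # K * D                            ∎

  AtApex : ∀ {I : Set} → (V → (I → V) → Set) → (Cone I → V) → Set
  AtApex P f = P (f (inj₁ tt)) (f ∘ inj₂)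

  IsStar : (V → V → Bool) → ∀ {k} → (Cone (Fin k) → V) → Set
  IsStar g = AtApex λ v f → ∀ l → g v (f l) ≡ true

  IsStar₃ : (V → V → V → Bool) → ∀ {d k} → (Cone (Fin d × Cone (Fin k)) → V) → Set
  IsStar₃ F = AtApex λ v → Each λ _ → IsStar (F v)

  IsStar₄ : (V → V → V → V → Bool) → ∀ {c d k} → (Cone (Fin c × Cone (Fin d × Cone (Fin k))) → V) → Set
  IsStar₄ E = AtApex λ v → Each λ _ → IsStar₃ (E v)

  Stars : (V → V → Bool) → ℕ → ℕ → (V → Bool) → Set
  Stars g m k = Family (Fin m) {Cone (Fin k)} (λ _ → IsStar g)

  Stars₃ : (V → V → V → Bool) → ℕ → ℕ → ℕ → (V → Bool) → Set
  Stars₃ F m d k = Family (Fin m) {Cone (Fin d × Cone (Fin k))} (λ _ → IsStar₃ F)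

  cone : ∀ {I : Set} (P : V → (I → V) → Set) {Z} v → Z v ≡ false → (c : Copy I (P v) Z)
       → (∀ i → v ≢ at c i) → Copy (Cone I) (AtApex P) Z
  cone P v ¬Zv (copy f f-inj f-av p) v≢f =
    copy [ (λ _ → v) , f ]′ inj′ (λ { (inj₁ _) → ¬Zv ; (inj₂ i) → f-av i }) p
    where
    inj′ : Injective _≡_ _≡_ [ (λ _ → v) , f ]′
    inj′ {inj₁ _} {inj₁ _} _  = refl
    inj′ {inj₁ _} {inj₂ j} eq = ⊥-elim (v≢f j eq)
    inj′ {inj₂ i} {inj₁ _} eq = ⊥-elim (v≢f i (sym eq))
    inj′ {inj₂ i} {inj₂ j} eq = cong inj₂ (f-inj eq)

  extend : ∀ {s m} {I J : Set} {P : (I → V) → Set} (e : Fin s ↔ I) (r : Fin m ↔ J)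
           (p : (I → V) → J → V → Bool) → (∀ f → P f → ∀ j → s + m < # (p f j))
         → Copy I P ∅ → ¬ ¬ Copy (I ⊎ J) (λ f → P (f ∘ inj₁) × (∀ j → p (f ∘ inj₁) j (f (inj₂ j)) ≡ true)) ∅
  extend {s} {m} e r p large c =
    representatives r (p (at c)) (∅ ∪ᵇ image e (at c))
      (λ j → ≤-<-trans (+-monoˡ-≤ m (#image≤ e (at c))) (large (at c) (prop c) j)) >>= λ c′ k →
    k (join {Q = λ f g → ∀ j → p f j (g j) ≡ true} e c c′)

-- Edge bounds for graphs and 3-graphs without disjoint stars

module _ {n : ℕ} where

  private
    V = Fin n

  open Graph
  open Graph₃

  opaque
    high : (V → V → Bool) → ℕ → V → Bool
    high g c v = does (c <? # (g v))

    high⁻ : ∀ g c {v} → high g c v ≡ true → c < # (g v)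
    high⁻ g c {v} = does⁻ {d = c <? # (g v)}

    low⁻ : ∀ g c {v} → high g c v ≡ false → # (g v) ≤ c
    low⁻ g c {v} h = ≮⇒≥ (does-false⁻ {d = c <? # (g v)} h)

    high-cong : ∀ g g′ c {v w} → # (g v) ≡ # (g′ w) → high g c v ≡ high g′ c w
    high-cong g g′ c = cong λ m → does (c <? m)

  -- The leaf `l₀` puts every centre into an edge avoiding `K`; the centre of a star without leaves
  -- could lie in `K`.
  ∖²-stars : ∀ (g : V → V → Bool) K {m k} → Fin k → Stars (g ∖² K) m k ∅ → Stars g m k K
  ∖²-stars g K l₀ = weaken
    (λ f h i l → proj₁ (∖²⁻ g K (h i l)))
    (λ { f h (i , inj₁ tt) → proj₁ (proj₂ (∖²⁻ g K (h i l₀)))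
       ; f h (i , inj₂ l)  → proj₂ (proj₂ (∖²⁻ g K (h i l))) })

  star-free-row : ∀ {g : V → V → Bool} → (∀ {v u} → g v u ≡ true → v ≢ u) → ∀ {k} Q → ¬ Copy (Cone (Fin k)) (IsStar g) Q
                → ∀ v → Q v ≡ false → # (g v ∖ Q) ≤ k
  star-free-row {g} irr {k} Q ¬star v ¬Qv = ≤-stable λ ≰ →
    representatives (finᶠ {k}) (λ _ → g v ∖ Q) ∅
      (λ _ → ≤-<-trans (≤-reflexive (cong (_+ k) (#∅ n))) (≰⇒> ≰)) λ c →
    ¬star (cone (λ v f → ∀ l → g v (f l) ≡ true) v ¬Qv
      (weaken (λ f h l → ∖⁻ˡ (g v) Q (h l)) (λ f h l → ∖⁻ʳ (g v) Q (h l)) c)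
      (λ l → irr (∖⁻ˡ (g v) Q (prop c l))))

  -- More than `m` such vertices would provide all the centres at once, and each has a neighbour to
  -- spare beyond the `m * (1 + k)` vertices of the whole family.
  #high≤ : ∀ {g : V → V → Bool} {m k} → ¬ Stars g m k ∅ → # (high g (m * (1 + k))) ≤ m
  #high≤ {g} {m} {k} ¬stars = ≤-stable λ ≰ →
    (representatives (finᶠ {m}) (λ _ → high g (m * (1 + k))) ∅
       (λ _ → ≤-<-trans (≤-reflexive (cong (_+ m) (#∅ n))) (≰⇒> ≰)) >>=
     extend finᶠ (finᶠ ×ᶠ finᶠ) (λ f (i , l) → g (f i))
       (λ f hf (i , l) → ≤-<-trans (≤-reflexive (sym (*-suc m k))) (high⁻ g _ (hf i))))
    λ c → ¬stars (reindex attach detach detach-attach (λ f (_ , h) i l → h (i , l)) c)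

  -- Deleting the set `Q` of a maximal family loses at most `D` edges per vertex and orientation,
  -- and leaves every degree at most `k`.
  stars-bound : ∀ {g : V → V → Bool} → Graph g → ∀ m k {D} → (∀ v → # (g v) ≤ D) → ¬ Stars g m k ∅
              → #₂ g ≤ n * k + (m * (1 + k) * D + m * (1 + k) * D)
  stars-bound {g} G m k {D} deg≤ ¬stars = ≤-stable λ ≰ →
    stuck m (starᶠ k) (IsStar g) ∅ ¬stars λ (Q , #Q≤ , ¬star) →
    let #Q≤′ = ≤-trans #Q≤ (≤-reflexive (cong (_+ m * (1 + k)) (#∅ n)))
        D-part = *-monoˡ-≤ D #Q≤′
        row : ∀ v → # ((g ∖² Q) v) ≤ k
        row v = [ (λ Qv → ≤-trans (#-mono {q = ∅} λ u h → ⊥-elim (true≢false Qv (proj₁ (proj₂ (∖²⁻ g Q h)))))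
                           (≤-trans (≤-reflexive (#∅ n)) z≤n))
                , (λ ¬Qv → ≤-trans (#-mono λ u h → let (e , _ , ¬Qu) = ∖²⁻ g Q h in ∧⁺ e (not⁺ ¬Qu))
                           (star-free-row (irreflexive G) Q ¬star v ¬Qv)) ]′ (true⊎false (Q v))
    in ≰ (≤-trans (#₂-delete G Q (λ v _ → deg≤ v)) (+-mono-≤ (sum-≤ row) (+-mono-≤ D-part D-part)))

  -- Off the high vertices the maximum degree is at most the number `D` of vertices of `m` stars, so
  -- deleting a maximal family costs order `D * D` instead of `D * n`.
  #₂-∖high : ∀ {g : V → V → Bool} → Graph g → ∀ m k → ¬ Stars g m k ∅
           → let D = m * (1 + k) in #₂ (g ∖² high g D) ≤ n * k + (D * D + D * D)
  #₂-∖high {g} G m k ¬stars = stars-bound (∖²-graph H G) m k deg≤ (¬stars ∘ weaken (λ f h i l → proj₁ (∖²⁻ g H (h i l))) (λ _ _ _ → refl))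
    where
    D = m * (1 + k)
    H = high g D
    deg≤ : ∀ v → # ((g ∖² H) v) ≤ D
    deg≤ v = [ (λ Hv → ≤-trans (#-mono {q = ∅} λ u h → ⊥-elim (true≢false Hv (proj₁ (proj₂ (∖²⁻ g H h)))))
                           (≤-trans (≤-reflexive (#∅ n)) z≤n))
             , (λ ¬Hv → ≤-trans (#-mono λ u h → proj₁ (∖²⁻ g H h)) (low⁻ g D ¬Hv)) ]′ (true⊎false (H v))

  star-free-edges : ∀ {g : V → V → Bool} → Graph g → ∀ m k → ¬ Stars g m k ∅
                  → let D = m * (1 + k) in #₂ g ≤ n * k + (D * D + D * D) + (m * n + m * n)
  star-free-edges {g} G m k ¬stars = ≤-trans (#₂-delete G (high g D) (λ v _ → #≤n (g v)))
    (+-mono-≤ (#₂-∖high G m k ¬stars) (+-mono-≤ mn mn))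
    where
    D = m * (1 + k)
    mn = *-monoˡ-≤ n (#high≤ {g} ¬stars)

  -- `A` bounds the edges whose two pairs at a given coordinate are both low, `B` the forks of two
  -- high pairs there; each occurs for three coordinates.
  star₃Bound : ℕ → ℕ → ℕ
  star₃Bound d k = A + (A + (A + (B + (B + B))))
    where
    D = d * (1 + k)
    A = n * (n * k + (D * D + D * D))
    B = n * (d * d)

  -- A vertex is low in its own link when none of its edges uses a pair of
  -- large codegree at it.  An edge with no low vertex contains two such pairs
  -- sharing a vertex, and these are few since every vertex lies in at most d.
  star₃-free-edges : ∀ {F : V → V → V → Bool} → Graph₃ F → ∀ d k → Fin k → ¬ Copy _ (IsStar₃ F {d} {k}) ∅
                   → #₃ F ≤ star₃Bound d k
  star₃-free-edges {F} G d k l₀ ¬star = ≤-trans (sum₃-mono pointwise)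
    (sum₃-+≤ p _ p≤ (sum₃-+≤ (λ v u w → p u v w) _ (via (sum₃-12 p) p≤)
    (sum₃-+≤ (λ v u w → p w u v) _ (via (sum₃-13 p) p≤)
    (sum₃-+≤ s _ s≤′ (sum₃-+≤ (λ v u w → s u v w) (λ v u w → s w u v)
      (via (sum₃-12 s) s≤′) (via (sum₃-13 s) s≤′))))))
    where
    D = d * (1 + k)
    hi : V → V → Bool
    hi v = high (F v) D
    P S : V → V → V → Bool
    P v u w = (F v ∖² hi v) u w
    S v u w = hi v u ∧ hi v w
    p s : V → V → V → ℕ
    p v u w = ⟦ P v u w ⟧
    s v u w = ⟦ S v u w ⟧
    hi-sym : ∀ v u → hi v u ≡ hi u v
    hi-sym v u = high-cong (F v) (F u) D (sum-cong λ w → ≤-antisym (⟦⟧-mono (swap₁₂ G)) (⟦⟧-mono (swap₁₂ G)))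
    ¬stars : ∀ v → ¬ Stars (F v) d k ∅
    ¬stars v c = ¬star (cone (λ v → Each λ _ → IsStar (F v)) v refl c apex∉)
      where
      apex∉ : ∀ i → v ≢ at c i
      apex∉ (i , inj₂ l)  = distinct G (swap₂₃ G (prop c i l))
      apex∉ (i , inj₁ tt) = distinct G (prop c i l₀)
    p≤ : sum₃ p ≤ n * (n * k + (D * D + D * D))
    p≤ = sum-≤ λ v → #₂-∖high (link G v) d k (¬stars v)
    s≤′ : sum₃ s ≤ n * (d * d)
    s≤′ = sum-≤ λ v → ≤-trans (sum-mono λ u → ≤-reflexive (trans (sum-cong λ w → sym (▹-⟦⟧ (hi v u) (hi v w))) (sum-▹ (hi v u))))
      (≤-trans (▹sum-≤ (hi v) λ u _ → #high≤ {F v} (¬stars v)) (*-monoˡ-≤ d (#high≤ {F v} (¬stars v))))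
    via : ∀ {a b c : ℕ} → a ≡ b → b ≤ c → a ≤ c
    via refl b≤c = b≤c
    pointwise : ∀ v u w → ⟦ F v u w ⟧ ≤ p v u w + (p u v w + (p w u v + (s v u w + (s u v w + s w u v))))
    pointwise v u w = ⟦⟧≤ λ e → ≤-trans (cover (hi v u) (hi v w) (hi u w))
      (+-mono-≤ (⟦⟧-mono λ h → ∧⁺ e h)
      (+-mono-≤ (⟦⟧-mono λ h → ∧⁺ (swap₁₂ G e) (subst (λ b → not b ∧ not (hi u w) ≡ true) (hi-sym v u) h))
      (+-mono-≤ (⟦⟧-mono λ h → ∧⁺ (swap₁₃ G e) (subst₂ (λ a b → not a ∧ not b ≡ true) (hi-sym u w) (hi-sym v w) h))
      (+-monoʳ-≤ (s v u w)
      (+-mono-≤ (⟦⟧-mono λ h → subst (λ b → b ∧ hi u w ≡ true) (hi-sym v u) h)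
                (⟦⟧-mono λ h → subst₂ (λ a b → a ∧ b ≡ true) (hi-sym u w) (hi-sym v w) h))))))
      where
      -- Of the three pairs of an edge two are alike, both high or both low, and any two pairs of a
      -- triple share a vertex.
      cover : ∀ a b c → 1 ≤ ⟦ not a ∧ not b ⟧ + (⟦ not a ∧ not c ⟧ + (⟦ not c ∧ not b ⟧
                          + (⟦ a ∧ b ⟧ + (⟦ a ∧ c ⟧ + ⟦ c ∧ b ⟧))))
      cover true  true  true  = s≤s z≤n
      cover true  true  false = s≤s z≤n
      cover true  false true  = s≤s z≤n
      cover true  false false = s≤s z≤n
      cover false true  true  = s≤s z≤n
      cover false true  false = s≤s z≤n
      cover false false _     = s≤s z≤n

▹sum-≥ : ∀ {n} (p : Fin n → Bool) {f : Fin n → ℕ} {c} → (∀ i → p i ≡ true → c ≤ f i)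
       → # p * c ≤ sum (λ i → p i ▹ f i)
▹sum-≥ p {f} {c} h = ≤-trans (≤-reflexive (sym (sum-*ʳ (λ i → ⟦ p i ⟧) c))) (sum-mono pointwise)
  where
  pointwise : ∀ i → ⟦ p i ⟧ * c ≤ p i ▹ f i
  pointwise i with p i | h i
  ... | true  | hi = ≤-trans (≤-reflexive (*-identityˡ c)) (hi refl)
  ... | false | _  = z≤n

-- Disjoint stars in 3-graphs, and high-degree vertices of star-free graphs

module _ {n : ℕ} where

  private
    V = Fin n

  open Graph
  open Graph₃

  stars₃-bound : ∀ {F : V → V → V → Bool} → Graph₃ F → ∀ m d k {δ} → Fin d → Fin k
               → (∀ v → #₂ (F v) ≤ δ) → ∀ Z → ¬ Stars₃ F m d k Z
               → let Q = # Z + m * (1 + d * (1 + k)) in #₃ F ≤ star₃Bound {n} d k + (Q * δ + (Q * δ + Q * δ))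
  stars₃-bound {F} G m d k {δ} i₀ l₀ deg≤ Z ¬stars = ≤-stable λ ≰ →
    stuck m (coneᶠ (finᶠ ×ᶠ starᶠ k)) (IsStar₃ F) Z ¬stars λ (Q , #Q≤ , ¬star) →
    let Qδ = *-monoˡ-≤ δ #Q≤
        ¬star′ : ¬ Copy _ (IsStar₃ (F ∖³ Q) {d} {k}) ∅
        ¬star′ = ¬star ∘ weaken (λ f h i l → proj₁ (∖³⁻ F Q (h i l)))
          (λ { f h (inj₁ tt)              → proj₁ (proj₂ (∖³⁻ F Q (h i₀ l₀)))
             ; f h (inj₂ (i , inj₁ tt)) → proj₁ (proj₂ (proj₂ (∖³⁻ F Q (h i l₀))))
             ; f h (inj₂ (i , inj₂ l))  → proj₂ (proj₂ (proj₂ (∖³⁻ F Q (h i l)))) })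
    in ≰ (≤-trans (#₃-delete G Q (λ v _ → deg≤ v))
            (+-mono-≤ (star₃-free-edges (∖³-graph Q G) d k l₀ ¬star′) (+-mono-≤ Qδ (+-mono-≤ Qδ Qδ))))

  -- Take a maximal family of disjoint d-stars, on the vertex set Q, and then a
  -- maximal family of disjoint d-stars with centres in Q and leaves among the
  -- vertices of large degree outside Q, with centres P.  A remaining vertex of
  -- large degree sends most of its edges to Q ∖ P, whose vertices now see at
  -- most d remaining vertices each.
  star-free-#high≤ : ∀ {g : V → V → Bool} → Graph g → ∀ d → 1 ≤ d → ¬ Stars g d d ∅
                   → # (high g (d * 4)) ≤ d * d * 4
  star-free-#high≤ {g} G d 1≤d ¬stars = ≤-stable λ ≰ →
    stuck d (starᶠ d) (IsStar g) ∅ ¬stars λ (Q , #Q≤ , ¬star) →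
    maximal d (starᶠ d) (IsStar (inward Q)) ∅
      (¬stars ∘ weaken (λ f h i l → proj₂ (proj₂ (inward⁻ Q (h i l)))) (λ _ _ _ → refl))
      λ (j , j≤d , c , ¬star′) → ≰ (bound Q #Q≤ ¬star j j≤d c ¬star′)
    where
    X = high g (d * 4)
    inward : (V → Bool) → V → V → Bool
    inward Q q x = Q q ∧ ((X ∖ Q) x ∧ g q x)
    inward⁻ : ∀ Q {q x} → inward Q q x ≡ true → Q q ≡ true × (X ∖ Q) x ≡ true × g q x ≡ true
    inward⁻ Q {q} {x} h = ∧⁻ˡ h , ∧⁻ˡ (∧⁻ʳ {Q q} h) , ∧⁻ʳ {(X ∖ Q) x} (∧⁻ʳ {Q q} h)

    module _ (Q : V → Bool) (#Q≤ : # Q ≤ # (∅ {n}) + d * (1 + d)) (¬star : ¬ Copy (Cone (Fin d)) (IsStar g) Q)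
             (j : ℕ) (j≤d : j ≤ d) (c : Family (Fin j) {Cone (Fin d)} (λ _ → IsStar (inward Q)) ∅)
             (¬star′ : ¬ Copy (Cone (Fin d)) (IsStar (inward Q)) (∅ ∪ᵇ image (finᶠ ×ᶠ starᶠ d) (at c))) where
      open ≤-Reasoning
      P R W L L′ : V → Bool
      P = image finᶠ λ i → at c (i , inj₁ tt)
      R = image (finᶠ ×ᶠ finᶠ {d}) λ (i , l) → at c (i , inj₂ l)
      W = ∅ ∪ᵇ image (finᶠ ×ᶠ starᶠ d) (at c)
      L = X ∖ Q
      L′ = L ∖ R

      R⇒L : ∀ {x} → R x ≡ true → L x ≡ true
      R⇒L h with image⁻ (finᶠ ×ᶠ finᶠ {d}) _ h
      ... | (i , l) , refl = proj₁ (proj₂ (inward⁻ Q (prop c i l)))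
      W⇒P⊎R : ∀ {x} → W x ≡ true → P x ≡ true ⊎ R x ≡ true
      W⇒P⊎R h with image⁻ (finᶠ ×ᶠ starᶠ d) (at c) h
      ... | (i , inj₁ tt) , refl = inj₁ (image⁺ finᶠ (λ i → at c (i , inj₁ tt)) i)
      ... | (i , inj₂ l)  , refl = inj₂ (image⁺ (finᶠ ×ᶠ finᶠ {d}) (λ (i , l) → at c (i , inj₂ l)) (i , l))
      l₀ : Fin d
      l₀ = fromℕ< 1≤d
      P⇒Q : ∀ {x} → P x ≡ true → Q x ≡ true
      P⇒Q h with image⁻ finᶠ _ h
      ... | i , refl = proj₁ (inward⁻ Q (prop c i l₀))

      to-L′ : ∀ q → (Q ∖ P) q ≡ true → # (λ x → L′ x ∧ g q x) ≤ d
      to-L′ q h = ≤-trans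
        (#-mono λ x h′ → let Lx = ∖⁻ˡ L R (∧⁻ˡ h′); ¬Rx = ∖⁻ʳ L R (∧⁻ˡ h′) in
          ∧⁺ (∧⁺ (∖⁻ˡ Q P h) (∧⁺ Lx (∧⁻ʳ {L′ x} h′)))
             (not⁺ (¬true⇒false λ Wx → [ (λ Px → true≢false (P⇒Q Px) (∖⁻ʳ X Q Lx))
                                        , (λ Rx → true≢false Rx ¬Rx) ]′ (W⇒P⊎R Wx))))
        (star-free-row (λ e → irreflexive G (proj₂ (proj₂ (inward⁻ Q e)))) W ¬star′ q
          (¬true⇒false λ Wq → [ (λ Pq → true≢false Pq (∖⁻ʳ Q P h))
                               , (λ Rq → true≢false (∖⁻ˡ Q P h) (∖⁻ʳ X Q (R⇒L Rq))) ]′ (W⇒P⊎R Wq)))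

      #P≤ : # P ≤ d
      #P≤ = ≤-trans (#image≤ finᶠ _) j≤d

      -- Of the more than `4d` neighbours of `x` at most `d` lie outside `Q`, because no star avoids
      -- `Q`, and at most `d` lie in `P`.
      from-L′ : ∀ x → L′ x ≡ true → d * 2 ≤ # (λ q → (Q ∖ P) q ∧ g q x)
      from-L′ x h = +-cancelʳ-≤ (d * 2) _ _ (begin
        d * 2 + d * 2                                  ≡⟨ sym (*-distribˡ-+ d 2 2) ⟩
        d * 4                                          ≤⟨ <⇒≤ (high⁻ g (d * 4) (∖⁻ˡ X Q Lx)) ⟩
        # (g x)                                        ≤⟨ #≤#∖+# (g x) Q′ ⟩
        # (g x ∖ Q′) + # Q′                            ≤⟨ +-mono-≤ outside (#-mono λ q h → ∧⁺ (∧⁻ˡ h) (symmetric G (∧⁻ʳ {(Q ∖ P) q} h))) ⟩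
        (d + d) + # (λ q → (Q ∖ P) q ∧ g q x)          ≡⟨ +-comm (d + d) _ ⟩
        # (λ q → (Q ∖ P) q ∧ g q x) + (d + d)          ≡⟨ cong (# (λ q → (Q ∖ P) q ∧ g q x) +_) (double d) ⟩
        # (λ q → (Q ∖ P) q ∧ g q x) + d * 2            ∎)
        where
        Lx = ∖⁻ˡ L R h
        Q′ : V → Bool
        Q′ q = (Q ∖ P) q ∧ g x q
        double : ∀ d → d + d ≡ d * 2
        double = solve-∀
        outside : # (g x ∖ Q′) ≤ d + d
        outside = ≤-trans
          (#-cover {q = g x ∖ Q} {r = P} λ q h′ → let gxq = ∖⁻ˡ (g x) Q′ h′ in
            [ (λ Qq → [ inj₂ , (λ ¬Pq → ⊥-elim (true≢false (∧⁺ (∧⁺ Qq (not⁺ ¬Pq)) gxq) (∖⁻ʳ (g x) Q′ h′))) ]′ (true⊎false (P q)))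
            , (λ ¬Qq → inj₁ (∧⁺ gxq (not⁺ ¬Qq))) ]′ (true⊎false (Q q)))
          (+-mono-≤ (star-free-row (irreflexive G) Q ¬star x (∖⁻ʳ X Q Lx)) #P≤)

      #Q≤′ : # Q ≤ d * (1 + d)
      #Q≤′ = ≤-trans #Q≤ (≤-reflexive (cong (_+ d * (1 + d)) (#∅ n)))

      1+d≤ : 1 + d ≤ d * 2
      1+d≤ = ≤-trans (+-monoˡ-≤ d 1≤d) (≤-reflexive (solve d))
        where
        solve : ∀ d → d + d ≡ d * 2
        solve = solve-∀

      -- The pairs between `L′` and `Q ∖ P` are counted from both sides: at least `2d` at each
      -- vertex of `L′`, at most `d` at each of the other at most `2d²` vertices.
      #L′≤ : # L′ ≤ d * d
      #L′≤ = *-cancelʳ-≤ (# L′) (d * d) (d * 2) ⦃ >-nonZero (≤-trans 1≤d (m≤m*n d 2)) ⦄ (begin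
        # L′ * (d * 2)                                                      ≤⟨ ▹sum-≥ L′ from-L′ ⟩
        sum (λ x → L′ x ▹ sum λ q → ⟦ (Q ∖ P) q ∧ g q x ⟧)                  ≡⟨ sum-cong (λ x → sym (sum-▹ (L′ x))) ⟩
        sum (λ x → sum λ q → L′ x ▹ ⟦ (Q ∖ P) q ∧ g q x ⟧)                  ≡⟨ sum-swap (λ x q → L′ x ▹ ⟦ (Q ∖ P) q ∧ g q x ⟧) ⟩
        sum (λ q → sum λ x → L′ x ▹ ⟦ (Q ∖ P) q ∧ g q x ⟧)                  ≡⟨ sum-cong (λ q → sum-cong λ x → rearrange (L′ x) ((Q ∖ P) q) (g q x)) ⟩
        sum (λ q → sum λ x → (Q ∖ P) q ▹ ⟦ L′ x ∧ g q x ⟧)                  ≡⟨ sum-cong (λ q → sum-▹ ((Q ∖ P) q)) ⟩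
        sum (λ q → (Q ∖ P) q ▹ # (λ x → L′ x ∧ g q x))                      ≤⟨ ▹sum-≤ (Q ∖ P) to-L′ ⟩
        # (Q ∖ P) * d                                                       ≤⟨ *-monoˡ-≤ d (≤-trans (#-mono λ q → ∖⁻ˡ Q P) #Q≤′) ⟩
        d * (1 + d) * d                                                     ≤⟨ *-monoˡ-≤ d (*-monoʳ-≤ d 1+d≤) ⟩
        d * (d * 2) * d                                                     ≡⟨ assoc d ⟩
        d * d * (d * 2)                                                     ∎)
        where
        assoc : ∀ d → d * (d * 2) * d ≡ d * d * (d * 2)
        assoc = solve-∀
        rearrange : ∀ a b c → a ▹ ⟦ b ∧ c ⟧ ≡ b ▹ ⟦ a ∧ c ⟧
        rearrange true  true  c = refl
        rearrange true  false c = refl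
        rearrange false true  c = refl
        rearrange false false c = refl

      -- `X` is covered by `L′`, `R` and `Q`, of sizes at most `d²`, `d²` and `2d²`.
      bound : # X ≤ d * d * 4
      bound = begin
        # X                                   ≤⟨ #≤#∖+# X Q ⟩
        # L + # Q                             ≤⟨ +-mono-≤ (≤-trans (#≤#∖+# L R) (+-mono-≤ #L′≤ #R≤)) (≤-trans #Q≤′ (*-monoʳ-≤ d 1+d≤)) ⟩
        d * d + d * d + d * (d * 2)           ≡⟨ collect d ⟩
        d * d * 4                             ∎
        where
        #R≤ : # R ≤ d * d
        #R≤ = ≤-trans (#image≤ (finᶠ ×ᶠ finᶠ {d}) _) (*-monoˡ-≤ d j≤d)
        collect : ∀ d → d * d + d * d + d * (d * 2) ≡ d * d * 4
        collect = solve-∀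

-- 4-graphs: rich vertices, high triples and A-pairs

module _ {n : ℕ} where

  private
    V = Fin n

  record Graph₄ (E : V → V → V → V → Bool) : Set where
    field
      swap₁₂   : ∀ {v u w x} → E v u w x ≡ true → E u v w x ≡ true
      swap₂₃   : ∀ {v u w x} → E v u w x ≡ true → E v w u x ≡ true
      swap₃₄   : ∀ {v u w x} → E v u w x ≡ true → E v u x w ≡ true
      distinct : ∀ {v u w x} → E v u w x ≡ true → v ≢ u
    link₄ : ∀ v → Graph₃ (E v)
    link₄ v = record { swap₁₂ = swap₂₃ ; swap₂₃ = swap₃₄ ; distinct = distinct ∘ swap₂₃ ∘ swap₁₂ }

  extend-by : ∀ {s m r} {I J K : Set} {P : (I → V) → Set} (eI : Fin s ↔ I) (eJ : Fin m ↔ J) (eK : Fin r ↔ K)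
              (B : (I → V) → J → (K → V) → Set)
            → (∀ f → P f → ∀ j Q → # Q ≤ s + m * r → ¬ ¬ Copy K (B f j) Q)
            → Copy I P ∅ → ¬ ¬ Copy (I ⊎ (J × K)) (λ f → P (f ∘ inj₁) × Each (B (f ∘ inj₁)) (f ∘ inj₂)) ∅
  extend-by {s} {m} {r} eI eJ eK B room c =
    greedy eJ eK (B (at c)) (∅ ∪ᵇ image eI (at c))
      (λ j Q Q≤ → room (at c) (prop c) j Q (≤-trans Q≤ (+-monoˡ-≤ (m * r) (#image≤ eI (at c))))) >>= λ c′ k →
    k (join {Q = λ f → Each (B f)} eI c c′)

  -- Richness quantifies over all small sets and is no Boolean; excluded middle at each vertex makes
  -- it a vertex set that can be counted.
  rich-set : ∀ t (Rich : V → Set) → ¬ Copy (Fin t) (λ f → ∀ s → Rich (f s)) ∅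
           → ¬ ¬ (∃[ r ] # r ≤ t × (∀ v → r v ≡ false → ¬ Rich v))
  rich-set t Rich ¬c = em-Fin Rich >>= λ rich? →
    let r : V → Bool
        r v = does (rich? v)
    in λ k → k (r , ≤-stable (λ ≰ →
         representatives (finᶠ {t}) (λ _ → r) ∅ (λ _ → ≤-<-trans (≤-reflexive (cong (_+ t) (#∅ n))) (≰⇒> ≰))
           λ c → ¬c (copy (at c) (inj c) (avoid c) (λ s → does⁻ {d = rich? (at c s)} (prop c s))))
       , λ v → does-false⁻ {d = rich? v})

module Rows {n : ℕ} {E : Fin n → Fin n → Fin n → Fin n → Bool} (G : Graph₄ E) (t d k : ℕ) where

  private
    V = Fin n

  open Graph₄ G renaming (distinct to distinct₄)

  -- t disjoint stars have ζ vertices, of which υ lie in the first three levels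
  -- and ρ in the first two.  More than α edges in N v u force d disjoint k-stars
  -- avoiding any ζ vertices.
  ζ υ ρ α : ℕ
  ζ = t * (1 + d * (1 + d * (1 + k)))
  υ = t * (1 + d * (1 + d))
  ρ = t * (1 + d)
  α = n * k + (d * (1 + k) * ζ + d * (1 + k) * ζ) + (ζ * ζ + ζ * ζ)

  M : V → V → V → Bool
  M v u = high (E v u) ζ

  N : V → V → V → V → Bool
  N v u = E v u ∖² M v u

  M-graph : Graph₃ M
  M-graph = record
    { swap₁₂   = λ {v} {u} {w} h → trans (high-cong (E u v) (E v u) ζ {w} {w} (sum-cong λ x → ⟦⟧-cong swap₁₂ swap₁₂)) h
    ; swap₂₃   = λ {v} {u} {w} h → trans (high-cong (E v w) (E v u) ζ {u} {w} (sum-cong λ x → ⟦⟧-cong swap₂₃ swap₂₃)) h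
    ; distinct = λ {v} {u} {w} h →
        let (x , e , _) = #<⇒∃∖ {p = E v u w} {∅} (≤-<-trans (≤-trans (≤-reflexive (#∅ n)) z≤n) (high⁻ (E v u) ζ h))
        in distinct₄ e }
    where
    ⟦⟧-cong : ∀ {a b} → (a ≡ true → b ≡ true) → (b ≡ true → a ≡ true) → ⟦ a ⟧ ≡ ⟦ b ⟧
    ⟦⟧-cong f g = ≤-antisym (⟦⟧-mono f) (⟦⟧-mono g)

  N-graph : ∀ v u → Graph (N v u)
  N-graph v u = ∖²-graph (M v u) (Graph₃.link (link₄ v) u)

  #N≤ : ∀ v u w → # (N v u w) ≤ ζ
  #N≤ v u w = [ (λ Mw → ≤-trans (#-mono {q = ∅} λ x h → ⊥-elim (true≢false Mw (proj₁ (proj₂ (∖²⁻ (E v u) (M v u) h)))))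
                           (≤-trans (≤-reflexive (#∅ n)) z≤n))
              , (λ ¬Mw → ≤-trans (#-mono λ x h → proj₁ (∖²⁻ (E v u) (M v u) h)) (low⁻ (E v u) ζ ¬Mw)) ]′ (true⊎false (M v u w))

  opaque
    A : V → V → Bool
    A v u = does (α <? #₂ (N v u))

    A⁻ : ∀ {v u} → A v u ≡ true → α < #₂ (N v u)
    A⁻ {v} {u} = does⁻ {d = α <? #₂ (N v u)}

    ¬A⁻ : ∀ {v u} → A v u ≡ false → #₂ (N v u) ≤ α
    ¬A⁻ {v} {u} h = ≮⇒≥ (does-false⁻ {d = α <? #₂ (N v u)} h)

    A-sym : ∀ {v u} → A v u ≡ true → A u v ≡ true
    A-sym {v} {u} h = dec-true (α <? #₂ (N u v)) (≤-trans (A⁻ h) (sum₂-mono λ w x → ⟦⟧-mono λ h →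
      let (e , ¬w , ¬x) = ∖²⁻ (E v u) (M v u) h in ∧⁺ (swap₁₂ e) (∧⁺ (not⁺ (flip ¬w)) (not⁺ (flip ¬x)))))
      where
      flip : ∀ {w} → M v u w ≡ false → M u v w ≡ false
      flip h = ¬true⇒false λ h′ → true≢false (Graph₃.swap₁₂ M-graph h′) h

  A-graph : Graph A
  A-graph = record { symmetric = A-sym ; irreflexive = λ { {v} h refl → irr (A⁻ h) } }
    where
    irr : ∀ {v} → ¬ (α < #₂ (N v v))
    irr {v} h = <⇒≱ h (≤-trans (≤-trans (sum₂-mono λ w x → ⟦⟧≤ λ h → ⊥-elim (distinct₄ (proj₁ (∖²⁻ (E v v) (M v v) h)) refl))
                               (≤-reflexive (trans (sum-cong λ _ → #∅ n) (#∅ n)))) z≤n)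

  -- `T` is to `M` what `M` is to `E`: its threshold `υ` is the number of vertices of `t` two-level
  -- stars.
  T : V → V → Bool
  T v = high (M v) υ

  T-graph : Graph T
  T-graph = record
    { symmetric   = λ {v} {u} h → trans (high-cong (M u) (M v) υ {v} {u}
        (sum-cong λ w → ≤-antisym (⟦⟧-mono (Graph₃.swap₁₂ M-graph)) (⟦⟧-mono (Graph₃.swap₁₂ M-graph)))) h
    ; irreflexive = λ {v} {u} h →
        let (w , e , _) = #<⇒∃∖ {p = M v u} {∅} (≤-<-trans (≤-trans (≤-reflexive (#∅ n)) z≤n) (high⁻ (M v) υ h))
        in Graph₃.distinct M-graph e }

  -- This is the origin of `α`. Degrees in `N v u` are at most `ζ`, so deleting `Z` costs at most
  -- `ζ * ζ + ζ * ζ`; the other terms are `stars-bound` for the rest.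
  A-stars : ∀ {v u} → A v u ≡ true → Fin k → ∀ Z → # Z ≤ ζ → ¬ ¬ Stars (E v u) d k Z
  A-stars {v} {u} h l₀ Z Z≤ ¬stars = <⇒≱ (A⁻ h)
    (≤-trans (#₂-delete (N-graph v u) Z (λ w _ → #N≤ v u w))
      (+-mono-≤ (stars-bound (∖²-graph Z (N-graph v u)) d k
          (λ w → ≤-trans (#-mono λ x h → proj₁ (∖²⁻ (N v u) Z h)) (#N≤ v u w))
          (¬stars ∘ map-prop (λ f h i l → proj₁ (∖²⁻ (E v u) (M v u) (h i l))) ∘ ∖²-stars (N v u) Z l₀))
        (+-mono-≤ Z² Z²)))
    where
    Z² = *-monoˡ-≤ ζ Z≤

-- Consequences of having no t disjoint stars

module StarFree {n : ℕ} {E : Fin n → Fin n → Fin n → Fin n → Bool} (G : Graph₄ E) (t d k : ℕ)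
  (i₀ : Fin d) (l₀ : Fin k) (¬stars₄ : ¬ Family (Fin t) {Cone (Fin d × Cone (Fin d × Cone (Fin k)))} (λ _ → IsStar₄ E) ∅) where

  private
    V = Fin n
    apex : ∀ {I : Set} → Cone I
    apex = inj₁ tt

  open Graph₄ G renaming (distinct to distinct₄)
  open Rows G t d k public

  -- Every triple of the stars is high and can receive `k` leaves: the `υ` vertices in place and all
  -- the leaves together number exactly `ζ`.
  ¬M-stars₃ : ¬ Stars₃ M t d d ∅
  ¬M-stars₃ c = extend (finᶠ ×ᶠ coneᶠ (finᶠ ×ᶠ starᶠ d)) (finᶠ ×ᶠ finᶠ {d} ×ᶠ finᶠ {d} ×ᶠ finᶠ)
    (λ f (s , i , j , l) → E (f (s , apex)) (f (s , inj₂ (i , apex))) (f (s , inj₂ (i , inj₂ j))))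
    (λ f h (s , i , j , l) → ≤-<-trans (≤-reflexive (total t d k)) (high⁻ (E _ _) ζ (h s i j))) c
    λ c′ → ¬stars₄ (reindex to from from∘to (λ f (_ , h) s i j l → h (s , i , j , l)) c′)
    where
    total : ∀ t d k → t * (1 + d * (1 + d)) + t * (d * (d * k)) ≡ t * (1 + d * (1 + d * (1 + k)))
    total = solve-∀
    to : Fin t × Cone (Fin d × Cone (Fin d × Cone (Fin k)))
       → (Fin t × Cone (Fin d × Cone (Fin d))) ⊎ (Fin t × Fin d × Fin d × Fin k)
    to (s , inj₁ tt)                                = inj₁ (s , apex)
    to (s , inj₂ (i , inj₁ tt))                     = inj₁ (s , inj₂ (i , apex))
    to (s , inj₂ (i , inj₂ (j , inj₁ tt)))          = inj₁ (s , inj₂ (i , inj₂ j))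
    to (s , inj₂ (i , inj₂ (j , inj₂ l)))           = inj₂ (s , i , j , l)
    from : (Fin t × Cone (Fin d × Cone (Fin d))) ⊎ (Fin t × Fin d × Fin d × Fin k)
         → Fin t × Cone (Fin d × Cone (Fin d × Cone (Fin k)))
    from (inj₁ (s , inj₁ tt))              = s , apex
    from (inj₁ (s , inj₂ (i , inj₁ tt)))   = s , inj₂ (i , apex)
    from (inj₁ (s , inj₂ (i , inj₂ j)))    = s , inj₂ (i , inj₂ (j , apex))
    from (inj₂ (s , i , j , l))            = s , inj₂ (i , inj₂ (j , inj₂ l))
    from∘to : ∀ x → from (to x) ≡ x
    from∘to (s , inj₁ tt)                       = refl
    from∘to (s , inj₂ (i , inj₁ tt))            = refl
    from∘to (s , inj₂ (i , inj₂ (j , inj₁ tt))) = refl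
    from∘to (s , inj₂ (i , inj₂ (j , inj₂ l)))  = refl

  -- The same extension one level up: `ρ` vertices in place and `t * d * d` new ones make exactly
  -- `υ`.
  ¬T-stars : ¬ Stars T t d ∅
  ¬T-stars c = extend (finᶠ ×ᶠ starᶠ d) (finᶠ ×ᶠ finᶠ {d} ×ᶠ finᶠ {d})
    (λ f (s , i , j) → M (f (s , apex)) (f (s , inj₂ i)))
    (λ f h (s , i , j) → ≤-<-trans (≤-reflexive (total t d)) (high⁻ (M _) υ (h s i))) c
    λ c′ → ¬M-stars₃ (reindex to from from∘to (λ f (_ , h) s i j → h (s , i , j)) c′)
    where
    total : ∀ t d → t * (1 + d) + t * (d * d) ≡ t * (1 + d * (1 + d))
    total = solve-∀
    to : Fin t × Cone (Fin d × Cone (Fin d)) → (Fin t × Cone (Fin d)) ⊎ (Fin t × Fin d × Fin d)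
    to (s , inj₁ tt)            = inj₁ (s , apex)
    to (s , inj₂ (i , inj₁ tt)) = inj₁ (s , inj₂ i)
    to (s , inj₂ (i , inj₂ j))  = inj₂ (s , i , j)
    from : (Fin t × Cone (Fin d)) ⊎ (Fin t × Fin d × Fin d) → Fin t × Cone (Fin d × Cone (Fin d))
    from (inj₁ (s , inj₁ tt)) = s , apex
    from (inj₁ (s , inj₂ i))  = s , inj₂ (i , apex)
    from (inj₂ (s , i , j))   = s , inj₂ (i , inj₂ j)
    from∘to : ∀ x → from (to x) ≡ x
    from∘to (s , inj₁ tt)            = refl
    from∘to (s , inj₂ (i , inj₁ tt)) = refl
    from∘to (s , inj₂ (i , inj₂ j))  = refl

  ¬A-stars : ¬ Stars A t d ∅
  ¬A-stars c = extend-by (finᶠ ×ᶠ starᶠ d) (finᶠ ×ᶠ finᶠ {d}) (finᶠ ×ᶠ starᶠ k)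
    (λ f (s , i) → Each λ (_ : Fin d) → IsStar (E (f (s , apex)) (f (s , inj₂ i))))
    (λ f h (s , i) Q Q≤ → A-stars (h s i) l₀ Q (≤-trans Q≤ (≤-reflexive (total t d k)))) c
    λ c′ → ¬stars₄ (reindex to from from∘to (λ f (_ , h) s i j l → h (s , i) j l) c′)
    where
    total : ∀ t d k → t * (1 + d) + t * d * (d * (1 + k)) ≡ t * (1 + d * (1 + d * (1 + k)))
    total = solve-∀
    to : Fin t × Cone (Fin d × Cone (Fin d × Cone (Fin k)))
       → (Fin t × Cone (Fin d)) ⊎ ((Fin t × Fin d) × (Fin d × Cone (Fin k)))
    to (s , inj₁ tt)            = inj₁ (s , apex)
    to (s , inj₂ (i , inj₁ tt)) = inj₁ (s , inj₂ i)
    to (s , inj₂ (i , inj₂ x))  = inj₂ ((s , i) , x)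
    from : (Fin t × Cone (Fin d)) ⊎ ((Fin t × Fin d) × (Fin d × Cone (Fin k)))
         → Fin t × Cone (Fin d × Cone (Fin d × Cone (Fin k)))
    from (inj₁ (s , inj₁ tt))    = s , apex
    from (inj₁ (s , inj₂ i))     = s , inj₂ (i , apex)
    from (inj₂ ((s , i) , x))    = s , inj₂ (i , inj₂ x)
    from∘to : ∀ x → from (to x) ≡ x
    from∘to (s , inj₁ tt)            = refl
    from∘to (s , inj₂ (i , inj₁ tt)) = refl
    from∘to (s , inj₂ (i , inj₂ x))  = refl

  -- Richness survives the deletion of as many vertices as the whole family occupies, so that `t`
  -- rich vertices can be completed one after another.
  RichE RichM : V → Set
  RichE v = ∀ Z → # Z ≤ ζ → ¬ ¬ Stars₃ (E v) d d k Z
  RichM v = ∀ Z → # Z ≤ υ → ¬ ¬ Stars (M v) d d Z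

  ¬RichE-many : ¬ Copy (Fin t) (λ f → ∀ s → RichE (f s)) ∅
  ¬RichE-many c = extend-by finᶠ finᶠ (finᶠ ×ᶠ coneᶠ (finᶠ ×ᶠ starᶠ k))
    (λ f s → Each λ (_ : Fin d) → IsStar₃ (E (f s)))
    (λ f h s Q Q≤ → h s Q (≤-trans Q≤ (≤-reflexive (sym (*-suc t (d * (1 + d * (1 + k)))))))) c
    λ c′ → ¬stars₄ (reindex attach detach detach-attach (λ f (_ , h) → h) c′)

  ¬RichM-many : ¬ Copy (Fin t) (λ f → ∀ s → RichM (f s)) ∅
  ¬RichM-many c = extend-by finᶠ finᶠ (finᶠ ×ᶠ starᶠ d)
    (λ f s → Each λ (_ : Fin d) → IsStar (M (f s)))
    (λ f h s Q Q≤ → h s Q (≤-trans Q≤ (≤-reflexive (sym (*-suc t (d * (1 + d))))))) c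
    λ c′ → ¬M-stars₃ (reindex attach detach detach-attach (λ f (_ , h) → h) c′)

  -- Since `v` is not rich, some set of at most `ζ` vertices leaves no `d` disjoint stars in the
  -- link; adding a maximal family of them gives the number of vertices deleted, each of degree at
  -- most `δ`.
  light-bound : ∀ {v F δ} → ¬ RichE v → Graph₃ F → (∀ {u w x} → F u w x ≡ true → E v u w x ≡ true)
              → (∀ u → #₂ (F u) ≤ δ) → let Q = (ζ + d * (1 + d * (1 + k))) * δ in
                #₃ F ≤ star₃Bound {n} d k + (Q + (Q + Q))
  light-bound {v} {F} {δ} ¬rich GF F⊆E deg≤ = ≤-stable λ ≰ → ¬rich λ Z Z≤ ¬stars →
    let Qδ = *-monoˡ-≤ δ (+-monoˡ-≤ (d * (1 + d * (1 + k))) Z≤) in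
    ≰ (≤-trans (stars₃-bound GF d d k i₀ l₀ deg≤ Z
         (¬stars ∘ map-prop (λ f h s i l → F⊆E (h s i l))))
       (+-monoʳ-≤ (star₃Bound {n} d k) (+-mono-≤ Qδ (+-mono-≤ Qδ Qδ))))

-- The edges at a single vertex

module Degrees {n : ℕ} {E : Fin n → Fin n → Fin n → Fin n → Bool} (G : Graph₄ E) (t d k : ℕ)
  (i₀ : Fin d) (l₀ : Fin k) (¬stars₄ : ¬ Family (Fin t) {Cone (Fin d × Cone (Fin d × Cone (Fin k)))} (λ _ → IsStar₄ E) ∅) where

  private
    V = Fin n

  open Graph₄ G renaming (distinct to distinct₄)
  open StarFree G t d k i₀ l₀ ¬stars₄ public

  ¬M-swap₂₃ : ∀ {v u w} → M v u w ≡ false → M v w u ≡ false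
  ¬M-swap₂₃ h = ¬true⇒false λ h′ → true≢false (Graph₃.swap₂₃ M-graph h′) h

  -- Only the triples through `v` are tested, because these are pairs in the link of `v`; the triple
  -- `u w x` may be high.
  NoTriple : V → V → V → V → Bool
  NoTriple v u w x = E v u w x ∧ (not (M v u w) ∧ (not (M v u x) ∧ not (M v w x)))

  NoTriple⁻ : ∀ {v u w x} → NoTriple v u w x ≡ true
            → E v u w x ≡ true × M v u w ≡ false × M v u x ≡ false × M v w x ≡ false
  NoTriple⁻ {v} {u} {w} {x} h = ∧⁻ˡ h , not⁻ (∧⁻ˡ h₁) , not⁻ (∧⁻ˡ h₂) , not⁻ (∧⁻ʳ {not (M v u x)} h₂)
    where
    h₁ = ∧⁻ʳ {E v u w x} h
    h₂ = ∧⁻ʳ {not (M v u w)} h₁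

  NoTriple-graph : ∀ v → Graph₃ (NoTriple v)
  NoTriple-graph v = record
    { swap₁₂   = λ h → let (e , uw , ux , wx) = NoTriple⁻ h in
                   ∧⁺ (swap₂₃ e) (∧⁺ (not⁺ (¬M-swap₂₃ uw)) (∧⁺ (not⁺ wx) (not⁺ ux)))
    ; swap₂₃   = λ h → let (e , uw , ux , wx) = NoTriple⁻ h in
                   ∧⁺ (swap₃₄ e) (∧⁺ (not⁺ ux) (∧⁺ (not⁺ uw) (not⁺ (¬M-swap₂₃ wx))))
    ; distinct = λ h → Graph₃.distinct (link₄ v) (∧⁻ˡ h) }

  Light : V → V → V → V → Bool
  Light v = NoTriple v ∖³ A v

  Light-degree : ∀ v u → #₂ (Light v u) ≤ α
  Light-degree v u = [ (λ Au → ≤-trans (sum₂-mono λ w x → ⟦⟧≤ λ h → ⊥-elim (true≢false Au (proj₁ (proj₂ (∖³⁻ (NoTriple v) (A v) h)))))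
                                (≤-trans (≤-reflexive (trans (sum-cong λ _ → #∅ n) (#∅ n))) z≤n))
                     , (λ ¬Au → ≤-trans (sum₂-mono λ w x → ⟦⟧-mono λ h →
                          let (e , uw , ux , _) = NoTriple⁻ (proj₁ (∖³⁻ (NoTriple v) (A v) h)) in ∧⁺ e (∧⁺ (not⁺ uw) (not⁺ ux)))
                          (¬A⁻ ¬Au)) ]′ (true⊎false (A v u))

  #Light≤ : ∀ v → ¬ RichE v → let Q = (ζ + d * (1 + d * (1 + k))) * α in
            #₃ (Light v) ≤ star₃Bound {n} d k + (Q + (Q + Q))
  #Light≤ v ¬rich = light-bound ¬rich (∖³-graph (A v) (NoTriple-graph v))
    (λ h → ∧⁻ˡ (proj₁ (∖³⁻ (NoTriple v) (A v) h))) (Light-degree v)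

  -- An edge that is not light contains an A-neighbour of `v` or a pair of `M v`, in one of three
  -- positions. Restricting to edges off `K` lets these be counted off `K`; `K` will be `∅` or the
  -- set meeting all stars of `A` and `M`.
  decompose : ∀ v K → let a = # (A v ∖ K) * (n * n); m = #₂ (M v ∖² K) * n in
              #₃ (E v ∖³ K) ≤ #₃ (Light v) + (a + (a + (a + (m + (m + m)))))
  decompose v K = ≤-trans (sum₃-mono pointwise)
    (sum₃-+≤ _ _ ≤-refl
    (sum₃-+≤ (λ u w x → ⟦ A′ u ⟧) _ a₁ (sum₃-+≤ (λ u w x → ⟦ A′ w ⟧) _ a₂ (sum₃-+≤ (λ u w x → ⟦ A′ x ⟧) _ a₃
    (sum₃-+≤ (λ u w x → ⟦ M′ u w ⟧) _ m₁ (sum₃-+≤ (λ u w x → ⟦ M′ u x ⟧) (λ u w x → ⟦ M′ w x ⟧) m₂ m₃))))))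
    where
    open ≤-Reasoning
    A′ : V → Bool
    A′ = A v ∖ K
    M′ : V → V → Bool
    M′ = M v ∖² K
    const₂ : ∀ c → sum₂ {n} (λ _ _ → c) ≡ c * (n * n)
    const₂ c = trans (trans (sum-cong λ _ → sum-const n c) (sum-const n (n * c))) (arith n c)
      where
      arith : ∀ n c → n * (n * c) ≡ c * (n * n)
      arith = solve-∀
    a₁ : sum₃ (λ u w x → ⟦ A′ u ⟧) ≤ # A′ * (n * n)
    a₁ = ≤-reflexive (trans (sum-cong λ u → const₂ ⟦ A′ u ⟧) (sum-*ʳ (λ u → ⟦ A′ u ⟧) (n * n)))
    a₂ : sum₃ (λ u w x → ⟦ A′ w ⟧) ≤ # A′ * (n * n)
    a₂ = ≤-trans (≤-reflexive (sum₃-12 λ u w x → ⟦ A′ u ⟧)) a₁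
    a₃ : sum₃ (λ u w x → ⟦ A′ x ⟧) ≤ # A′ * (n * n)
    a₃ = ≤-trans (≤-reflexive (sum₃-13 λ u w x → ⟦ A′ u ⟧)) a₁
    m₁ : sum₃ (λ u w x → ⟦ M′ u w ⟧) ≤ #₂ M′ * n
    m₁ = ≤-reflexive (trans (sum-cong λ u → trans (sum-cong λ w → trans (sum-const n ⟦ M′ u w ⟧) (*-comm n _))
                              (sum-*ʳ (λ w → ⟦ M′ u w ⟧) n)) (sum-*ʳ (λ u → # (M′ u)) n))
    m₂ : sum₃ (λ u w x → ⟦ M′ u x ⟧) ≤ #₂ M′ * n
    m₂ = ≤-trans (≤-reflexive (sum₃-23 λ u w x → ⟦ M′ u w ⟧)) m₁
    m₃ : sum₃ (λ u w x → ⟦ M′ w x ⟧) ≤ #₂ M′ * n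
    m₃ = ≤-reflexive (trans (sum-const n (#₂ M′)) (*-comm n _))
    cover : ∀ a b c p q r → 1 ≤ ⟦ not a ∧ (not b ∧ (not c ∧ (not p ∧ (not q ∧ not r)))) ⟧
              + (⟦ a ⟧ + (⟦ b ⟧ + (⟦ c ⟧ + (⟦ p ⟧ + (⟦ q ⟧ + ⟦ r ⟧)))))
    cover true  _     _     _     _     _     = s≤s z≤n
    cover false true  _     _     _     _     = s≤s z≤n
    cover false false true  _     _     _     = s≤s z≤n
    cover false false false true  _     _     = s≤s z≤n
    cover false false false false true  _     = s≤s z≤n
    cover false false false false false true  = s≤s z≤n
    cover false false false false false false = s≤s z≤n
    regroup : ∀ a b c p q r → a ∧ (b ∧ (c ∧ (p ∧ (q ∧ r)))) ≡ true → p ∧ (q ∧ r) ≡ true × a ∧ (b ∧ c) ≡ true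
    regroup true true true p q r h = h , refl
    pointwise : ∀ u w x → ⟦ (E v ∖³ K) u w x ⟧ ≤ ⟦ Light v u w x ⟧
              + (⟦ A′ u ⟧ + (⟦ A′ w ⟧ + (⟦ A′ x ⟧ + (⟦ M′ u w ⟧ + (⟦ M′ u x ⟧ + ⟦ M′ w x ⟧)))))
    pointwise u w x = ⟦⟧≤ λ h → let (e , ¬u , ¬w , ¬x) = ∖³⁻ (E v) K h in
      ≤-trans (cover (A v u) (A v w) (A v x) (M v u w) (M v u x) (M v w x))
        (+-mono-≤ (⟦⟧-mono λ h → let (m , a) = regroup (not (A v u)) (not (A v w)) (not (A v x))
                                             (not (M v u w)) (not (M v u x)) (not (M v w x)) h in ∧⁺ (∧⁺ e m) a)
        (+-mono-≤ (⟦⟧-mono {A v u} λ a → ∧⁺ a (not⁺ ¬u))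
        (+-mono-≤ (⟦⟧-mono {A v w} λ a → ∧⁺ a (not⁺ ¬w))
        (+-mono-≤ (⟦⟧-mono {A v x} λ a → ∧⁺ a (not⁺ ¬x))
        (+-mono-≤ (⟦⟧-mono {M v u w} λ m → ∧⁺ m (∧⁺ (not⁺ ¬u) (not⁺ ¬w)))
        (+-mono-≤ (⟦⟧-mono {M v u x} λ m → ∧⁺ m (∧⁺ (not⁺ ¬u) (not⁺ ¬x)))
                  (⟦⟧-mono {M v w x} λ m → ∧⁺ m (∧⁺ (not⁺ ¬w) (not⁺ ¬x)))))))))

  -- `μ` is the bound of `star-free-edges` for a graph without `d` disjoint `d`-stars.
  D μ : ℕ
  D = d * (1 + d)
  μ = n * d + (D * D + D * D) + (d * n + d * n)

  ¬M-stars : ∀ v Y → Y v ≡ false → ¬ Copy (Cone (Fin d × Cone (Fin d))) (IsStar₃ M) Y → ¬ Stars (M v) d d Y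
  ¬M-stars v Y ¬Yv ¬star c = ¬star (cone (λ v → Each λ _ → IsStar (M v)) v ¬Yv c
    λ { (i , inj₁ tt) → Graph₃.distinct M-graph (prop c i i₀)
      ; (i , inj₂ j)  → Graph₃.distinct M-graph (Graph₃.swap₂₃ M-graph (prop c i j)) })

  #M∖≤ : ∀ v Y → Y v ≡ false → ¬ Copy (Cone (Fin d × Cone (Fin d))) (IsStar₃ M) Y → #₂ (M v ∖² Y) ≤ μ
  #M∖≤ v Y ¬Yv ¬star = star-free-edges (∖²-graph Y (Graph₃.link M-graph v)) d d
    (¬M-stars v Y ¬Yv ¬star ∘ ∖²-stars (M v) Y i₀)

  -- Meant for vertices at which no set meeting the stars of `M` can be avoided. Deleting the
  -- neighbours in `T v` first brings the degrees down to `υ`; then the set `U` witnessing that `v`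
  -- is not rich costs only order `υ * υ`.
  #M≤ : ∀ v → ¬ RichM v → # (T v) ≤ ρ → #₂ (M v) ≤ μ + (υ * υ + υ * υ) + (ρ * n + ρ * n)
  #M≤ v ¬rich #T≤ = ≤-stable λ ≰ → ¬rich λ U U≤ ¬stars →
    let Uυ = *-monoˡ-≤ υ U≤
        Tn = *-monoˡ-≤ n #T≤
        M-link = Graph₃.link M-graph v
        MT = ∖²-graph (T v) M-link
    in ≰ (begin
      #₂ (M v)                                                     ≤⟨ #₂-delete M-link (T v) (λ u _ → #≤n (M v u)) ⟩
      #₂ (M v ∖² T v) + (# (T v) * n + # (T v) * n)                ≤⟨ +-mono-≤ (#₂-delete MT U (λ u _ → degree v u)) (+-mono-≤ Tn Tn) ⟩
      #₂ ((M v ∖² T v) ∖² U) + (# U * υ + # U * υ) + (ρ * n + ρ * n) ≤⟨ +-monoˡ-≤ (ρ * n + ρ * n) (+-mono-≤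
          (star-free-edges (∖²-graph U MT) d d
            (¬stars ∘ map-prop (λ f h i l → proj₁ (∖²⁻ (M v) (T v) (h i l))) ∘ ∖²-stars (M v ∖² T v) U i₀))
          (+-mono-≤ Uυ Uυ)) ⟩
      μ + (υ * υ + υ * υ) + (ρ * n + ρ * n)                         ∎)
    where
    open ≤-Reasoning
    degree : ∀ v u → # ((M v ∖² T v) u) ≤ υ
    degree v u = [ (λ Tu → ≤-trans (#-mono {q = ∅} λ w h → ⊥-elim (true≢false Tu (proj₁ (proj₂ (∖²⁻ (M v) (T v) h)))))
                              (≤-trans (≤-reflexive (#∅ n)) z≤n))
                 , (λ ¬Tu → ≤-trans (#-mono λ w h → proj₁ (∖²⁻ (M v) (T v) h)) (low⁻ (M v) υ ¬Tu)) ]′ (true⊎false (T v u))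

-- 4-graphs without any star

1≤ˡ : ∀ {a b} → 1 ≤ a → 1 ≤ a + b
1≤ˡ h = ≤-trans h (m≤m+n _ _)

1≤ʳ : ∀ {a b} → 1 ≤ b → 1 ≤ a + b
1≤ʳ {a} h = ≤-trans h (m≤n+m _ a)

module _ {n : ℕ} where

  private
    V = Fin n

  sum₄-12 : (f : V → V → V → V → ℕ) → sum₄ (λ v u w x → f u v w x) ≡ sum₄ f
  sum₄-12 f = sum-swap λ v u → sum₂ (f u v)

  sum₄-23 : (f : V → V → V → V → ℕ) → sum₄ (λ v u w x → f v w u x) ≡ sum₄ f
  sum₄-23 f = sum-cong λ v → sum₃-12 (f v)

  sum₄-34 : (f : V → V → V → V → ℕ) → sum₄ (λ v u w x → f v u x w) ≡ sum₄ f
  sum₄-34 f = sum-cong λ v → sum₃-23 (f v)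

  module _ (f : V → V → V → V → ℕ) where
    sum₄-wvux : sum₄ (λ v u w x → f w v u x) ≡ sum₄ f
    sum₄-wvux = trans (sum₄-23 λ v u w x → f u v w x) (sum₄-12 f)

    sum₄-xvuw : sum₄ (λ v u w x → f x v u w) ≡ sum₄ f
    sum₄-xvuw = trans (sum₄-34 λ v u w x → f w v u x) sum₄-wvux

    sum₄-vxuw : sum₄ (λ v u w x → f v x u w) ≡ sum₄ f
    sum₄-vxuw = trans (sum₄-34 λ v u w x → f v w u x) (sum₄-23 f)

    sum₄-uwvx : sum₄ (λ v u w x → f u w v x) ≡ sum₄ f
    sum₄-uwvx = trans (sum₄-12 λ v u w x → f v w u x) (sum₄-23 f)

    sum₄-uxvw : sum₄ (λ v u w x → f u x v w) ≡ sum₄ f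
    sum₄-uxvw = trans (sum₄-12 λ v u w x → f v x u w) sum₄-vxuw

    sum₄-wxvu : sum₄ (λ v u w x → f w x v u) ≡ sum₄ f
    sum₄-wxvu = trans (sum₄-23 λ v u w x → f u x v w) sum₄-uxvw

module Single {n : ℕ} {E : Fin n → Fin n → Fin n → Fin n → Bool} (G : Graph₄ E) (d k : ℕ)
  (i₀ : Fin d) (l₀ : Fin k) (¬star : ¬ Copy (Cone (Fin d × Cone (Fin d × Cone (Fin k)))) (IsStar₄ E) ∅) where

  private
    V = Fin n

  open Graph₄ G renaming (distinct to distinct₄)

  one : ∀ {I : Set} {P : (I → V) → Set} → ¬ Copy I P ∅ → ¬ Family (Fin 1) (λ _ → P) ∅
  one ¬c c = ¬c (reindex (zero ,_) proj₂ (λ _ → refl) (λ f h → h zero) c)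

  same : ∀ {I : Set} {P : (I → V) → Set} → ¬ Family (Fin 1) (λ _ → P) ∅ → ¬ Copy I P ∅
  same ¬c c = ¬c (reindex proj₂ (zero ,_) (λ { (zero , _) → refl }) (λ { f h zero → h }) c)

  open Degrees G 1 d k i₀ l₀ (one ¬star)

  ¬richE : ∀ v → ¬ RichE v
  ¬richE v h = ¬RichE-many (copy (λ _ → v) (λ { {zero} {zero} _ → refl }) (λ _ → refl) (λ _ → h))

  #A≤ : ∀ v → # (A v) ≤ d
  #A≤ v = ≤-trans (#-mono λ u h → ∧⁺ h refl)
    (star-free-row (Graph.irreflexive A-graph) ∅ (same ¬A-stars) v refl)

  #T≤ : ∀ v → # (T v) ≤ d
  #T≤ v = ≤-trans (#-mono λ u h → ∧⁺ h refl)
    (star-free-row (Graph.irreflexive T-graph) ∅ (same ¬T-stars) v refl)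

  -- The threshold must be of order `d`: order `d * n` edges through a high triple at a pair are
  -- within the order `d * k * n` of `α`, while `υ * n`, of order `d * d * n`, need not be. The
  -- price is up to `4d²` such pairs at a vertex, against `d` for `T`.
  B : V → V → Bool
  B v = high (M v) (d * 4)

  B-sym : ∀ {v u} → B v u ≡ true → B u v ≡ true
  B-sym {v} {u} h = trans (high-cong (M u) (M v) (d * 4) {v} {u}
    (sum-cong λ w → ≤-antisym (⟦⟧-mono (Graph₃.swap₁₂ M-graph)) (⟦⟧-mono (Graph₃.swap₁₂ M-graph)))) h

  1≤d : 1 ≤ d
  1≤d = ≤-trans (s≤s z≤n) (toℕ<n i₀)

  #B≤ : ∀ v → # (B v) ≤ d * d * 4
  #B≤ v = star-free-#high≤ (Graph₃.link M-graph v) d 1≤d (¬M-stars v ∅ refl (same ¬M-stars₃))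

  Free : V → V → V → V → Bool
  Free v = E v ∖³ (A v ∪ᵇ B v)

  δ : ℕ
  δ = α + (d * 4 * n + d * 4 * n)

  Free-degree : ∀ v u → #₂ (Free v u) ≤ δ
  Free-degree v u = [ (λ K → ≤-trans (sum₂-mono λ w x → ⟦⟧≤ λ h → ⊥-elim (true≢false K (proj₁ (proj₂ (∖³⁻ (E v) (A v ∪ᵇ B v) h)))))
                              (≤-trans (≤-reflexive (trans (sum-cong λ _ → #∅ n) (#∅ n))) z≤n))
                    , (λ ¬K → ≤-trans (sum₂-mono λ w x → pointwise w x)
                         (sum₂-+≤ (λ w x → ⟦ N v u w x ⟧) _ (¬A⁻ (∨-false⁻ˡ ¬K))
                           (sum₂-+≤ (λ w x → ⟦ M v u w ⟧) (λ w x → ⟦ M v u x ⟧) (Mn ¬K)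
                             (≤-trans (≤-reflexive (sum-swap λ w x → ⟦ M v u x ⟧)) (Mn ¬K))))) ]′ (true⊎false ((A v ∪ᵇ B v) u))
    where
    Mn : (A v ∪ᵇ B v) u ≡ false → sum₂ (λ w x → ⟦ M v u w ⟧) ≤ d * 4 * n
    Mn ¬K = ≤-trans (≤-reflexive (trans (sum-cong λ w → trans (sum-const n ⟦ M v u w ⟧) (*-comm n _)) (sum-*ʳ (λ w → ⟦ M v u w ⟧) n)))
      (*-monoˡ-≤ n (low⁻ (M v) (d * 4) (∨-false⁻ʳ {A v u} ¬K)))
    pointwise : ∀ w x → ⟦ Free v u w x ⟧ ≤ ⟦ N v u w x ⟧ + (⟦ M v u w ⟧ + ⟦ M v u x ⟧)
    pointwise w x = ⟦⟧≤ λ h →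
      [ (λ m → 1≤ʳ {a = ⟦ N v u w x ⟧} (1≤ˡ (1≤⟦⟧ m)))
      , (λ ¬w → [ (λ m → 1≤ʳ {a = ⟦ N v u w x ⟧} (1≤ʳ {a = ⟦ M v u w ⟧} (1≤⟦⟧ m)))
                , (λ ¬x → 1≤ˡ (1≤⟦⟧ (∧⁺ (proj₁ (∖³⁻ (E v) (A v ∪ᵇ B v) h)) (∧⁺ (not⁺ ¬w) (not⁺ ¬x))))) ]′ (true⊎false (M v u x))) ]′
      (true⊎false (M v u w))

  freeBound : ℕ
  freeBound = star₃Bound {n} d k + (Q + (Q + Q))
    where Q = (ζ + d * (1 + d * (1 + k))) * δ

  #Free≤ : #₄ Free ≤ n * freeBound
  #Free≤ = sum-≤ λ v → light-bound (¬richE v) (∖³-graph (A v ∪ᵇ B v) (link₄ v))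
    (λ h → proj₁ (∖³⁻ (E v) (A v ∪ᵇ B v) h)) (Free-degree v)

  -- An edge which is not free at any of its vertices has a partner (Pr) at each
  -- of them.  If some pair of the edge lies in B°, then the edge either lies in N
  -- at that pair, or contains a triple of M through it, and the partner of the
  -- fourth vertex leaves few choices.  Otherwise the pairs in S cover the edge, so
  -- two of them form a path or a matching.
  S Pr B° : V → V → Bool
  S v = A v ∪ᵇ T v
  Pr v = S v ∪ᵇ B v
  B° v = B v ∖ S v

  S-sym : ∀ {v u} → S v u ≡ true → S u v ≡ true
  S-sym {v} {u} h = [ (λ a → ∨⁺ˡ (A-sym a)) , (λ t → ∨⁺ʳ {A u v} (Graph.symmetric T-graph t)) ]′ (∨⁻ h)

  Pr-sym : ∀ {v u} → Pr v u ≡ true → Pr u v ≡ true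
  Pr-sym {v} {u} h = [ (λ s → ∨⁺ˡ (S-sym s)) , (λ b → ∨⁺ʳ {S u v} (B-sym b)) ]′ (∨⁻ h)

  σ π : ℕ
  σ = d + d
  π = σ + d * d * 4

  #S≤ : ∀ v → # (S v) ≤ σ
  #S≤ v = ≤-trans (#∪≤ (A v) (T v)) (+-mono-≤ (#A≤ v) (#T≤ v))

  #Pr≤ : ∀ v → # (Pr v) ≤ π
  #Pr≤ v = ≤-trans (#∪≤ (S v) (B v)) (+-mono-≤ (#S≤ v) (#B≤ v))

  via : V → V → V → V → ℕ
  via v u w x = B° v u ▹ (⟦ N v u w x ⟧ + (M v u w ▹ (⟦ Pr v x ⟧ + (⟦ Pr u x ⟧ + ⟦ Pr w x ⟧))
                                          + M v u x ▹ (⟦ Pr v w ⟧ + (⟦ Pr u w ⟧ + ⟦ Pr x w ⟧))))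

  fork : V → V → V → V → ℕ
  fork v u w x = S v u ▹ S v w ▹ 1

  matching : V → V → V → V → ℕ
  matching v u w x = S v u ▹ S w x ▹ 1

  -- The factors are choices: `v`, a partner `u` in `B°`, then either an edge of `N v u`, at most
  -- `α` because the pair is not in `A`, or a third vertex, at most `υ` because it is not in `T`,
  -- followed by a partner of one of the three.
  viaBound : ℕ
  viaBound = n * (π * (α + (υ * (π + (π + π)) + υ * (π + (π + π)))))

  via≤ : sum₄ via ≤ viaBound
  via≤ = sum-≤ λ v → ≤-trans
    (≤-trans (≤-reflexive (sum-cong λ u → sum₂-▹ (B° v u)))
      (▹sum-≤ (B° v) λ u h → sum₂-+≤ (λ w x → ⟦ N v u w x ⟧) _ (¬A⁻ (∨-false⁻ˡ (∖⁻ʳ (B v) (S v) h)))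
        (sum₂-+≤ (λ w x → M v u w ▹ (⟦ Pr v x ⟧ + (⟦ Pr u x ⟧ + ⟦ Pr w x ⟧)))
                 (λ w x → M v u x ▹ (⟦ Pr v w ⟧ + (⟦ Pr u w ⟧ + ⟦ Pr x w ⟧)))
          (part v u h) (≤-trans (≤-reflexive (sum-swap λ w x → M v u x ▹ (⟦ Pr v w ⟧ + (⟦ Pr u w ⟧ + ⟦ Pr x w ⟧)))) (part v u h)))))
    (*-monoˡ-≤ _ (≤-trans (#-mono λ u h → ∨⁺ʳ {S v u} (∖⁻ˡ (B v) (S v) h)) (#Pr≤ v)))
    where
    part : ∀ v u → B° v u ≡ true → sum₂ (λ w x → M v u w ▹ (⟦ Pr v x ⟧ + (⟦ Pr u x ⟧ + ⟦ Pr w x ⟧))) ≤ υ * (π + (π + π))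
    part v u h = ≤-trans (≤-reflexive (sum-cong λ w → sum-▹ (M v u w)))
      (≤-trans (▹sum-≤ (M v u) λ w _ → ≤-trans (≤-reflexive (trans (sum-+ (λ x → ⟦ Pr v x ⟧) (λ x → ⟦ Pr u x ⟧ + ⟦ Pr w x ⟧))
                  (cong (# (Pr v) +_) (sum-+ (λ x → ⟦ Pr u x ⟧) (λ x → ⟦ Pr w x ⟧)))))
                  (+-mono-≤ (#Pr≤ v) (+-mono-≤ (#Pr≤ u) (#Pr≤ w))))
        (*-monoˡ-≤ _ (low⁻ (M v) υ (∨-false⁻ʳ {A v u} (∖⁻ʳ (B v) (S v) h)))))

  fork≤ : sum₄ fork ≤ n * (σ * (σ * n))
  fork≤ = sum-≤ λ v → ≤-trans (≤-reflexive (sum-cong λ u → sum₂-▹ (S v u)))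
    (≤-trans (▹sum-≤ (S v) λ u _ → ≤-trans (≤-reflexive (sum-cong λ w → sum-▹ (S v w)))
        (≤-trans (▹sum-≤ (S v) λ w _ → ≤-reflexive (trans (sum-const n 1) (*-identityʳ n))) (*-monoˡ-≤ n (#S≤ v))))
      (*-monoˡ-≤ _ (#S≤ v)))

  matching≤ : sum₄ matching ≤ n * (σ * (n * σ))
  matching≤ = sum-≤ λ v → ≤-trans (≤-reflexive (sum-cong λ u → sum₂-▹ (S v u)))
    (≤-trans (▹sum-≤ (S v) λ u _ → sum-≤ λ w → ≤-trans (▹sum-≤ (S w) λ x _ → ≤-refl {1})
        (≤-trans (≤-reflexive (*-identityʳ _)) (#S≤ w)))
      (*-monoˡ-≤ _ (#S≤ v)))

  Partner : (V → V → Bool) → V → V → V → V → Set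
  Partner R v u w x = R v u ≡ true ⊎ R v w ≡ true ⊎ R v x ≡ true

  swap-12 : ∀ {R v u w x} → Partner R v u w x → Partner R v w u x
  swap-12 (inj₁ h)        = inj₂ (inj₁ h)
  swap-12 (inj₂ (inj₁ h)) = inj₁ h
  swap-12 (inj₂ (inj₂ h)) = inj₂ (inj₂ h)

  swap-23 : ∀ {R v u w x} → Partner R v u w x → Partner R v u x w
  swap-23 (inj₁ h)        = inj₁ h
  swap-23 (inj₂ (inj₁ h)) = inj₂ (inj₂ h)
  swap-23 (inj₂ (inj₂ h)) = inj₂ (inj₁ h)

  ¬Free⇒partner : ∀ {v u w x} → E v u w x ≡ true → Free v u w x ≡ false → Partner Pr v u w x
  ¬Free⇒partner {v} {u} {w} {x} e ¬f = go (true⊎false (K u)) (true⊎false (K w)) (true⊎false (K x))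
    where
    K : V → Bool
    K = A v ∪ᵇ B v
    K⇒Pr : ∀ {u} → K u ≡ true → Pr v u ≡ true
    K⇒Pr {u} h = [ (λ a → ∨⁺ˡ (∨⁺ˡ a)) , ∨⁺ʳ {S v u} ]′ (∨⁻ h)
    go : K u ≡ true ⊎ K u ≡ false → K w ≡ true ⊎ K w ≡ false → K x ≡ true ⊎ K x ≡ false → Partner Pr v u w x
    go (inj₁ h) _ _ = inj₁ (K⇒Pr h)
    go _ (inj₁ h) _ = inj₂ (inj₁ (K⇒Pr h))
    go _ _ (inj₁ h) = inj₂ (inj₂ (K⇒Pr h))
    go (inj₂ a) (inj₂ b) (inj₂ c) = ⊥-elim (true≢false (∧⁺ e (∧⁺ (not⁺ a) (∧⁺ (not⁺ b) (not⁺ c)))) ¬f)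

  1≤via : ∀ {v u w x} → E v u w x ≡ true → B° v u ≡ true → Partner Pr w v u x → Partner Pr x v u w → 1 ≤ via v u w x
  1≤via {v} {u} {w} {x} e b pw px = 1≤▹ b ([ (λ m → 1≤ʳ {a = ⟦ N v u w x ⟧} (1≤ˡ (1≤▹ m (pick px))))
    , (λ ¬w → [ (λ m → 1≤ʳ {a = ⟦ N v u w x ⟧} (1≤ʳ {a = M v u w ▹ _} (1≤▹ m (pick pw))))
              , (λ ¬x → 1≤ˡ (1≤⟦⟧ (∧⁺ e (∧⁺ (not⁺ ¬w) (not⁺ ¬x))))) ]′ (true⊎false (M v u x))) ]′ (true⊎false (M v u w)))
    where
    pick : ∀ {a b c x} → Partner Pr x a b c → 1 ≤ ⟦ Pr a x ⟧ + (⟦ Pr b x ⟧ + ⟦ Pr c x ⟧)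
    pick (inj₁ h)                          = 1≤ˡ (1≤⟦⟧ (Pr-sym h))
    pick {a} (inj₂ (inj₁ h))               = 1≤ʳ {a = ⟦ Pr a _ ⟧} (1≤ˡ (1≤⟦⟧ (Pr-sym h)))
    pick {a} {b} (inj₂ (inj₂ h))           = 1≤ʳ {a = ⟦ Pr a _ ⟧} (1≤ʳ {a = ⟦ Pr b _ ⟧} (1≤⟦⟧ (Pr-sym h)))

  singleBound : ℕ
  singleBound = (a + (a + (a + a))) + ((b + (b + (b + (b + (b + b))))) + ((c + (c + (c + (c + c)))) + (e + (e + e))))
    where
    a = n * freeBound
    b = viaBound
    c = n * (σ * (σ * n))
    e = n * (σ * (n * σ))

  free : V → V → V → V → ℕ
  free v u w x = ⟦ Free v u w x ⟧

  frees vias forks matchings : V → V → V → V → ℕ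
  frees v u w x = free v u w x + (free u v w x + (free w v u x + free x v u w))
  vias v u w x = via v u w x + (via v w u x + (via v x u w + (via u w v x + (via u x v w + via w x v u))))
  forks v u w x = fork v u w x + (fork v u x w + (fork u v w x + (fork w v u x + fork x v u w)))
  matchings v u w x = matching v u w x + (matching v w u x + matching v x u w)

  cover : ∀ v u w x → ⟦ E v u w x ⟧ ≤ frees v u w x + (vias v u w x + (forks v u w x + matchings v u w x))
  cover v u w x = ⟦⟧≤ λ e → byFree e (true⊎false (Free v u w x)) (true⊎false (Free u v w x))
                                     (true⊎false (Free w v u x)) (true⊎false (Free x v u w))
    where
    Dec′ : Bool → Set
    Dec′ b = b ≡ true ⊎ b ≡ false
    goal = 1 ≤ frees v u w x + (vias v u w x + (forks v u w x + matchings v u w x))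
    inFree : 1 ≤ frees v u w x → goal
    inFree = 1≤ˡ
    inVia : 1 ≤ vias v u w x → goal
    inVia h = 1≤ʳ {a = frees v u w x} (1≤ˡ h)
    inFork : 1 ≤ forks v u w x → goal
    inFork h = 1≤ʳ {a = frees v u w x} (1≤ʳ {a = vias v u w x} (1≤ˡ h))
    inMatching : 1 ≤ matchings v u w x → goal
    inMatching h = 1≤ʳ {a = frees v u w x} (1≤ʳ {a = vias v u w x} (1≤ʳ {a = forks v u w x} h))

    toS : ∀ {a b} → Pr a b ≡ true → B° a b ≡ false → S a b ≡ true
    toS {a} {b} h ¬b = [ (λ s → s) , (λ Bab → ≢false⇒true λ ¬s → true≢false (∧⁺ Bab (not⁺ ¬s)) ¬b) ]′ (∨⁻ h)

    fork⁺ : ∀ {a b c} y → S a b ≡ true → S a c ≡ true → 1 ≤ fork a b c y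
    fork⁺ _ p q = 1≤▹ p (1≤▹ q ≤-refl)
    matching⁺ : ∀ {a b c y} → S a b ≡ true → S c y ≡ true → 1 ≤ matching a b c y
    matching⁺ p q = 1≤▹ p (1≤▹ q ≤-refl)

    -- One of `u` and `w` is outside the pair chosen at `v`. The pair chosen at that vertex is a
    -- different one, so the two meet in a vertex or are disjoint.
    byS : Partner S v u w x → Partner S u v w x → Partner S w v u x → goal
    byS (inj₁ vu) _ (inj₁ wv)        = inFork (1≤ˡ (fork⁺ x vu (S-sym wv)))
    byS (inj₁ vu) _ (inj₂ (inj₁ wu)) = inFork (1≤ʳ {a = fork v u w x} (1≤ʳ {a = fork v u x w}
                                         (1≤ˡ (fork⁺ x (S-sym vu) (S-sym wu)))))
    byS (inj₁ vu) _ (inj₂ (inj₂ wx)) = inMatching (1≤ˡ (matching⁺ vu wx))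
    byS (inj₂ (inj₁ vw)) (inj₁ uv)        _ = inFork (1≤ˡ (fork⁺ x (S-sym uv) vw))
    byS (inj₂ (inj₁ vw)) (inj₂ (inj₁ uw)) _ = inFork (1≤ʳ {a = fork v u w x} (1≤ʳ {a = fork v u x w}
                                                (1≤ʳ {a = fork u v w x} (1≤ˡ (fork⁺ x (S-sym vw) (S-sym uw))))))
    byS (inj₂ (inj₁ vw)) (inj₂ (inj₂ ux)) _ = inMatching (1≤ʳ {a = matching v u w x} (1≤ˡ (matching⁺ vw ux)))
    byS (inj₂ (inj₂ vx)) (inj₁ uv)        _ = inFork (1≤ʳ {a = fork v u w x} (1≤ˡ (fork⁺ w (S-sym uv) vx)))
    byS (inj₂ (inj₂ vx)) (inj₂ (inj₁ uw)) _ = inMatching (1≤ʳ {a = matching v u w x} (1≤ʳ {a = matching v w u x} (matching⁺ vx uw)))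
    byS (inj₂ (inj₂ vx)) (inj₂ (inj₂ ux)) _ = inFork (1≤ʳ {a = fork v u w x} (1≤ʳ {a = fork v u x w}
                                                (1≤ʳ {a = fork u v w x} (1≤ʳ {a = fork w v u x} (fork⁺ w (S-sym vx) (S-sym ux))))))

    toPartnerS : ∀ {a b c y} → Partner Pr a b c y → B° a b ≡ false → B° a c ≡ false → B° a y ≡ false → Partner S a b c y
    toPartnerS (inj₁ h)        p q r = inj₁ (toS h p)
    toPartnerS (inj₂ (inj₁ h)) p q r = inj₂ (inj₁ (toS h q))
    toPartnerS (inj₂ (inj₂ h)) p q r = inj₂ (inj₂ (toS h r))

    B°-sym : ∀ {a b} → B° a b ≡ false → B° b a ≡ false
    B°-sym {a} {b} h = ¬true⇒false λ h′ → true≢false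
      (∧⁺ (B-sym (∖⁻ˡ (B b) (S b) h′)) (not⁺ (¬true⇒false λ s → true≢false (S-sym s) (∖⁻ʳ (B b) (S b) h′)))) h

    byVia : E v u w x ≡ true → Partner Pr v u w x → Partner Pr u v w x → Partner Pr w v u x → Partner Pr x v u w
          → Dec′ (B° v u) → Dec′ (B° v w) → Dec′ (B° v x) → Dec′ (B° u w) → Dec′ (B° u x) → Dec′ (B° w x) → goal
    byVia e pv pu pw px (inj₁ b) _ _ _ _ _ = inVia (1≤ˡ (1≤via e b pw px))
    byVia e pv pu pw px _ (inj₁ b) _ _ _ _ = inVia (1≤ʳ {a = via v u w x} (1≤ˡ (1≤via (swap₂₃ e) b pu (swap-23 {Pr} px))))
    byVia e pv pu pw px _ _ (inj₁ b) _ _ _ = inVia (1≤ʳ {a = via v u w x} (1≤ʳ {a = via v w u x} (1≤ˡ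
      (1≤via (swap₂₃ (swap₃₄ e)) b (swap-23 {Pr} pu) (swap-23 {Pr} pw)))))
    byVia e pv pu pw px _ _ _ (inj₁ b) _ _ = inVia (1≤ʳ {a = via v u w x} (1≤ʳ {a = via v w u x} (1≤ʳ {a = via v x u w} (1≤ˡ
      (1≤via (swap₂₃ (swap₁₂ e)) b pv (swap-23 {Pr} (swap-12 {Pr} px)))))))
    byVia e pv pu pw px _ _ _ _ (inj₁ b) _ = inVia (1≤ʳ {a = via v u w x} (1≤ʳ {a = via v w u x} (1≤ʳ {a = via v x u w} (1≤ʳ {a = via u w v x} (1≤ˡ
      (1≤via (swap₂₃ (swap₃₄ (swap₁₂ e))) b (swap-23 {Pr} pv) (swap-23 {Pr} (swap-12 {Pr} pw))))))))
    byVia e pv pu pw px _ _ _ _ _ (inj₁ b) = inVia (1≤ʳ {a = via v u w x} (1≤ʳ {a = via v w u x} (1≤ʳ {a = via v x u w} (1≤ʳ {a = via u w v x} (1≤ʳ {a = via u x v w}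
      (1≤via (swap₂₃ (swap₃₄ (swap₁₂ (swap₂₃ e)))) b (swap-23 {Pr} (swap-12 {Pr} pv)) (swap-23 {Pr} (swap-12 {Pr} pu))))))))
    byVia e pv pu pw px (inj₂ vu) (inj₂ vw) (inj₂ vx) (inj₂ uw) (inj₂ ux) (inj₂ wx) =
      byS (toPartnerS pv vu vw vx) (toPartnerS pu (B°-sym vu) uw ux) (toPartnerS pw (B°-sym vw) (B°-sym uw) wx)

    byFree : E v u w x ≡ true → Dec′ (Free v u w x) → Dec′ (Free u v w x) → Dec′ (Free w v u x) → Dec′ (Free x v u w) → goal
    byFree e (inj₁ h) _ _ _ = inFree (1≤ˡ (1≤⟦⟧ h))
    byFree e _ (inj₁ h) _ _ = inFree (1≤ʳ {a = free v u w x} (1≤ˡ (1≤⟦⟧ h)))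
    byFree e _ _ (inj₁ h) _ = inFree (1≤ʳ {a = free v u w x} (1≤ʳ {a = free u v w x} (1≤ˡ (1≤⟦⟧ h))))
    byFree e _ _ _ (inj₁ h) = inFree (1≤ʳ {a = free v u w x} (1≤ʳ {a = free u v w x} (1≤ʳ {a = free w v u x} (1≤⟦⟧ h))))
    byFree e (inj₂ fv) (inj₂ fu) (inj₂ fw) (inj₂ fx) =
      byVia e (¬Free⇒partner e fv) (¬Free⇒partner (swap₁₂ e) fu) (¬Free⇒partner (swap₁₂ (swap₂₃ e)) fw)
        (¬Free⇒partner (swap₁₂ (swap₂₃ (swap₃₄ e))) fx)
        (true⊎false _) (true⊎false _) (true⊎false _) (true⊎false _) (true⊎false _) (true⊎false _)

  #₄-bound : #₄ E ≤ singleBound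
  #₄-bound = ≤-trans (sum₄-mono cover)
    (sum₄-+≤ frees _
      (sum₄-+≤ free _ #Free≤ (sum₄-+≤ (λ v u w x → free u v w x) _ (by (sum₄-12 free) #Free≤)
        (sum₄-+≤ (λ v u w x → free w v u x) (λ v u w x → free x v u w) (by (sum₄-wvux free) #Free≤) (by (sum₄-xvuw free) #Free≤))))
    (sum₄-+≤ vias _
      (sum₄-+≤ via _ via≤ (sum₄-+≤ (λ v u w x → via v w u x) _ (by (sum₄-23 via) via≤)
        (sum₄-+≤ (λ v u w x → via v x u w) _ (by (sum₄-vxuw via) via≤) (sum₄-+≤ (λ v u w x → via u w v x) _ (by (sum₄-uwvx via) via≤)
        (sum₄-+≤ (λ v u w x → via u x v w) (λ v u w x → via w x v u) (by (sum₄-uxvw via) via≤) (by (sum₄-wxvu via) via≤))))))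
    (sum₄-+≤ forks matchings
      (sum₄-+≤ fork _ fork≤ (sum₄-+≤ (λ v u w x → fork v u x w) _ (by (sum₄-34 fork) fork≤)
        (sum₄-+≤ (λ v u w x → fork u v w x) _ (by (sum₄-12 fork) fork≤)
        (sum₄-+≤ (λ v u w x → fork w v u x) (λ v u w x → fork x v u w) (by (sum₄-wvux fork) fork≤) (by (sum₄-xvuw fork) fork≤)))))
      (sum₄-+≤ matching _ matching≤ (sum₄-+≤ (λ v u w x → matching v w u x) (λ v u w x → matching v x u w)
        (by (sum₄-23 matching) matching≤) (by (sum₄-vxuw matching) matching≤))))))
    where
    by : ∀ {a b c : ℕ} → a ≡ b → b ≤ c → a ≤ c
    by refl b≤c = b≤c

-- Heavy and light vertices: distributing all edges

module Combine {n : ℕ} {E : Fin n → Fin n → Fin n → Fin n → Bool} (G : Graph₄ E) (t d k : ℕ)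
  (i₀ : Fin d) (l₀ : Fin k) (¬stars₄ : ¬ Family (Fin t) {Cone (Fin d × Cone (Fin d × Cone (Fin k)))} (λ _ → IsStar₄ E) ∅)
  (Δ : ℕ) where

  private
    V = Fin n

  open Graph₄ G renaming (distinct to distinct₄)
  open Degrees G t d k i₀ l₀ ¬stars₄ public

  degree : V → ℕ
  degree v = #₃ (E v)

  -- `Δ` over `τ` is the degree that separates heavy from light; comparing products avoids the
  -- division.
  τ : ℕ
  τ = t * d * d

  opaque
    heavy : V → Bool
    heavy v = does (Δ <? degree v * τ)

    heavy⁻ : ∀ {v} → heavy v ≡ true → Δ ≤ degree v * τ
    heavy⁻ {v} h = <⇒≤ (does⁻ {d = Δ <? degree v * τ} h)

    ¬heavy⁻ : ∀ {v} → heavy v ≡ false → degree v * τ ≤ Δ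
    ¬heavy⁻ {v} h = ≮⇒≥ (does-false⁻ {d = Δ <? degree v * τ} h)

  _∖⁴_ : (V → V → V → V → Bool) → (V → Bool) → V → V → V → V → Bool
  (F ∖⁴ K) v u w x = F v u w x ∧ (not (K v) ∧ (not (K u) ∧ (not (K w) ∧ not (K x))))

  ∖⁴⁻ : ∀ K {v u w x} → (E ∖⁴ K) v u w x ≡ true
      → E v u w x ≡ true × K v ≡ false × K u ≡ false × K w ≡ false × K x ≡ false
  ∖⁴⁻ K {v} {u} {w} {x} h =
    ∧⁻ˡ h , not⁻ (∧⁻ˡ h₁) , not⁻ (∧⁻ˡ h₂) , not⁻ (∧⁻ˡ h₃) , not⁻ (∧⁻ʳ {not (K w)} h₃)
    where
    h₁ = ∧⁻ʳ {E v u w x} h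
    h₂ = ∧⁻ʳ {not (K v)} h₁
    h₃ = ∧⁻ʳ {not (K u)} h₂

  ∖⁴⁺ : ∀ K {v u w x} → E v u w x ≡ true → K v ≡ false → K u ≡ false → K w ≡ false → K x ≡ false
      → (E ∖⁴ K) v u w x ≡ true
  ∖⁴⁺ K e v u w x = ∧⁺ e (∧⁺ (not⁺ v) (∧⁺ (not⁺ u) (∧⁺ (not⁺ w) (not⁺ x))))

  ∖⁴-graph : ∀ K → Graph₄ (E ∖⁴ K)
  ∖⁴-graph K = record
    { swap₁₂   = λ h → let (e , v , u , w , x) = ∖⁴⁻ K h in ∖⁴⁺ K (swap₁₂ e) u v w x
    ; swap₂₃   = λ h → let (e , v , u , w , x) = ∖⁴⁻ K h in ∖⁴⁺ K (swap₂₃ e) v w u x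
    ; swap₃₄   = λ h → let (e , v , u , w , x) = ∖⁴⁻ K h in ∖⁴⁺ K (swap₃₄ e) v u x w
    ; distinct = λ h → distinct₄ (∧⁻ˡ h) }

  -- In `XY` nothing is deleted from the link, and only the bound `ρ` on A-neighbours is known; in
  -- `XH` the deletion of `Y` replaces `ρ` by `d` and leaves `μ` for the high pairs.
  lightBound XY XH : ℕ
  lightBound = star₃Bound {n} d k + (Q + (Q + Q))
    where Q = (ζ + d * (1 + d * (1 + k))) * α
  XY = lightBound + (a + (a + (a + (m + (m + m)))))
    where
    a = ρ * (n * n)
    m = (μ + (υ * υ + υ * υ) + (ρ * n + ρ * n)) * n
  XH = lightBound + (a + (a + (a + (m + (m + m)))))
    where
    a = d * (n * n)
    m = μ * n

  module Parts
    (R Z Y : V → Bool)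
    (¬richE : ∀ v → R v ≡ false → ¬ RichE v)
    (¬richM : ∀ v → R v ≡ false → ¬ RichM v)
    (#A≤ : ∀ v → R v ≡ false → # (A v) ≤ ρ)
    (#T≤ : ∀ v → R v ≡ false → # (T v) ≤ ρ)
    (¬star₄ : ¬ Copy (Cone (Fin d × Cone (Fin d × Cone (Fin k)))) (IsStar₄ E) Z)
    (¬starA : ¬ Copy (Cone (Fin d)) (IsStar A) Y)
    (¬starM : ¬ Copy (Cone (Fin d × Cone (Fin d))) (IsStar₃ M) Y) where

    H′ : V → Bool
    H′ = heavy ∖ (R ∪ᵇ Y)

    -- The edges counted at their vertex v by p: all of them if v is rich (R), light
    -- in Z, or in Y, and those avoiding Y if v is any other heavy vertex.  An edge
    -- counted at none of its vertices avoids Z.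
    p₁ p₂ p₃ p₄ p : V → V → V → V → ℕ
    p₁ v u w x = R v ▹ ⟦ E v u w x ⟧
    p₂ v u w x = (Z ∖ heavy) v ▹ ⟦ E v u w x ⟧
    p₃ v u w x = (Y ∖ R) v ▹ ⟦ E v u w x ⟧
    p₄ v u w x = H′ v ▹ ⟦ (E v ∖³ Y) u w x ⟧
    p v u w x = p₁ v u w x + (p₂ v u w x + (p₃ v u w x + p₄ v u w x))

    light-sum : ℕ
    light-sum = sum λ v → (Z ∖ heavy) v ▹ degree v

    light-sum≤ : light-sum * τ ≤ # Z * Δ
    light-sum≤ = begin
      light-sum * τ                                ≡⟨ sym (sum-*ʳ (λ v → (Z ∖ heavy) v ▹ degree v) τ) ⟩
      sum (λ v → ((Z ∖ heavy) v ▹ degree v) * τ)   ≡⟨ sum-cong (λ v → ▹-* ((Z ∖ heavy) v)) ⟩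
      sum (λ v → (Z ∖ heavy) v ▹ (degree v * τ))   ≤⟨ ▹sum-≤ (Z ∖ heavy) (λ v h → ¬heavy⁻ (∖⁻ʳ Z heavy h)) ⟩
      # (Z ∖ heavy) * Δ                            ≤⟨ *-monoˡ-≤ Δ (#-mono λ v → ∖⁻ˡ Z heavy) ⟩
      # Z * Δ                                      ∎
      where
      open ≤-Reasoning
      ▹-* : ∀ b {a c} → (b ▹ a) * c ≡ b ▹ (a * c)
      ▹-* true  = refl
      ▹-* false = refl

    p≤ : sum₄ p ≤ # R * (n * (n * n)) + (light-sum + (# Y * XY + # heavy * XH))
    p≤ = sum₄-+≤ p₁ _ p₁≤ (sum₄-+≤ p₂ _ p₂≤ (sum₄-+≤ p₃ p₄ p₃≤ p₄≤))
      where
      p₁≤ : sum₄ p₁ ≤ # R * (n * (n * n))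
      p₁≤ = ≤-trans (≤-reflexive (sum-cong λ v → sum₃-▹ (R v)))
        (▹sum-≤ R λ v _ → sum-≤ λ u → sum-≤ λ w → #≤n (E v u w))
      p₂≤ : sum₄ p₂ ≤ light-sum
      p₂≤ = ≤-reflexive (sum-cong λ v → sum₃-▹ ((Z ∖ heavy) v))
      p₃≤ : sum₄ p₃ ≤ # Y * XY
      p₃≤ = ≤-trans (≤-reflexive (sum-cong λ v → sum₃-▹ ((Y ∖ R) v)))
        (≤-trans (▹sum-≤ (Y ∖ R) λ v h → row v (∖⁻ʳ Y R h)) (*-monoˡ-≤ XY (#-mono λ v → ∖⁻ˡ Y R)))
        where
        row : ∀ v → R v ≡ false → #₃ (E v) ≤ XY
        row v ¬R = ≤-trans (sum₃-mono λ u w x → ⟦⟧-mono λ e → ∧⁺ e refl) (≤-trans (decompose v ∅)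
          (+-mono-≤ (#Light≤ v (¬richE v ¬R)) (+-mono-≤ a (+-mono-≤ a (+-mono-≤ a (+-mono-≤ m (+-mono-≤ m m)))))))
          where
          a = *-monoˡ-≤ (n * n) (≤-trans (#-mono λ u → ∧⁻ˡ) (#A≤ v ¬R))
          m = *-monoˡ-≤ n (≤-trans (sum₂-mono λ u w → ⟦⟧-mono ∧⁻ˡ) (#M≤ v (¬richM v ¬R) (#T≤ v ¬R)))
      p₄≤ : sum₄ p₄ ≤ # heavy * XH
      p₄≤ = ≤-trans (≤-reflexive (sum-cong λ v → sum₃-▹ (H′ v)))
        (≤-trans (▹sum-≤ H′ λ v h → row v (∖⁻ʳ heavy (R ∪ᵇ Y) h)) (*-monoˡ-≤ XH (#-mono λ v → ∖⁻ˡ heavy (R ∪ᵇ Y))))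
        where
        row : ∀ v → (R ∪ᵇ Y) v ≡ false → #₃ (E v ∖³ Y) ≤ XH
        row v ¬RY = ≤-trans (decompose v Y)
          (+-mono-≤ (#Light≤ v (¬richE v (∨-false⁻ˡ ¬RY))) (+-mono-≤ a (+-mono-≤ a (+-mono-≤ a (+-mono-≤ m (+-mono-≤ m m))))))
          where
          ¬Yv = ∨-false⁻ʳ {R v} ¬RY
          a = *-monoˡ-≤ (n * n) (star-free-row (Graph.irreflexive A-graph) Y ¬starA v ¬Yv)
          m = *-monoˡ-≤ n (#M∖≤ v Y ¬Yv ¬starM)

    cover : ∀ v u w x → ⟦ E v u w x ⟧ ≤ p v u w x + (p u v w x + (p w v u x + (p x v u w + ⟦ (E ∖⁴ Z) v u w x ⟧)))
    cover v u w x = ⟦⟧≤ λ e → go e (swap₁₂ e) (swap₁₂ (swap₂₃ e)) (swap₁₂ (swap₂₃ (swap₃₄ e)))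
      where
      goal = 1 ≤ p v u w x + (p u v w x + (p w v u x + (p x v u w + ⟦ (E ∖⁴ Z) v u w x ⟧)))

      at₁ : 1 ≤ p v u w x → goal
      at₁ = 1≤ˡ
      at₂ : 1 ≤ p u v w x → goal
      at₂ h = 1≤ʳ {a = p v u w x} (1≤ˡ h)
      at₃ : 1 ≤ p w v u x → goal
      at₃ h = 1≤ʳ {a = p v u w x} (1≤ʳ {a = p u v w x} (1≤ˡ h))
      at₄ : 1 ≤ p x v u w → goal
      at₄ h = 1≤ʳ {a = p v u w x} (1≤ʳ {a = p u v w x} (1≤ʳ {a = p w v u x} (1≤ˡ h)))
      rest : 1 ≤ ⟦ (E ∖⁴ Z) v u w x ⟧ → goal
      rest h = 1≤ʳ {a = p v u w x} (1≤ʳ {a = p u v w x} (1≤ʳ {a = p w v u x} (1≤ʳ {a = p x v u w} h)))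

      inRY : ∀ {a b c y} → E a b c y ≡ true → 1 ≤ p a b c y ⊎ (R a ≡ false × Y a ≡ false)
      inRY {a} {b} {c} {y} e = go′ (true⊎false (R a)) (true⊎false (Y a))
        where
        go′ : R a ≡ true ⊎ R a ≡ false → Y a ≡ true ⊎ Y a ≡ false → 1 ≤ p a b c y ⊎ (R a ≡ false × Y a ≡ false)
        go′ (inj₁ r)  _         = inj₁ (1≤ˡ (1≤▹ r (1≤⟦⟧ e)))
        go′ (inj₂ ¬r) (inj₁ h)  = inj₁ (1≤ʳ {a = p₁ a b c y} (1≤ʳ {a = p₂ a b c y} (1≤ˡ (1≤▹ (∧⁺ h (not⁺ ¬r)) (1≤⟦⟧ e)))))
        go′ (inj₂ ¬r) (inj₂ ¬h) = inj₂ (¬r , ¬h)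

      -- At a heavy vertex only edges avoiding `Y` are counted, so all four vertices must be known
      -- to lie off `Y` before heaviness is examined.
      inHZ : ∀ {a b c y} → E a b c y ≡ true → R a ≡ false × Y a ≡ false → Y b ≡ false → Y c ≡ false → Y y ≡ false
           → 1 ≤ p a b c y ⊎ Z a ≡ false
      inHZ {a} {b} {c} {y} e (¬ra , ¬ya) ¬yb ¬yc ¬yy = go′ (true⊎false (heavy a)) (true⊎false (Z a))
        where
        go′ : heavy a ≡ true ⊎ heavy a ≡ false → Z a ≡ true ⊎ Z a ≡ false → 1 ≤ p a b c y ⊎ Z a ≡ false
        go′ (inj₁ h)  _        = inj₁ (1≤ʳ {a = p₁ a b c y} (1≤ʳ {a = p₂ a b c y} (1≤ʳ {a = p₃ a b c y}
                                   (1≤▹ (∧⁺ h (not⁺ (∨-false⁺ ¬ra ¬ya)))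
                                        (1≤⟦⟧ (∧⁺ e (∧⁺ (not⁺ ¬yb) (∧⁺ (not⁺ ¬yc) (not⁺ ¬yy)))))))))
        go′ (inj₂ ¬h) (inj₁ z) = inj₁ (1≤ʳ {a = p₁ a b c y} (1≤ˡ (1≤▹ (∧⁺ z (not⁺ ¬h)) (1≤⟦⟧ e))))
        go′ (inj₂ ¬h) (inj₂ z) = inj₂ z

      go : E v u w x ≡ true → E u v w x ≡ true → E w v u x ≡ true → E x v u w ≡ true → goal
      go ev eu ew ex = [ at₁ , (λ v′ → [ at₂ , (λ u′ → [ at₃ , (λ w′ → [ at₄ , (λ x′ → go″ v′ u′ w′ x′) ]′ (inRY ex)) ]′ (inRY ew)) ]′ (inRY eu)) ]′ (inRY ev)
        where
        go″ : R v ≡ false × Y v ≡ false → R u ≡ false × Y u ≡ false → R w ≡ false × Y w ≡ false → R x ≡ false × Y x ≡ false → goal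
        go″ v′@(_ , yv) u′@(_ , yu) w′@(_ , yw) x′@(_ , yx) =
          [ at₁ , (λ zv → [ at₂ , (λ zu → [ at₃ , (λ zw → [ at₄ , (λ zx → rest (1≤⟦⟧ (∖⁴⁺ Z ev zv zu zw zx))) ]′
            (inHZ ex x′ yv yu yw)) ]′ (inHZ ew w′ yv yu yx)) ]′ (inHZ eu u′ yv yw yx)) ]′ (inHZ ev v′ yu yw yx)

    star-free : ¬ Copy (Cone (Fin d × Cone (Fin d × Cone (Fin k)))) (IsStar₄ (E ∖⁴ Z)) ∅
    star-free = ¬star₄ ∘ weaken (λ f h i j l → proj₁ (∖⁴⁻ Z (h i j l)))
      (λ { f h (inj₁ tt)                             → let (_ , v , _) = ∖⁴⁻ Z (h i₀ i₀ l₀) in v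
         ; f h (inj₂ (i , inj₁ tt))                  → let (_ , _ , u , _) = ∖⁴⁻ Z (h i i₀ l₀) in u
         ; f h (inj₂ (i , inj₂ (j , inj₁ tt)))       → let (_ , _ , _ , w , _) = ∖⁴⁻ Z (h i j l₀) in w
         ; f h (inj₂ (i , inj₂ (j , inj₂ l)))        → let (_ , _ , _ , _ , x) = ∖⁴⁻ Z (h i j l) in x })

    open Single (∖⁴-graph Z) d k i₀ l₀ star-free using (singleBound; #₄-bound)

    total : let P = # R * (n * (n * n)) + (light-sum + (# Y * XY + # heavy * XH)) in
            #₄ E ≤ P + (P + (P + (P + singleBound)))
    total = ≤-trans (sum₄-mono cover)
      (sum₄-+≤ p _ p≤ (sum₄-+≤ (λ v u w x → p u v w x) _ (by (sum₄-12 p) p≤)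
      (sum₄-+≤ (λ v u w x → p w v u x) _ (by (sum₄-wvux p) p≤)
      (sum₄-+≤ (λ v u w x → p x v u w) (λ v u w x → ⟦ (E ∖⁴ Z) v u w x ⟧) (by (sum₄-xvuw p) p≤) #₄-bound))))
      where
      by : ∀ {a b c : ℕ} → a ≡ b → b ≤ c → a ≤ c
      by refl b≤c = b≤c

  #heavy≤ : # heavy * Δ ≤ #₄ E * τ
  #heavy≤ = begin
    # heavy * Δ                               ≤⟨ ▹sum-≥ heavy (λ v → heavy⁻) ⟩
    sum (λ v → heavy v ▹ (degree v * τ))      ≤⟨ sum-mono (λ v → ▹≤ (heavy v)) ⟩
    sum (λ v → degree v * τ)                  ≡⟨ sum-*ʳ degree τ ⟩
    #₄ E * τ                                  ∎
    where open ≤-Reasoning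

-- Orders of magnitude and constants

-- The numeral is kept as an index, apart from the monomial, so that constants
-- are found by computation and monomials by unification.
record _≲_·_ (a m c : ℕ) : Set where
  constructor bounded
  field
    bound : a ≤ m * c
open _≲_·_

infix 4 _≲_·_
infixl 6 _⊕_
infixl 7 _⊗_

_⊕_ : ∀ {m a b c c′} → a ≲ m · c → b ≲ m · c′ → a + b ≲ m · (c + c′)
_⊕_ {m} {c = c} {c′} (bounded p) (bounded q) = bounded (≤-trans (+-mono-≤ p q) (≤-reflexive (sym (*-distribˡ-+ m c c′))))

_⊗_ : ∀ {m m′ a b c c′} → a ≲ m · c → b ≲ m′ · c′ → a * b ≲ m * m′ · (c * c′)
_⊗_ {m} {m′} {c = c} {c′} (bounded p) (bounded q) = bounded (≤-trans (*-mono-≤ p q) (≤-reflexive (eq m m′ c c′)))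
  where
  eq : ∀ m m′ c c′ → (m * c) * (m′ * c′) ≡ (m * m′) * (c * c′)
  eq = solve-∀

unit : ∀ {a} → a ≲ a · 1
unit {a} = bounded (≤-reflexive (sym (*-identityʳ a)))

one≤ : ∀ {m} → 1 ≤ m → 1 ≲ m · 1
one≤ {m} h = bounded (≤-trans h (≤-reflexive (sym (*-identityʳ m))))

scaled : ∀ {m} c → m * c ≲ m · c
scaled c = bounded ≤-refl

lift : ∀ {m m′ a c} → m ≤ m′ → a ≲ m · c → a ≲ m′ · c
lift {c = c} h (bounded p) = bounded (≤-trans p (*-monoˡ-≤ c h))

below : ∀ {a b m c} → a ≤ b → b ≲ m · c → a ≲ m · c
below h (bounded p) = bounded (≤-trans h p)

split : ∀ {s x y m c c′} → s * x ≲ m · c → s * y ≲ m · c′ → s * (x + y) ≲ m · (c + c′)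
split {s} {x} {y} p q = below (≤-reflexive (*-distribˡ-+ s x y)) (p ⊕ q)

splitʳ : ∀ s z x y {m c c′} → s * (x * z) ≲ m · c → s * (y * z) ≲ m · c′ → s * ((x + y) * z) ≲ m · (c + c′)
splitʳ s z x y p q = below (≤-reflexive (cong (s *_) (*-distribʳ-+ z x y))) (split {s} p q)

≤*ˡ : ∀ {m} s → 1 ≤ s → m ≤ s * m
≤*ˡ {m} s h = ≤-trans (≤-reflexive (sym (*-identityˡ m))) (*-monoˡ-≤ m h)

module Numerics (n t d k : ℕ) (1≤t : 1 ≤ t) (1≤d : 1 ≤ d) (1≤k : 1 ≤ k) (kd³≤n : k * (d * d * d) ≤ n) where

  open ≤-Reasoning

  -- The capital monomials are orders of magnitude: `T₀` of `ζ`, `W` of `α`, `X` of the light edges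
  -- at a vertex, `K₀` of the final bound.
  ζ υ ρ α T₀ W X K₀ N₃ D μ : ℕ
  ζ = t * (1 + d * (1 + d * (1 + k)))
  υ = t * (1 + d * (1 + d))
  ρ = t * (1 + d)
  α = n * k + (d * (1 + k) * ζ + d * (1 + k) * ζ) + (ζ * ζ + ζ * ζ)
  T₀ = t * (d * (d * k))
  W = t * t * d * k * n
  X = t * t * t * (n * (n * k))
  N₃ = n * (n * n)
  K₀ = n * (n * (n * k))
  D = d * (1 + d)
  μ = n * d + (D * D + D * D) + (d * n + d * n)

  d³≤n : d * d * d ≤ n
  d³≤n = ≤-trans (≤*ˡ k 1≤k) kd³≤n

  1≤dk : 1 ≤ d * k
  1≤dk = *-mono-≤ 1≤d 1≤k

  1≤ddk : 1 ≤ d * (d * k)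
  1≤ddk = *-mono-≤ 1≤d 1≤dk

  dk≤ : d * (1 + k) ≲ d * k · 2
  dk≤ = unit {d} ⊗ (one≤ 1≤k ⊕ unit {k})

  ddk≤ : d * (1 + d * (1 + k)) ≲ d * (d * k) · 3
  ddk≤ = unit {d} ⊗ (one≤ 1≤dk ⊕ dk≤)

  ζ≤ : ζ ≲ T₀ · 4
  ζ≤ = unit {t} ⊗ (one≤ 1≤ddk ⊕ ddk≤)

  d1d≤ : d * (1 + d) ≲ d * d · 2
  d1d≤ = unit {d} ⊗ (one≤ 1≤d ⊕ unit {d})

  υ≤ : υ ≲ t * (d * d) · 3
  υ≤ = unit {t} ⊗ (one≤ (*-mono-≤ 1≤d 1≤d) ⊕ d1d≤)

  ρ≤ : ρ ≲ t * d · 2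
  ρ≤ = unit {t} ⊗ (one≤ 1≤d ⊕ unit {d})

  α≤ : α ≲ W · 49
  α≤ = (lift nk≤W unit ⊕ lift T₀²≤W (dkζ ⊕ dkζ)) ⊕ lift T₀²≤W (ζ≤ ⊗ ζ≤ ⊕ ζ≤ ⊗ ζ≤)
    where
    dkζ : d * (1 + k) * ζ ≲ T₀ * T₀ · 8
    dkζ = lift (≤-trans (≤*ˡ d 1≤d) (≤*ˡ t 1≤t)) dk≤ ⊗ ζ≤
    nk≤W : n * k ≤ W
    nk≤W = ≤-trans (≤*ˡ (t * t * d) (*-mono-≤ (*-mono-≤ 1≤t 1≤t) 1≤d)) (≤-reflexive (eq t d k n))
      where
      eq : ∀ t d k n → t * t * d * (n * k) ≡ t * t * d * k * n
      eq = solve-∀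
    T₀²≤W : T₀ * T₀ ≤ W
    T₀²≤W = ≤-trans (≤-reflexive (eq t d k)) (*-monoʳ-≤ (t * t * d * k) kd³≤n)
      where
      eq : ∀ t d k → (t * (d * (d * k))) * (t * (d * (d * k))) ≡ t * t * d * k * (k * (d * d * d))
      eq = solve-∀

  n≤nk : n ≤ n * k
  n≤nk = ≤-trans (≤*ˡ k 1≤k) (≤-reflexive (*-comm k n))

  star₃≤ : star₃Bound {n} d k ≲ n * (n * k) · 30
  star₃≤ = A≤ ⊕ (A≤ ⊕ (A≤ ⊕ (B≤ ⊕ (B≤ ⊕ B≤))))
    where
    d²k²≤ : (d * k) * (d * k) ≤ n * k
    d²k²≤ = begin
      (d * k) * (d * k)        ≤⟨ *-monoˡ-≤ (d * k) (≤*ˡ d 1≤d) ⟩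
      (d * (d * k)) * (d * k)  ≡⟨ eq d k ⟩
      k * (d * d * d) * k      ≤⟨ *-monoˡ-≤ k kd³≤n ⟩
      n * k                    ∎
      where
      eq : ∀ d k → (d * (d * k)) * (d * k) ≡ k * (d * d * d) * k
      eq = solve-∀
    A≤ : n * (n * k + (d * (1 + k) * (d * (1 + k)) + d * (1 + k) * (d * (1 + k)))) ≲ n * (n * k) · 9
    A≤ = unit {n} ⊗ (unit {n * k} ⊕ (lift d²k²≤ (dk≤ ⊗ dk≤) ⊕ lift d²k²≤ (dk≤ ⊗ dk≤)))
    B≤ : n * (d * d) ≲ n * (n * k) · 1
    B≤ = unit {n} ⊗ lift (≤-trans (≤-trans (≤*ˡ d 1≤d) (≤-reflexive (sym (*-assoc d d d)))) (≤-trans d³≤n n≤nk)) unit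

  nnk≤X : n * (n * k) ≤ X
  nnk≤X = ≤*ˡ (t * t * t) (*-mono-≤ (*-mono-≤ 1≤t 1≤t) 1≤t)

  light≤ : ∀ {δ c} → δ ≲ W · c → let Q = (ζ + d * (1 + d * (1 + k))) * δ in
           star₃Bound {n} d k + (Q + (Q + Q)) ≲ X · (30 + (7 * c + (7 * c + 7 * c)))
  light≤ {δ} {c} δ≤ = lift nnk≤X star₃≤ ⊕ (Q≤ ⊕ (Q≤ ⊕ Q≤))
    where
    -- Here t³ arises: `T₀` contributes one factor `t` and `W` two.
    T₀W≤X : T₀ * W ≤ X
    T₀W≤X = begin
      T₀ * W                                      ≡⟨ eq t d k n ⟩
      t * t * t * (n * (k * (d * d * d) * k))     ≤⟨ *-monoʳ-≤ (t * t * t) (*-monoʳ-≤ n (*-monoˡ-≤ k kd³≤n)) ⟩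
      X                                           ∎
      where
      eq : ∀ t d k n → t * (d * (d * k)) * (t * t * d * k * n) ≡ t * t * t * (n * (k * (d * d * d) * k))
      eq = solve-∀
    Q≤ : (ζ + d * (1 + d * (1 + k))) * δ ≲ X · (7 * c)
    Q≤ = lift T₀W≤X ((ζ≤ ⊕ lift (≤*ˡ t 1≤t) ddk≤) ⊗ δ≤)

  δ≤ : α + (d * 4 * n + d * 4 * n) ≲ W · 57
  δ≤ = α≤ ⊕ (dn≤ ⊕ dn≤)
    where
    dn≤ : d * 4 * n ≲ W · 4
    dn≤ = lift (begin
      d * n                   ≤⟨ ≤*ˡ (t * t * k) (*-mono-≤ (*-mono-≤ 1≤t 1≤t) 1≤k) ⟩
      t * t * k * (d * n)     ≡⟨ eq t d k n ⟩
      W                       ∎) (scaled {d} 4 ⊗ unit {n})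
      where
      eq : ∀ t d k n → t * t * k * (d * n) ≡ t * t * d * k * n
      eq = solve-∀

  N₃≤K₀ : N₃ ≤ K₀
  N₃≤K₀ = *-monoʳ-≤ n (*-monoʳ-≤ n n≤nk)

module SingleNumerics (n t d k : ℕ) (1≤t : 1 ≤ t) (1≤d : 1 ≤ d) (1≤k : 1 ≤ k) (kd³≤n : k * (d * d * d) ≤ n) where

  open ≤-Reasoning
  open Numerics n t d k 1≤t 1≤d 1≤k kd³≤n

  K₁ : ℕ
  K₁ = t * t * t * K₀

  σ π viaBound fork matching freeBound : ℕ
  σ = d + d
  π = σ + d * d * 4
  viaBound = n * (π * (α + (υ * (π + (π + π)) + υ * (π + (π + π)))))
  fork = n * (σ * (σ * n))
  matching = n * (σ * (n * σ))
  freeBound = star₃Bound {n} d k + (Q + (Q + Q))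
    where Q = (ζ + d * (1 + d * (1 + k))) * (α + (d * 4 * n + d * 4 * n))

  σ≤ : σ ≲ d · 2
  σ≤ = unit {d} ⊕ unit {d}

  π≤ : π ≲ d * d · 6
  π≤ = lift (≤*ˡ d 1≤d) σ≤ ⊕ scaled {d * d} 4

  d²≤n : d * d ≤ n
  d²≤n = ≤-trans (≤-trans (≤*ˡ d 1≤d) (≤-reflexive (sym (*-assoc d d d)))) d³≤n

  N₃≤K₁ : N₃ ≤ K₁
  N₃≤K₁ = ≤-trans N₃≤K₀ (≤*ˡ (t * t * t) (*-mono-≤ (*-mono-≤ 1≤t 1≤t) 1≤t))

  free≤ : n * freeBound ≲ K₁ · 1227
  free≤ = lift (≤-reflexive (eq t k n)) (unit {n} ⊗ light≤ δ≤)
    where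
    eq : ∀ t k n → n * (t * t * t * (n * (n * k))) ≡ t * t * t * (n * (n * (n * k)))
    eq = solve-∀

  via≤ : viaBound ≲ K₁ · 942
  via≤ = lift n³t²≤K₁ (unit {n} ⊗ split {π} (lift πW (π≤ ⊗ α≤)) (split {π} S≤ S≤))
    where
    n³t²≤K₁ : n * (t * t * (n * n)) ≤ K₁
    n³t²≤K₁ = begin
      n * (t * t * (n * n))        ≡⟨ eq t n ⟩
      t * t * N₃                   ≤⟨ *-mono-≤ (≤-trans (≤*ˡ t 1≤t) (≤-reflexive (sym (*-assoc t t t)))) N₃≤K₀ ⟩
      K₁                           ∎
      where
      eq : ∀ t n → n * (t * t * (n * n)) ≡ t * t * (n * (n * n))
      eq = solve-∀
    πW : d * d * W ≤ t * t * (n * n)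
    πW = ≤-trans (≤-reflexive (eq t d k n)) (*-monoʳ-≤ (t * t) (*-monoˡ-≤ n kd³≤n))
      where
      eq : ∀ t d k n → d * d * (t * t * d * k * n) ≡ t * t * (k * (d * d * d) * n)
      eq = solve-∀
    S≤ : π * (υ * (π + (π + π))) ≲ t * t * (n * n) · 324
    S≤ = lift (≤-trans (≤-reflexive (eq t d)) (*-mono-≤ (≤*ˡ t 1≤t) (*-mono-≤ d³≤n d³≤n))) (π≤ ⊗ (υ≤ ⊗ (π≤ ⊕ (π≤ ⊕ π≤))))
      where
      eq : ∀ t d → d * d * (t * (d * d) * (d * d)) ≡ t * (d * d * d * (d * d * d))
      eq = solve-∀

  fork≤ : fork ≲ K₁ · 4
  fork≤ = lift (≤-trans (*-monoʳ-≤ n (≤-trans (≤-reflexive (sym (*-assoc d d n))) (*-monoˡ-≤ n d²≤n))) N₃≤K₁)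
    (unit {n} ⊗ (σ≤ ⊗ (σ≤ ⊗ unit {n})))

  matching≤ : matching ≲ K₁ · 4
  matching≤ = lift (≤-trans (*-monoʳ-≤ n (≤-trans (≤-reflexive (eq d n)) (*-monoˡ-≤ n d²≤n))) N₃≤K₁)
    (unit {n} ⊗ (σ≤ ⊗ (unit {n} ⊗ σ≤)))
    where
    eq : ∀ d n → d * (n * d) ≡ d * d * n
    eq = solve-∀

  single≤ : (n * freeBound + (n * freeBound + (n * freeBound + n * freeBound)))
          + ((viaBound + (viaBound + (viaBound + (viaBound + (viaBound + viaBound)))))
          + ((fork + (fork + (fork + (fork + fork)))) + (matching + (matching + matching)))) ≲ K₁ · 10592
  single≤ = (free≤ ⊕ (free≤ ⊕ (free≤ ⊕ free≤)))
    ⊕ ((via≤ ⊕ (via≤ ⊕ (via≤ ⊕ (via≤ ⊕ (via≤ ⊕ via≤)))))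
    ⊕ ((fork≤ ⊕ (fork≤ ⊕ (fork≤ ⊕ (fork≤ ⊕ fork≤)))) ⊕ (matching≤ ⊕ (matching≤ ⊕ matching≤))))

single≤ : ∀ n d k → 1 ≤ d → 1 ≤ k → k * (d * d * d) ≤ n → ∀ {E : Fin n → Fin n → Fin n → Fin n → Bool} (G : Graph₄ E)
          i₀ l₀ ¬star → Single.singleBound G d k i₀ l₀ ¬star ≲ n * (n * (n * k)) · 10592
single≤ n d k 1≤d 1≤k h G i₀ l₀ ¬star =
  lift (≤-reflexive (*-identityˡ (n * (n * (n * k))))) (SingleNumerics.single≤ n 1 d k ≤-refl 1≤d 1≤k h)

open _≲_·_

module TopNumerics (n t d k : ℕ) (1≤t : 1 ≤ t) (1≤d : 1 ≤ d) (1≤k : 1 ≤ k) (kd³≤n : k * (d * d * d) ≤ n)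
  (t≤k : t ≤ k) (t⁴≤d : t * t * t * t ≤ d) where

  open ≤-Reasoning
  open Numerics n t d k 1≤t 1≤d 1≤k kd³≤n public

  τ lightBound : ℕ
  τ = t * d * d
  lightBound = star₃Bound {n} d k + (Q + (Q + Q))
    where Q = (ζ + d * (1 + d * (1 + k))) * α

  td³≤n : t * (d * d * d) ≤ n
  td³≤n = ≤-trans (*-monoˡ-≤ (d * d * d) t≤k) kd³≤n

  τlight≤ : τ * lightBound ≲ N₃ · 1059
  τlight≤ = lift τX≤N₃ (unit {τ} ⊗ light≤ α≤)
    where
    -- One factor `t` comes from `τ` and three from `X`; trading their product for `d` completes
    -- `d * d` to the cube in `kd³≤n`.
    τX≤N₃ : τ * X ≤ N₃
    τX≤N₃ = begin
      τ * X                                          ≡⟨ eq t d k n ⟩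
      (t * t * t * t) * (d * d * k) * (n * n)        ≤⟨ *-monoˡ-≤ (n * n) (*-monoˡ-≤ (d * d * k) t⁴≤d) ⟩
      d * (d * d * k) * (n * n)                      ≡⟨ cong (_* (n * n)) (eq′ d k) ⟩
      k * (d * d * d) * (n * n)                      ≤⟨ *-monoˡ-≤ (n * n) kd³≤n ⟩
      N₃                                             ∎
      where
      eq : ∀ t d k n → t * d * d * (t * t * t * (n * (n * k))) ≡ (t * t * t * t) * (d * d * k) * (n * n)
      eq = solve-∀
      eq′ : ∀ d k → d * (d * d * k) ≡ k * (d * d * d)
      eq′ = solve-∀

  a≤ : τ * (d * (n * n)) ≲ N₃ · 1
  a≤ = lift (≤-trans (≤-reflexive (eq t d n)) (*-monoˡ-≤ (n * n) td³≤n)) unit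
    where
    eq : ∀ t d n → t * d * d * (d * (n * n)) ≡ t * (d * d * d) * (n * n)
    eq = solve-∀

  μ≤ : τ * (μ * n) ≲ N₃ · 11
  μ≤ = splitʳ τ n (n * d + (D * D + D * D)) (d * n + d * n)
    (splitʳ τ n (n * d) (D * D + D * D) nd≤ (splitʳ τ n (D * D) (D * D) DD≤ DD≤)) (splitʳ τ n (d * n) (d * n) dn≤ dn≤)
    where
    dn≤ : τ * (d * n * n) ≲ N₃ · 1
    dn≤ = below (≤-reflexive (cong (τ *_) (*-assoc d n n))) a≤
    nd≤ : τ * (n * d * n) ≲ N₃ · 1
    nd≤ = below (≤-reflexive (cong (λ m → τ * (m * n)) (*-comm n d))) dn≤
    DD≤ : τ * (D * D * n) ≲ N₃ · 4
    DD≤ = lift (≤-trans (≤-reflexive (eq t d n)) (*-mono-≤ td³≤n (*-monoˡ-≤ n d³≤n))) (unit {τ} ⊗ (d1d≤ ⊗ d1d≤ ⊗ unit {n}))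
      where
      eq : ∀ t d n → t * d * d * (d * d * (d * d) * n) ≡ t * (d * d * d) * (d * d * d * n)
      eq = solve-∀

  XY XH : ℕ
  XY = lightBound + (a + (a + (a + (m + (m + m)))))
    where
    a = ρ * (n * n)
    m = (μ + (υ * υ + υ * υ) + (ρ * n + ρ * n)) * n
  XH = lightBound + (a + (a + (a + (m + (m + m)))))
    where
    a = d * (n * n)
    m = μ * n

  XH≤ : τ * XH ≲ N₃ · 1095
  XH≤ = split {τ} τlight≤ (split {τ} a≤ (split {τ} a≤ (split {τ} a≤ (split {τ} μ≤ (split {τ} μ≤ μ≤)))))

  kN₃≡K₀ : k * N₃ ≡ K₀
  kN₃≡K₀ = eq k n
    where
    eq : ∀ k n → k * (n * (n * n)) ≡ n * (n * (n * k))
    eq = solve-∀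

  tN₃≤K₀ : t * N₃ ≤ K₀
  tN₃≤K₀ = ≤-trans (*-monoˡ-≤ N₃ t≤k) (≤-reflexive kN₃≡K₀)

  -- Only order `τ` vertices are charged with `XY`, so a factor `k` more than in `XH≤` is available.
  -- It pays for the additional `t` in `ρ` and `υ`, by `t≤k`.
  XY≤ : τ * XY ≲ K₀ · 1164
  XY≤ = split {τ} (lift N₃≤K₀ τlight≤) (split {τ} ρ² (split {τ} ρ² (split {τ} ρ² (split {τ} m≤ (split {τ} m≤ m≤)))))
    where
    mono : τ * (t * d * (n * n)) ≤ K₀
    mono = begin
      τ * (t * d * (n * n))             ≡⟨ eq t d n ⟩
      t * (t * (d * d * d) * (n * n))   ≤⟨ *-monoʳ-≤ t (*-monoˡ-≤ (n * n) td³≤n) ⟩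
      t * N₃                            ≤⟨ tN₃≤K₀ ⟩
      K₀                                ∎
      where
      eq : ∀ t d n → t * d * d * (t * d * (n * n)) ≡ t * (t * (d * d * d) * (n * n))
      eq = solve-∀
    ρ² : τ * (ρ * (n * n)) ≲ K₀ · 2
    ρ² = lift mono (unit {τ} ⊗ (ρ≤ ⊗ unit {n * n}))
    ρn≤ : τ * (ρ * n * n) ≲ K₀ · 2
    ρn≤ = below (≤-reflexive (cong (τ *_) (*-assoc ρ n n))) ρ²
    υυ≤ : τ * (υ * υ * n) ≲ K₀ · 9
    υυ≤ = lift (begin
      τ * (t * (d * d) * (t * (d * d)) * n)                       ≡⟨ eq t d n ⟩
      t * (t * (d * d * d) * (t * (d * d * d) * n))               ≤⟨ *-monoʳ-≤ t (*-mono-≤ td³≤n (*-monoˡ-≤ n td³≤n)) ⟩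
      t * N₃                                                      ≤⟨ tN₃≤K₀ ⟩
      K₀                                                          ∎) (unit {τ} ⊗ (υ≤ ⊗ υ≤ ⊗ unit {n}))
      where
      eq : ∀ t d n → t * d * d * (t * (d * d) * (t * (d * d)) * n) ≡ t * (t * (d * d * d) * (t * (d * d * d) * n))
      eq = solve-∀
    m≤ : τ * ((μ + (υ * υ + υ * υ) + (ρ * n + ρ * n)) * n) ≲ K₀ · 33
    m≤ = splitʳ τ n (μ + (υ * υ + υ * υ)) (ρ * n + ρ * n)
      (splitʳ τ n μ (υ * υ + υ * υ) (lift N₃≤K₀ μ≤) (splitʳ τ n (υ * υ) (υ * υ) υυ≤ υυ≤)) (splitʳ τ n (ρ * n) (ρ * n) ρn≤ ρn≤)

  1≤n : 1 ≤ n
  1≤n = ≤-trans (*-mono-≤ 1≤k (*-mono-≤ (*-mono-≤ 1≤d 1≤d) 1≤d)) kd³≤n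

  1≤τ : 1 ≤ τ
  1≤τ = *-mono-≤ (*-mono-≤ 1≤t 1≤d) 1≤d

  -- By XH≤, the factor 8 makes the edges counted at heavy vertices at most an
  -- eighth of all edges.
  Δ : ℕ
  Δ = N₃ * (1095 * 8)

  combine : ∀ {N r z y h l s} → r ≤ t + (t + (t + t)) → z ≤ ζ → y ≤ ρ + υ → l * τ ≤ z * Δ → h * Δ ≤ N * τ
          → s ≲ K₀ · 10592 → let p = r * N₃ + (l + (y * XY + h * XH)) in
            N ≤ p + (p + (p + (p + s))) → N ≲ K₀ · 348096
  combine {N} {r} {z} {y} {h} {l} {s} r≤ z≤ y≤ l≤ h≤ s≤ N≤ =
    below total (_⊕_ {c = 40864 * 8} {10592 * 2} (times {c = 40864} 8 q≤) (times {c = 10592} 2 s≤))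
    where
    times : ∀ {a m c} e → a ≲ m · c → a * e ≲ m · (c * e)
    times {a} {m} {c} e (bounded p) = bounded (≤-trans (*-monoˡ-≤ e p) (≤-reflexive (*-assoc m c e)))
    q : ℕ
    q = r * N₃ + (l + y * XY)
    r≤′ : r * N₃ ≲ K₀ · 4
    r≤′ = below (*-monoˡ-≤ N₃ r≤) (lift tN₃≤K₀ ((unit {t} ⊕ (unit {t} ⊕ (unit {t} ⊕ unit {t}))) ⊗ unit {N₃}))
    -- At most `ζ` vertices, each of degree at most `Δ` over `τ`: the factor `t * d * d` cancels and
    -- leaves order k n³.
    l≤′ : l ≲ K₀ · 35040
    l≤′ = bounded (*-cancelʳ-≤ l (K₀ * 35040) τ ⦃ >-nonZero 1≤τ ⦄ (begin
      l * τ                ≤⟨ ≤-trans l≤ (*-monoˡ-≤ Δ z≤) ⟩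
      ζ * Δ                ≤⟨ bound (ζ≤ ⊗ scaled {N₃} (1095 * 8)) ⟩
      T₀ * N₃ * 35040      ≡⟨ eq t d k n 35040 ⟩
      K₀ * 35040 * τ       ∎))
      where
      eq : ∀ t d k n c → t * (d * (d * k)) * (n * (n * n)) * c ≡ n * (n * (n * k)) * c * (t * d * d)
      eq = solve-∀
    y≤′ : y * XY ≲ K₀ · 5820
    y≤′ = below (begin
      y * XY           ≤⟨ *-monoˡ-≤ XY (≤-trans y≤ (bound (ρ+υ≤))) ⟩
      τ * 5 * XY       ≡⟨ eq τ XY 5 ⟩
      τ * XY * 5       ∎) (times {c = 1164} 5 XY≤)
      where
      eq : ∀ a b c → a * c * b ≡ a * b * c
      eq = solve-∀
      ρ+υ≤ : ρ + υ ≲ τ · 5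
      ρ+υ≤ = lift (≤-trans (≤*ˡ d 1≤d) (≤-reflexive (*-comm d (t * d)))) ρ≤ ⊕ lift (≤-reflexive (sym (*-assoc t d d))) υ≤
    q≤ : q ≲ K₀ · 40864
    q≤ = _⊕_ {c = 4} {40860} r≤′ (_⊕_ {c = 35040} {5820} l≤′ y≤′)
    x≤ : h * XH * 8 ≤ N
    x≤ = *-cancelʳ-≤ (h * XH * 8) N (N₃ * 1095) ⦃ >-nonZero (*-mono-≤ (*-mono-≤ 1≤n (*-mono-≤ 1≤n 1≤n)) (s≤s (z≤n {1094}))) ⦄ (begin
      h * XH * 8 * (N₃ * 1095)      ≡⟨ eq h XH 8 N₃ 1095 ⟩
      h * (N₃ * (1095 * 8)) * XH    ≤⟨ *-monoˡ-≤ XH h≤ ⟩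
      N * τ * XH                    ≡⟨ *-assoc N τ XH ⟩
      N * (τ * XH)                  ≤⟨ *-monoʳ-≤ N (bound XH≤) ⟩
      N * (N₃ * 1095)               ∎)
      where
      eq : ∀ h x e m c → h * x * e * (m * c) ≡ h * (m * (c * e)) * x
      eq = solve-∀
    -- In twice the inequality the heavy terms amount to `h * XH * 8`, which is at most one `N` and
    -- cancels.
    total : N ≤ q * 8 + s * 2
    total = +-cancelʳ-≤ N N (q * 8 + s * 2) (begin
      N + N                           ≤⟨ +-mono-≤ N≤ N≤ ⟩
      (p + (p + (p + (p + s)))) + (p + (p + (p + (p + s))))  ≡⟨ eq (r * N₃) l (y * XY) (h * XH) s ⟩
      q * 8 + s * 2 + h * XH * 8      ≤⟨ +-monoʳ-≤ (q * 8 + s * 2) x≤ ⟩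
      q * 8 + s * 2 + N               ∎)
      where
      p = r * N₃ + (l + (y * XY + h * XH))
      eq : ∀ a b c x s → let p = a + (b + (c + x)) in
           (p + (p + (p + (p + s)))) + (p + (p + (p + (p + s)))) ≡ (a + (b + c)) * 8 + s * 2 + x * 8
      eq = solve-∀

-- The bound on the number of ordered edges

edge-bound : ∀ n t d k → 1 ≤ t → (i₀ : Fin d) (l₀ : Fin k) → k * (d * d * d) ≤ n → t ≤ k → t * t * t * t ≤ d
           → ∀ {E : Fin n → Fin n → Fin n → Fin n → Bool} → Graph₄ E
           → ¬ Family (Fin t) {Cone (Fin d × Cone (Fin d × Cone (Fin k)))} (λ _ → IsStar₄ E) ∅
           → #₄ E ≤ n * (n * (n * k)) * 348096
edge-bound n t d k 1≤t i₀ l₀ kd³≤n t≤k t⁴≤d {E} G ¬stars₄ = ≤-stable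
  (rich-set t RichE ¬RichE-many >>= λ (rE , #rE , ¬richE) →
   rich-set t RichM ¬RichM-many >>= λ (rM , #rM , ¬richM) →
   stuck t (coneᶠ (finᶠ ×ᶠ coneᶠ (finᶠ ×ᶠ starᶠ k))) (IsStar₄ E) ∅ ¬stars₄ >>= λ (Z , #Z , ¬star₄) →
   stuck t (starᶠ d) (IsStar A) ∅ ¬A-stars >>= λ (YA , #YA , ¬starA) →
   stuck t (coneᶠ (finᶠ ×ᶠ starᶠ d)) (IsStar₃ M) ∅ ¬M-stars₃ >>= λ (YM , #YM , ¬starM) done →
   let rA = high A ρ
       rT = high T ρ
       -- Each of the four exceptional sets has at most `t` vertices, so the trivial degree bound n³
       -- costs only order t n³, at most k n³.
       R = rE ∪ᵇ (rM ∪ᵇ (rA ∪ᵇ rT))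
       Y = YA ∪ᵇ YM
       #R≤ : # R ≤ t + (t + (t + t))
       #R≤ = ≤-trans (#∪≤ rE _) (+-mono-≤ #rE (≤-trans (#∪≤ rM _) (+-mono-≤ #rM (≤-trans (#∪≤ rA rT)
               (+-mono-≤ (#high≤ {g = A} ¬A-stars) (#high≤ {g = T} ¬T-stars))))))
       open Parts R Z Y
         (λ v h → ¬richE v (∨-false⁻ˡ h))
         (λ v h → ¬richM v (∨-false⁻ˡ (∨-false⁻ʳ {rE v} h)))
         (λ v h → low⁻ A ρ (∨-false⁻ˡ (∨-false⁻ʳ {rM v} (∨-false⁻ʳ {rE v} h))))
         (λ v h → low⁻ T ρ (∨-false⁻ʳ {rA v} (∨-false⁻ʳ {rM v} (∨-false⁻ʳ {rE v} h))))
         ¬star₄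
         (λ c → ¬starA (shrink (λ i → ∨-false⁻ˡ) c))
         (λ c → ¬starM (shrink (λ i → ∨-false⁻ʳ {YA i}) c))
   in done (bound (combine {h = # heavy} {l = light-sum} #R≤ (from∅ #Z) (≤-trans (#∪≤ YA YM) (+-mono-≤ (from∅ #YA) (from∅ #YM)))
        light-sum≤ #heavy≤ (single≤ n d k 1≤d 1≤k kd³≤n (∖⁴-graph Z) i₀ l₀ star-free) total)))
  where
  1≤d : 1 ≤ d
  1≤d = ≤-trans (s≤s z≤n) (toℕ<n i₀)
  1≤k : 1 ≤ k
  1≤k = ≤-trans (s≤s z≤n) (toℕ<n l₀)
  open TopNumerics n t d k 1≤t 1≤d 1≤k kd³≤n t≤k t⁴≤d using (Δ; combine)
  open Combine G t d k i₀ l₀ ¬stars₄ Δ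
  from∅ : ∀ {a b} → a ≤ # (∅ {n}) + b → a ≤ b
  from∅ {a} {b} h = ≤-trans h (≤-reflexive (cong (_+ b) (#∅ n)))

-- Between lists of edges and adjacency predicates; decidability

module _ {n : ℕ} where

  open import Data.Fin.Subset using (Subset; ⁅_⁆; _∪_; ∣_∣; inside; outside) renaming (⊥ to ∅ˢ)
  open import Data.Fin.Subset.Properties using (∪-comm; ∪-assoc; ∪-idem; ∪-identityˡ; ∪-identityʳ; ∣⁅x⁆∣≡1)
  open import Data.List using (List; []; _∷_; length)
  open import Data.List.Membership.DecPropositional (≡-dec {n = n} _≟ᵇ_) using (_∈_; _∈?_)
  open import Data.List.Relation.Unary.All using (All; []; _∷_; lookup)
  open import Data.List.Relation.Unary.Any using (here; there)
  open import Data.List.Relation.Unary.Unique.Propositional using (Unique)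
  open import Data.List.Relation.Unary.AllPairs using ([]; _∷_)
  open import Data.Vec using ([]; _∷_)

  private
    V = Fin n

  quad : V → V → V → V → Subset n
  quad v u w x = ⁅ v ⁆ ∪ ⁅ u ⁆ ∪ ⁅ w ⁆ ∪ ⁅ x ⁆

  ∪-left-comm : (p q r : Subset n) → p ∪ q ∪ r ≡ q ∪ p ∪ r
  ∪-left-comm p q r = trans (sym (∪-assoc p q r)) (trans (cong (_∪ r) (∪-comm p q)) (∪-assoc q p r))

  opaque
    adjacent : List (Subset n) → V → V → V → V → Bool
    adjacent es v u w x = does (quad v u w x ∈? es)

    adjacent⁻ : ∀ es {v u w x} → adjacent es v u w x ≡ true → quad v u w x ∈ es
    adjacent⁻ es {v} {u} {w} {x} = does⁻ {d = quad v u w x ∈? es}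

    adjacent⁺ : ∀ es {v u w x} → quad v u w x ∈ es → adjacent es v u w x ≡ true
    adjacent⁺ es {v} {u} {w} {x} = dec-true (quad v u w x ∈? es)

  ∣∪∣≤ : ∀ {m} (p q : Subset m) → ∣ p ∪ q ∣ ≤ ∣ p ∣ + ∣ q ∣
  ∣∪∣≤ []            []            = z≤n
  ∣∪∣≤ (outside ∷ p) (outside ∷ q) = ∣∪∣≤ p q
  ∣∪∣≤ (outside ∷ p) (inside  ∷ q) = ≤-trans (s≤s (∣∪∣≤ p q)) (≤-reflexive (sym (+-suc ∣ p ∣ ∣ q ∣)))
  ∣∪∣≤ (inside  ∷ p) (outside ∷ q) = s≤s (∣∪∣≤ p q)
  ∣∪∣≤ (inside  ∷ p) (inside  ∷ q) = s≤s (≤-trans (∣∪∣≤ p q) (+-monoʳ-≤ ∣ p ∣ (n≤1+n ∣ q ∣)))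

  -- Symmetry is that of unions. A repeated vertex would leave at most three elements, against
  -- uniformity.
  adjacent-graph : ∀ {es} → All (λ e → ∣ e ∣ ≡ 4) es → Graph₄ (adjacent es)
  adjacent-graph {es} uniform = record
    { swap₁₂   = λ {v} {u} {w} {x} → transport (∪-left-comm ⁅ v ⁆ ⁅ u ⁆ (⁅ w ⁆ ∪ ⁅ x ⁆))
    ; swap₂₃   = λ {v} {u} {w} {x} → transport (cong (⁅ v ⁆ ∪_) (∪-left-comm ⁅ u ⁆ ⁅ w ⁆ ⁅ x ⁆))
    ; swap₃₄   = λ {v} {u} {w} {x} → transport (cong (λ p → ⁅ v ⁆ ∪ ⁅ u ⁆ ∪ p) (∪-comm ⁅ w ⁆ ⁅ x ⁆))
    ; distinct = λ { {v} {u} {w} {x} h refl → <⇒≢ (s≤s (three v w x)) (lookup uniform (adjacent⁻ es h)) } }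
    where
    transport : ∀ {v u w x v′ u′ w′ x′} → quad v u w x ≡ quad v′ u′ w′ x′
              → adjacent es v u w x ≡ true → adjacent es v′ u′ w′ x′ ≡ true
    transport eq h = adjacent⁺ es (subst (_∈ es) eq (adjacent⁻ es h))
    three : ∀ v w x → ∣ quad v v w x ∣ ≤ 3
    three v w x = begin
      ∣ ⁅ v ⁆ ∪ ⁅ v ⁆ ∪ ⁅ w ⁆ ∪ ⁅ x ⁆ ∣  ≡⟨ cong ∣_∣ (trans (sym (∪-assoc ⁅ v ⁆ ⁅ v ⁆ (⁅ w ⁆ ∪ ⁅ x ⁆))) (cong (_∪ ⁅ w ⁆ ∪ ⁅ x ⁆) (∪-idem ⁅ v ⁆))) ⟩
      ∣ ⁅ v ⁆ ∪ ⁅ w ⁆ ∪ ⁅ x ⁆ ∣          ≤⟨ ≤-trans (∣∪∣≤ ⁅ v ⁆ _) (+-monoʳ-≤ ∣ ⁅ v ⁆ ∣ (∣∪∣≤ ⁅ w ⁆ ⁅ x ⁆)) ⟩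
      ∣ ⁅ v ⁆ ∣ + (∣ ⁅ w ⁆ ∣ + ∣ ⁅ x ⁆ ∣)  ≡⟨ cong₂ _+_ (∣⁅x⁆∣≡1 v) (cong₂ _+_ (∣⁅x⁆∣≡1 w) (∣⁅x⁆∣≡1 x)) ⟩
      3                                  ∎
      where open ≤-Reasoning

  ∣∣≡0⇒∅ : ∀ {m} (p : Subset m) → ∣ p ∣ ≡ 0 → p ≡ ∅ˢ
  ∣∣≡0⇒∅ []            _ = refl
  ∣∣≡0⇒∅ (outside ∷ p) h = cong (outside ∷_) (∣∣≡0⇒∅ p h)

  remove-one : ∀ {m c} (p : Subset m) → ∣ p ∣ ≡ suc c → ∃[ v ] ∃[ q ] p ≡ ⁅ v ⁆ ∪ q × ∣ q ∣ ≡ c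
  remove-one (outside ∷ p) h with remove-one p h
  ... | v , q , eq , c = suc v , outside ∷ q , cong (outside ∷_) eq , c
  remove-one (inside ∷ p) h = zero , outside ∷ p , cong (inside ∷_) (sym (∪-identityˡ p)) , suc-injective h

  as-quad : (e : Subset n) → ∣ e ∣ ≡ 4 → ∃[ v ] ∃[ u ] ∃[ w ] ∃[ x ] e ≡ quad v u w x
  as-quad e h₀ =
    let (v , e₁ , eq₁ , h₁) = remove-one e h₀
        (u , e₂ , eq₂ , h₂) = remove-one e₁ h₁
        (w , e₃ , eq₃ , h₃) = remove-one e₂ h₂
        (x , e₄ , eq₄ , h₄) = remove-one e₃ h₃
        eq₃′ = trans eq₃ (cong (⁅ w ⁆ ∪_) (trans eq₄ (trans (cong (⁅ x ⁆ ∪_) (∣∣≡0⇒∅ e₄ h₄)) (∪-identityʳ ⁅ x ⁆))))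
    in v , u , w , x , trans eq₁ (cong (⁅ v ⁆ ∪_) (trans eq₂ (cong (⁅ u ⁆ ∪_) eq₃′)))

  -- One ordering of each edge is enough, as the constant absorbs the others. Uniqueness keeps the
  -- orderings of the head from being counted again in the tail.
  length≤#adjacent : ∀ {es} → Unique es → All (λ e → ∣ e ∣ ≡ 4) es → length es ≤ #₄ (adjacent es)
  length≤#adjacent []            []        = z≤n
  length≤#adjacent {e ∷ es} (fresh ∷ unique) (h ∷ uniform) = begin
    1 + length es                                                       ≤⟨ +-mono-≤ hit (length≤#adjacent unique uniform) ⟩
    sum₄ new + #₄ (adjacent es)                                         ≡⟨ sym (sum₄-+ new old) ⟩
    sum₄ (λ v u w x → new v u w x + old v u w x)                        ≤⟨ sum₄-mono pointwise ⟩
    #₄ (adjacent (e ∷ es))                                              ∎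
    where
    open ≤-Reasoning
    new old : V → V → V → V → ℕ
    new v u w x = ⟦ does (≡-dec _≟ᵇ_ (quad v u w x) e) ⟧
    old v u w x = ⟦ adjacent es v u w x ⟧
    hit : 1 ≤ sum₄ new
    hit with as-quad e h
    ... | v , u , w , x , eq = ≤-trans (1≤⟦⟧ (dec-true (≡-dec _≟ᵇ_ (quad v u w x) e) (sym eq)))
      (≤-trans (≤-trans (≤-sum (new v u w) x) (≤-sum (λ w → sum (new v u w)) w))
               (≤-trans (≤-sum (λ u → sum₂ (new v u)) u) (≤-sum (λ v → sum₃ (new v)) v)))
    pointwise : ∀ v u w x → new v u w x + old v u w x ≤ ⟦ adjacent (e ∷ es) v u w x ⟧
    pointwise v u w x with ≡-dec _≟ᵇ_ (quad v u w x) e | true⊎false (adjacent es v u w x)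
    ... | yes eq | inj₁ a = ⊥-elim (lookup fresh (adjacent⁻ es a) (sym eq))
    ... | yes eq | inj₂ a rewrite a = 1≤⟦⟧ (adjacent⁺ (e ∷ es) (here eq))
    ... | no _   | _ = ⟦⟧-mono λ a → adjacent⁺ (e ∷ es) (there (adjacent⁻ es a))

  -- The values are searched one by one; `P` has to respect pointwise equality because a function
  -- need not be equal to the one rebuilt from its values.
  exists-function? : ∀ m (P : (Fin m → V) → Set) → (∀ {f g} → (∀ i → f i ≡ g i) → P f → P g)
                   → (∀ f → Dec (P f)) → Dec (∃ P)
  exists-function? zero    P resp P? = map′ (none ,_) (λ (f , p) → resp (λ ()) p) (P? none)
    where
    none : Fin 0 → V
    none ()
  exists-function? (suc m) P resp P? =
    map′ (λ (x , f , p) → x ∷ᶠ f , p) (λ (f , p) → f zero , f ∘ suc , resp (λ { zero → refl ; (suc i) → refl }) p)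
      (any? λ x → exists-function? m (λ f → P (x ∷ᶠ f)) (λ h → resp (λ { zero → refl ; (suc i) → h i })) (λ f → P? (x ∷ᶠ f)))

  -- The conclusion of the theorem is a construction, not an inequality. A finite search through all
  -- maps decides it, which removes the double negation left by the counting.
  stars₄-stable : ∀ {E : V → V → V → V → Bool} t c d k
                → ¬ ¬ Family (Fin t) {Cone (Fin c × Cone (Fin d × Cone (Fin k)))} (λ _ → IsStar₄ E) ∅
                → Family (Fin t) {Cone (Fin c × Cone (Fin d × Cone (Fin k)))} (λ _ → IsStar₄ E) ∅
  stars₄-stable {E} t c d k ¬¬c = toCopy (decidable-stable (exists-function? m P resp P?) (λ ¬P → ¬¬c (¬P ∘ fromCopy)))
    where
    I = Fin t × Cone (Fin c × Cone (Fin d × Cone (Fin k)))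
    m = t * (1 + c * (1 + d * (1 + k)))
    e : Fin m ↔ I
    e = finᶠ ×ᶠ coneᶠ (finᶠ ×ᶠ coneᶠ (finᶠ ×ᶠ starᶠ k))
    open Inverse e
    P : (Fin m → V) → Set
    P f = (∀ a b → f a ≡ f b → a ≡ b) × Each {J = Fin t} (λ _ → IsStar₄ E {c} {d} {k}) (f ∘ from)
    ext : ∀ {f g : I → V} → (∀ x → f x ≡ g x) → Each {J = Fin t} (λ _ → IsStar₄ E {c} {d} {k}) f
        → Each {J = Fin t} (λ _ → IsStar₄ E {c} {d} {k}) g
    ext h p s i j l = trans (cong-E (sym (h _)) (sym (h _)) (sym (h _)) (sym (h _))) (p s i j l)
      where
      cong-E : ∀ {v u w x v′ u′ w′ x′} → v ≡ v′ → u ≡ u′ → w ≡ w′ → x ≡ x′ → E v u w x ≡ E v′ u′ w′ x′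
      cong-E refl refl refl refl = refl
    resp : ∀ {f g} → (∀ i → f i ≡ g i) → P f → P g
    resp h (f-inj , p) = (λ a b eq → f-inj a b (trans (h a) (trans eq (sym (h b))))) , ext (h ∘ from) p
    P? : ∀ f → Dec (P f)
    P? f = (all? λ a → all? λ b → (f a ≟ f b) →-dec (a ≟ b))
         ×-dec (all? λ s → all? λ i → all? λ j → all? λ l → _ ≟ᵇ true)
    toCopy : ∃ P → Family (Fin t) (λ _ → IsStar₄ E) ∅
    toCopy (f , f-inj , p) = copy (f ∘ from) (λ {x} {y} eq →
      trans (sym (strictlyInverseˡ x)) (trans (cong to (f-inj _ _ eq)) (strictlyInverseˡ y))) (λ _ → refl) p
    fromCopy : Family (Fin t) (λ _ → IsStar₄ E) ∅ → ∃ P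
    fromCopy (copy f f-inj _ p) = f ∘ to ,
      (λ a b eq → trans (sym (strictlyInverseʳ a)) (trans (cong from (f-inj eq)) (strictlyInverseʳ b))) ,
      ext (λ x → cong f (sym (strictlyInverseˡ x))) p

-- Rounded parameters and the theorem

maxBelow-spec : ∀ (f : ℕ → ℕ) m x → f 0 ≤ m → f (maxBelow f m x) ≤ m
maxBelow-spec f m zero    h = h
maxBelow-spec f m (suc x) h with f (suc x) ≤? m
... | yes p = p
... | no  _ = maxBelow-spec f m x h

toDisjointCopies : ∀ {n} (G : FourGraph n) t d k
                 → Family (Fin t) {Cone (Fin d × Cone (Fin d × Cone (Fin k)))} (λ _ → IsStar₄ (adjacent (edges G))) ∅
                 → DisjointStarCopies G t d d k
toDisjointCopies G t d k (copy f f-inj _ p) =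
  f ∘ h , (λ {x} {y} eq → trans (sym (g∘h x)) (trans (cong g (f-inj eq)) (g∘h y))) ,
  λ s i j l → adjacent⁻ (edges G) (p s i j l)
  where
  h : Fin t × StarV d d k → Fin t × Cone (Fin d × Cone (Fin d × Cone (Fin k)))
  h (s , inj₁ tt)                          = s , inj₁ tt
  h (s , inj₂ (inj₁ i))                    = s , inj₂ (i , inj₁ tt)
  h (s , inj₂ (inj₂ (inj₁ (i , j))))       = s , inj₂ (i , inj₂ (j , inj₁ tt))
  h (s , inj₂ (inj₂ (inj₂ (i , j , l))))   = s , inj₂ (i , inj₂ (j , inj₂ l))
  g : Fin t × Cone (Fin d × Cone (Fin d × Cone (Fin k))) → Fin t × StarV d d k
  g (s , inj₁ tt)                           = s , inj₁ tt
  g (s , inj₂ (i , inj₁ tt))                = s , inj₂ (inj₁ i)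
  g (s , inj₂ (i , inj₂ (j , inj₁ tt)))     = s , inj₂ (inj₂ (inj₁ (i , j)))
  g (s , inj₂ (i , inj₂ (j , inj₂ l)))      = s , inj₂ (inj₂ (inj₂ (i , j , l)))
  g∘h : ∀ x → g (h x) ≡ x
  g∘h (s , inj₁ tt)                        = refl
  g∘h (s , inj₂ (inj₁ i))                  = refl
  g∘h (s , inj₂ (inj₂ (inj₁ (i , j))))     = refl
  g∘h (s , inj₂ (inj₂ (inj₂ (i , j , l)))) = refl

-- The successor makes the inequality strict, since k n³ is positive.
too-many-edges : ∀ c {k n N} → 1 ≤ k → 1 ≤ n → suc c * k * n ^ 3 ≤ N → N ≤ n * (n * (n * k)) * c → ⊥
too-many-edges c {k} {n} {N} 1≤k 1≤n lower upper = <⇒≱ (begin-strict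
  n * (n * (n * k)) * c                         <⟨ m<n+m _ (*-mono-≤ 1≤n (*-mono-≤ 1≤n (*-mono-≤ 1≤n 1≤k))) ⟩
  n * (n * (n * k)) + n * (n * (n * k)) * c     ≡⟨ eq c k n ⟩
  suc c * k * n ^ 3                             ∎) (≤-trans lower upper)
  where
  open ≤-Reasoning
  eq : ∀ c k n → n * (n * (n * k)) + n * (n * (n * k)) * c ≡ (1 + c) * k * (n * (n * (n * 1)))
  eq = solve-∀

find-stars : ∀ {k n} → 1 ≤ k → k ≤ n → (G : FourGraph n) → suc 348096 * k * n ^ 3 ≤ numEdges G
           → ∀ t d → k * d ^ 3 ≤ n → t ≤ k → t ^ 4 ≤ d → DisjointStarCopies G t d d k
-- For `t = 0` the family is empty, and `d = 0` would force `t = 0`; otherwise `Fin d` and `Fin k`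
-- are inhabited, as the counting requires.
find-stars _ _ G _ zero d _ _ _ = (λ ()) , (λ { {()} }) , λ ()
find-stars _ _ G _ (suc t) zero _ _ ()
find-stars {suc k} {n} 1≤k k≤n G many (suc t) (suc d) kd³≤n t≤k t⁴≤d =
  toDisjointCopies G (suc t) (suc d) (suc k) (stars₄-stable {E = adjacent (edges G)} (suc t) (suc d) (suc d) (suc k) λ ¬stars →
    too-many-edges 348096 1≤k (≤-trans 1≤k k≤n) many
      (≤-trans (length≤#adjacent (unique G) (uniform G))
        (edge-bound n (suc t) (suc d) (suc k) (s≤s z≤n) zero zero
          (subst (λ m → suc k * m ≤ n) (cube (suc d)) kd³≤n) t≤k (subst (_≤ suc d) (fourth (suc t)) t⁴≤d)
          (adjacent-graph (uniform G)) ¬stars)))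
  where
  cube : ∀ d → d * (d * (d * 1)) ≡ d * d * d
  cube = solve-∀
  fourth : ∀ t → t * (t * (t * (t * 1))) ≡ t * t * t * t
  fourth = solve-∀

theorem5p7 : ∃[ C ] ∀ (k n : ℕ) → 1 ≤ k → k ≤ n → (G : FourGraph n)
    → C * k * n ^ 3 ≤ numEdges G
    → DisjointStarCopies G (tParam k n) (dParam k n) (dParam k n) k
theorem5p7 = suc 348096 , λ k n 1≤k k≤n G many →
  find-stars 1≤k k≤n G many (tParam k n) (dParam k n)
    (maxBelow-spec (λ x → k * x ^ 3) n n (≤-trans (≤-reflexive (*-zeroʳ k)) z≤n))
    (m⊓n≤m k _)
    (≤-trans (^-monoˡ-≤ 4 (m⊓n≤n k (root4 (dParam k n)))) (maxBelow-spec (λ x → x ^ 4) (dParam k n) (dParam k n) z≤n))
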